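{- Let $\ell \ge 2$ be a fixed integer. Suppose $G$ is a $\mathcal{C}_{2\ell}$-free bipartite graph on $n$ vertices with parts $X$ and $Y$ and average degree $d \sim (n/2)^{1/\ell}$. Then for any $S \subseteq X$ and $T \subseteq Y$ we have $$e(S,T) = \frac{2d}{n}|S||T| + o(n^{1+1/\ell}).$$
   Context: Graphs are finite and simple. $C_j$ denotes the cycle of length $j$, and $\mathcal{C}_{2\ell} = \{C_4, C_6, \dots, C_{2\ell}\}$. A graph is $\mathcal{C}_{2\ell}$-free if it contains no member of $\mathcal{C}_{2\ell}$ as a (not necessarily induced) subgraph. For $S,T \subseteq V(G)$, $e(S,T)$ is the number of ordered pairs $(s,t)$ with $s \in S$, $t \in T$ and $st \in E(G)$. Asymptotic notation is as $n \to \infty$ with $\ell$ fixed: the statement concerns sequences of graphs $G$ (with $n \to \infty$) together with choices of $S,T$, $f \sim g$ means $f/g \to 1$, and the error term $o(n^{1+1/\ell})$ is uniform over all choices of $S$ and $T$. -}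

module Defs where

open import Data.Fin using (Fin; toℕ)
open import Data.Fin.Subset using (Subset; _∈_)
open import Data.Fin.Subset.Properties using (_∈?_)
open import Data.Integer using (+_)
open import Data.List using (allFin; cartesianProduct; filter; length; map)
open import Data.Nat as ℕ using (ℕ; suc; pred; NonZero)
open import Data.Nat.Divisibility using (_∣_)
open import Data.Nat.ListAction using (sum)
open import Data.Nat.Properties using (1+n≢n; ≤-pred; n≮0)
open import Data.Product using (Σ-syntax; ∃-syntax; _×_; _,_)
open import Data.Rational as ℚ using (ℚ; 0ℚ; 1ℚ; _/_)
open import Data.Sum using (_⊎_; inj₁; inj₂; swap)
open import Function.Definitions using (Injective)
open import Level using (0ℓ)
open import Relation.Binary using (Rel; Decidable; Symmetric)
open import Relation.Binary.PropositionalEquality using (_≡_; cong; subst; sym; trans)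
open import Relation.Nullary using (¬_)
open import Relation.Nullary.Decidable using (_×-dec_; _⊎-dec_)

record Graph (n : ℕ) : Set₁ where
  infix 4 _~_ _~?_
  field
    _~_      : Rel (Fin n) 0ℓ
    _~?_     : Decidable _~_
    ~-sym    : Symmetric _~_
    ~-irrefl : ∀ {v} → ¬ (v ~ v)

open Graph

-- H ⊑ G: G contains a copy of H as a (not necessarily induced) subgraph.
infix 4 _⊑_
_⊑_ : ∀ {m n} → Graph m → Graph n → Set
_⊑_ {m} {n} H G = Σ[ f ∈ (Fin m → Fin n) ]
  Injective _≡_ _≡_ f × (∀ u v → _~_ H u v → _~_ G (f u) (f v))

Next : ∀ {j} → Rel (Fin j) 0ℓ
Next {j} u v = (suc (toℕ u) ≡ toℕ v) ⊎ (suc (toℕ u) ≡ j × toℕ v ≡ 0)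

Next-irrefl : ∀ {j} → 3 ℕ.≤ j → {v : Fin j} → ¬ Next v v
Next-irrefl _ (inj₁ eq) = 1+n≢n eq
Next-irrefl 3≤j {v} (inj₂ (1+v≡j , v≡0)) =
  n≮0 (≤-pred (subst (3 ℕ.≤_) (trans (sym 1+v≡j) (cong suc v≡0)) 3≤j))

Next? : ∀ {j} → Decidable (Next {j})
Next? {j} u v = (suc (toℕ u) ℕ.≟ toℕ v) ⊎-dec ((suc (toℕ u) ℕ.≟ j) ×-dec (toℕ v ℕ.≟ 0))

Cycle : (j : ℕ) → 3 ℕ.≤ j → Graph j
Cycle j 3≤j = record
  { _~_      = λ u v → Next u v ⊎ Next v u
  ; _~?_     = λ u v → Next? u v ⊎-dec Next? v u
  ; ~-sym    = swap
  ; ~-irrefl = λ { (inj₁ p) → Next-irrefl 3≤j p ; (inj₂ p) → Next-irrefl 3≤j p }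
  }

-- G contains none of C₄, C₆, …, C₂ₗ; the even j ≥ 3 are 4, 6, 8, ….
EvenCycleFree : ∀ {n} → ℕ → Graph n → Set
EvenCycleFree ℓ G =
  ∀ j (3≤j : 3 ℕ.≤ j) → 2 ∣ j → j ℕ.≤ 2 ℕ.* ℓ → ¬ (Cycle j 3≤j ⊑ G)

record HasParts {n} (G : Graph n) (X Y : Subset n) : Set where
  field
    cover    : ∀ v → v ∈ X ⊎ v ∈ Y
    disjoint : ∀ {v} → v ∈ X → ¬ (v ∈ Y)
    X-indep  : ∀ {u v} → u ∈ X → v ∈ X → ¬ (_~_ G u v)
    Y-indep  : ∀ {u v} → u ∈ Y → v ∈ Y → ¬ (_~_ G u v)

degree : ∀ {n} → Graph n → Fin n → ℕ
degree {n} G v = length (filter (_~?_ G v) (allFin n))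

avgDegree : ∀ {n} .{{_ : NonZero n}} → Graph n → ℚ
avgDegree {n} G = + sum (map (degree G) (allFin n)) / n

e : ∀ {n} → Graph n → Subset n → Subset n → ℕ
e {n} G S T =
  length (filter (λ (s , t) → (s ∈? S) ×-dec (t ∈? T) ×-dec (_~?_ G s t))
                 (cartesianProduct (allFin n) (allFin n)))

fromℕ : ℕ → ℚ
fromℕ m = + m / 1

open import Algebra.Definitions.RawSemiring ℚ.+-*-rawSemiring public using (_^_)

-- The real number coeff · radicand^(1/ℓ), for ℓ ≥ 1 and radicand ≥ 0.
record Radical (ℓ : ℕ) : Set where
  constructor radical
  field
    coeff    : ℚ
    radicand : ℚ

open Radical

infix 9 _^1/_
_^1/_ : ℚ → (ℓ : ℕ) → Radical ℓ
a ^1/ ℓ = radical 1ℚ a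

infixr 7 _·_
_·_ : ∀ {ℓ} → ℚ → Radical ℓ → Radical ℓ
c · r = radical (c ℚ.* coeff r) (radicand r)

-- sgn(q)|q|^ℓ (for ℓ ≥ 1): as a function of real q this is a strictly
-- increasing bijection, sending c · a^(1/ℓ) to (signedPow ℓ c) · a.
signedPow : ℕ → ℚ → ℚ
signedPow ℓ q = q ℚ.* ℚ.∣ q ∣ ^ pred ℓ

-- The order between rationals and the reals c · a^(1/ℓ), compared through
-- that increasing bijection.
infix 4 _≤ʳ_ _ʳ≤_
_≤ʳ_ : ∀ {ℓ} → ℚ → Radical ℓ → Set
_≤ʳ_ {ℓ} q r = signedPow ℓ q ℚ.≤ signedPow ℓ (coeff r) ℚ.* radicand r

_ʳ≤_ : ∀ {ℓ} → Radical ℓ → ℚ → Set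
_ʳ≤_ {ℓ} r q = signedPow ℓ (coeff r) ℚ.* radicand r ℚ.≤ signedPow ℓ q

Eventually : (ℕ → Set) → Set
Eventually P = ∃[ K ] (∀ k → K ℕ.≤ k → P k)

TendsToInfinity : (ℕ → ℕ) → Set
TendsToInfinity n = ∀ M → Eventually (λ k → M ℕ.≤ n k)

-- f / g → 1 for eventually positive g: |f / g - 1| ≤ ε, multiplied out by g.
infix 4 _∼_
_∼_ : ∀ {ℓ} → (ℕ → ℚ) → (ℕ → Radical ℓ) → Set
f ∼ g = ∀ ε → 0ℚ ℚ.< ε → Eventually λ k →
  ((1ℚ ℚ.- ε) · g k ʳ≤ f k) × (f k ≤ʳ (1ℚ ℚ.+ ε) · g k)

module Submission where

-- A bipartite graph without even cycles of length at most 2ℓ has at most one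
-- non-backtracking walk of length ℓ between two given vertices.  Once the vertices of low
-- degree have been isolated, which costs few edges, all degrees are O(d), so that only o(n)
-- walks of length ℓ from a vertex backtrack.  The adjacency operator A therefore satisfies
-- A^ℓ f ≤ ∑ f + o(n) for 0 ≤ f ≤ 2.  For |φ| ≤ 1_X with ∑ φ = 0, taking f = 1_X ± φ gives
-- (A^ℓ φ)² + (A^ℓ 1_X)² ≤ (|X| + o(n))² at every vertex.  On the other hand ‖A^ℓ 1_X‖² is at
-- least |X| d^(2ℓ), about |X| n²/4, so this forces |X| and |Y| to be about n/2 and ‖A^ℓ φ‖² to
-- be o(n³).  As ‖A^k φ‖² is log-convex in k, it follows that ‖A φ‖² = o(n d²).  Together with
-- Cauchy–Schwarz, applied to φ = 1_S - (|S|/|X|) 1_X and likewise to T, this is the theorem.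

-- All computations use rationals and integer powers. The average degree `d` itself stands for the
-- irrational root of `n`: eventually `d ^ ℓ ≤ n ≤ 4 d ^ ℓ`, and powers are cancelled where roots
-- would be taken. Log-convexity of the moments replaces a spectral decomposition and works in both
-- directions: it lifts a lower bound from ‖A 1_X‖² to ‖A^ℓ 1_X‖², and it brings an upper bound on
-- ‖A^ℓ φ‖² down to ‖A φ‖². The degree bound behind the estimate of A^ℓ is itself a walk count. If
-- all non-isolated vertices have degree at least θ, then at least deg(u) (θ - 1)^(ℓ-1)
-- non-backtracking walks of length ℓ leave u, and they end at distinct vertices, so this number is
-- at most n. For θ = ηd this makes deg(u) a bounded multiple of d, which is why low degrees have to
-- go first. The parity of ℓ decides where walks from X end. If they end in Y, the main terms cancel
-- by AM-GM; if they end in X, lower bounds on the sizes of both parts are needed instead.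

open import Defs

-- Ordered-field facts, powers and natural numbers inside the rationals.

module Rationals where

  open import Algebra.Bundles using (CommutativeRing)
  open import Data.Integer as ℤ using (+_)
  import Data.Integer.Properties as ℤₚ
  import Data.Integer.Tactic.RingSolver as ℤ-Solver
  open import Data.Nat as ℕ using (ℕ; zero; suc)
  import Data.Nat.Properties as ℕₚ
  open import Data.Product using (∃-syntax; _×_; _,_)
  open import Data.Rational hiding (_/_; NonZero)
  open import Data.Rational.Properties
  import Data.Rational.Unnormalised as ℚᵘ
  import Data.Rational.Unnormalised.Properties as ℚᵘₚ
  open import Data.Sum using (inj₁; inj₂)
  open import Function using (case_of_)
  open import Level using (0ℓ)
  open import Relation.Binary.PropositionalEquality
  open import Relation.Nullary using (yes; no; contradiction)
  open import Relation.Nullary.Decidable using (dec⇒maybe)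
  open import Tactic.RingSolver using (solve-∀)
  open import Tactic.RingSolver.Core.AlmostCommutativeRing
    using (AlmostCommutativeRing; fromCommutativeRing)

  ring : AlmostCommutativeRing 0ℓ 0ℓ
  ring = fromCommutativeRing +-*-commutativeRing λ p → dec⇒maybe (0ℚ ≟ p)

  2ℚ 3ℚ 4ℚ 8ℚ : ℚ
  2ℚ = 1ℚ + 1ℚ
  3ℚ = 1ℚ + 2ℚ
  4ℚ = 2ℚ * 2ℚ
  8ℚ = 2ℚ * 4ℚ

  -- Inequalities are proved by exhibiting the difference of the two sides as a
  -- manifestly nonnegative expression.
  ≤-by : ∀ {p q} r → q - p ≡ r → 0ℚ ≤ r → p ≤ q
  ≤-by {p} {q} r eq 0≤r = subst₂ _≤_ (+-identityʳ p) (lemma p q)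
    (+-monoʳ-≤ p (subst (0ℚ ≤_) (sym eq) 0≤r))
    where
    lemma : ∀ p q → p + (q - p) ≡ q
    lemma = solve-∀ ring

  0≤- : ∀ {p q} → p ≤ q → 0ℚ ≤ q - p
  0≤- {p} {q} p≤q = subst (_≤ q - p) (+-inverseʳ p) (+-monoˡ-≤ (- p) p≤q)

  0≤1 : 0ℚ ≤ 1ℚ
  0≤1 = nonNegative⁻¹ 1ℚ

  0<1 : 0ℚ < 1ℚ
  0<1 = positive⁻¹ 1ℚ

  infixl 6 _+₀_
  infixl 7 _*₀_

  _+₀_ : ∀ {p q} → 0ℚ ≤ p → 0ℚ ≤ q → 0ℚ ≤ p + q
  0≤p +₀ 0≤q = +-mono-≤ 0≤p 0≤q

  _*₀_ : ∀ {p q} → 0ℚ ≤ p → 0ℚ ≤ q → 0ℚ ≤ p * q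
  _*₀_ {p} {q} 0≤p 0≤q =
    nonNegative⁻¹ (p * q) {{nonNeg*nonNeg⇒nonNeg p {{nonNegative 0≤p}} q {{nonNegative 0≤q}}}}

  0<* : ∀ {p q} → 0ℚ < p → 0ℚ < q → 0ℚ < p * q
  0<* {p} {q} 0<p 0<q =
    positive⁻¹ (p * q) {{pos*pos⇒pos p {{positive 0<p}} q {{positive 0<q}}}}

  0≤² : ∀ p → 0ℚ ≤ p * p
  0≤² p = case ≤-total 0ℚ p of λ where
      (inj₁ 0≤p) → 0≤p *₀ 0≤p
      (inj₂ p≤0) → subst (0ℚ ≤_) (lemma p) (neg-antimono-≤ p≤0 *₀ neg-antimono-≤ p≤0)
    where
    lemma : ∀ p → - p * - p ≡ p * p
    lemma = solve-∀ ring

  *-monoˡ : ∀ {p q} r → 0ℚ ≤ r → p ≤ q → r * p ≤ r * q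
  *-monoˡ r 0≤r = *-monoˡ-≤-nonNeg r {{nonNegative 0≤r}}

  *-monoʳ : ∀ {p q} r → 0ℚ ≤ r → p ≤ q → p * r ≤ q * r
  *-monoʳ r 0≤r = *-monoʳ-≤-nonNeg r {{nonNegative 0≤r}}

  *-mono : ∀ {p q r s} → 0ℚ ≤ p → p ≤ q → 0ℚ ≤ r → r ≤ s → p * r ≤ q * s
  *-mono 0≤p p≤q 0≤r r≤s =
    ≤-trans (*-monoʳ _ 0≤r p≤q) (*-monoˡ _ (≤-trans 0≤p p≤q) r≤s)

  *-cancelˡ : ∀ {p q} r → 0ℚ < r → r * p ≤ r * q → p ≤ q
  *-cancelˡ r 0<r = *-cancelˡ-≤-pos r {{positive 0<r}}

  -- Delivered as a witness with its equation, so that later ring identities see an ordinary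
  -- variable and carry no nonzero instance.
  inverse : ∀ {p} → 0ℚ < p → ∃[ r ] 0ℚ < r × r * p ≡ 1ℚ
  inverse {p} 0<p = 1/p , positive⁻¹ 1/p {{1/pos⇒pos p {{p⁺}}}} ,
                    *-inverseˡ p {{pos⇒nonZero p {{p⁺}}}}
    where
    p⁺ = positive 0<p
    1/p = (1/ p) {{pos⇒nonZero p {{p⁺}}}}

  ∣_∣≤ : ∀ {q} p → p ≤ q → - p ≤ q → ∣ p ∣ ≤ q
  ∣ p ∣≤ p≤q -p≤q = case ∣p∣≡p∨∣p∣≡-p p of λ where
    (inj₁ eq) → subst (_≤ _) (sym eq) p≤q
    (inj₂ eq) → subst (_≤ _) (sym eq) -p≤q

  open import Algebra.Properties.CommutativeSemiring.Exp
    (CommutativeRing.commutativeSemiring +-*-commutativeRing) public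
    using (^-distrib-*)

  0≤^ : ∀ {p} k → 0ℚ ≤ p → 0ℚ ≤ p ^ k
  0≤^ zero    0≤p = 0≤1
  0≤^ (suc k) 0≤p = 0≤p *₀ 0≤^ k 0≤p

  0<^ : ∀ {p} k → 0ℚ < p → 0ℚ < p ^ k
  0<^ zero    0<p = 0<1
  0<^ (suc k) 0<p = 0<* 0<p (0<^ k 0<p)

  ^-monoˡ : ∀ {p q} k → 0ℚ ≤ p → p ≤ q → p ^ k ≤ q ^ k
  ^-monoˡ zero    0≤p p≤q = ≤-refl
  ^-monoˡ (suc k) 0≤p p≤q = *-mono 0≤p p≤q (0≤^ k 0≤p) (^-monoˡ k 0≤p p≤q)

  1^ : ∀ k → 1ℚ ^ k ≡ 1ℚ
  1^ zero    = refl
  1^ (suc k) = trans (*-identityˡ _) (1^ k)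

  -- Takes the place of extracting roots. No sign is asked of `p`: in the case to be refuted,
  -- `q < p` already makes `p` positive.
  ^-cancelˡ : ∀ {p q} k → 0ℚ ≤ q → p ^ suc k ≤ q ^ suc k → p ≤ q
  ^-cancelˡ {p} {q} k 0≤q p^≤q^ with p ≤? q
  ... | yes p≤q = p≤q
  ... | no p≰q = contradiction (<-≤-trans q^<p^ p^≤q^) (<-irrefl refl)
    where
    q<p = ≰⇒> p≰q
    0<p = ≤-<-trans 0≤q q<p
    q^<p^ : q ^ suc k < p ^ suc k
    q^<p^ = ≤-<-trans (*-monoˡ q 0≤q (^-monoˡ k 0≤q (<⇒≤ q<p)))
                      (*-monoˡ-<-pos (p ^ k) {{positive (0<^ k 0<p)}} q<p)

  toℚᵘ-fromℕ : ∀ m → toℚᵘ (fromℕ m) ℚᵘ.≃ ℚᵘ.mkℚᵘ (+ m) 0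
  toℚᵘ-fromℕ m = toℚᵘ-fromℚᵘ (ℚᵘ.mkℚᵘ (+ m) 0)

  fromℕ-+ : ∀ m n → fromℕ (m ℕ.+ n) ≡ fromℕ m + fromℕ n
  fromℕ-+ m n = toℚᵘ-injective (begin
    toℚᵘ (fromℕ (m ℕ.+ n))                ≈⟨ toℚᵘ-fromℕ (m ℕ.+ n) ⟩
    ℚᵘ.mkℚᵘ (+ (m ℕ.+ n)) 0               ≈⟨ ℚᵘ.*≡* (lemma (+ m) (+ n)) ⟩
    ℚᵘ.mkℚᵘ (+ m) 0 ℚᵘ.+ ℚᵘ.mkℚᵘ (+ n) 0  ≈⟨ ℚᵘₚ.+-cong (toℚᵘ-fromℕ m) (toℚᵘ-fromℕ n) ⟨
    toℚᵘ (fromℕ m) ℚᵘ.+ toℚᵘ (fromℕ n)    ≈⟨ toℚᵘ-homo-+ (fromℕ m) (fromℕ n) ⟨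
    toℚᵘ (fromℕ m + fromℕ n)              ∎)
    where
    open ℚᵘₚ.≃-Reasoning
    lemma : ∀ i j → (i ℤ.+ j) ℤ.* + 1 ≡ (i ℤ.* + 1 ℤ.+ j ℤ.* + 1) ℤ.* + 1
    lemma = ℤ-Solver.solve-∀

  fromℕ-suc : ∀ m → fromℕ (suc m) ≡ 1ℚ + fromℕ m
  fromℕ-suc m = fromℕ-+ 1 m

  0≤fromℕ : ∀ m → 0ℚ ≤ fromℕ m
  0≤fromℕ m = nonNegative⁻¹ (fromℕ m) {{normalize-nonNeg m 1}}

  fromℕ-mono : ∀ {m n} → m ℕ.≤ n → fromℕ m ≤ fromℕ n
  fromℕ-mono {m} {n} m≤n = ≤-by (fromℕ (n ℕ.∸ m)) eq (0≤fromℕ (n ℕ.∸ m))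
    where
    lemma : ∀ p q → p + q - p ≡ q
    lemma = solve-∀ ring
    eq : fromℕ n - fromℕ m ≡ fromℕ (n ℕ.∸ m)
    eq = trans (cong (_- fromℕ m) (trans (cong fromℕ (sym (ℕₚ.m+[n∸m]≡n m≤n))) (fromℕ-+ m (n ℕ.∸ m))))
               (lemma (fromℕ m) (fromℕ (n ℕ.∸ m)))

  archimedean : ∀ p → ∃[ m ] p ≤ fromℕ m
  archimedean p@record{} = m , toℚᵘ-cancel-≤ (ℚᵘₚ.≤-respʳ-≃ (ℚᵘₚ.≃-sym (toℚᵘ-fromℕ m)) (ℚᵘ.*≤* (begin
      ↥ p ℤ.* + 1    ≡⟨ ℤₚ.*-identityʳ (↥ p) ⟩
      ↥ p            ≤⟨ i≤+∣i∣ (↥ p) ⟩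
      + m            ≡⟨ ℤₚ.*-identityʳ (+ m) ⟨
      + m ℤ.* + 1    ≤⟨ ℤₚ.*-monoˡ-≤-nonNeg (+ m) (ℤ.+≤+ (ℕ.s≤s ℕ.z≤n)) ⟩
      + m ℤ.* ↧ p    ∎)))
    where
    open ℤₚ.≤-Reasoning
    -- The denominator is at least 1, so the absolute value of the numerator is large enough.
    m = ℤ.∣ ↥ p ∣
    i≤+∣i∣ : ∀ i → i ℤ.≤ + ℤ.∣ i ∣
    i≤+∣i∣ (+ _)      = ℤₚ.≤-refl
    i≤+∣i∣ ℤ.-[1+ _ ] = ℤ.-≤+

  bernoulli : ∀ {t} k → 0ℚ ≤ t → t ≤ 1ℚ → 1ℚ - fromℕ k * t ≤ (1ℚ - t) ^ k
  bernoulli {t} zero 0≤t t≤1 = ≤-reflexive (lemma t)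
    where
    lemma : ∀ t → 1ℚ - 0ℚ * t ≡ 1ℚ
    lemma = solve-∀ ring
  bernoulli {t} (suc k) 0≤t t≤1 = ≤-trans
    (≤-by (fromℕ k * (t * t)) (trans (cong (λ s → (1ℚ - t) * (1ℚ - fromℕ k * t) - (1ℚ - s * t)) (fromℕ-suc k))
                                     (lemma t (fromℕ k)))
          (0≤fromℕ k *₀ 0≤² t))
    (*-monoˡ (1ℚ - t) (0≤- t≤1) (bernoulli k 0≤t t≤1))
    where
    lemma : ∀ t k → (1ℚ - t) * (1ℚ - k * t) - (1ℚ - (1ℚ + k) * t) ≡ k * (t * t)
    lemma = solve-∀ ring

-- Indicators, finite sums and the Cauchy-Schwarz inequality.

module FiniteSums where

  open Rationals
  open import Algebra.Bundles using (CommutativeRing)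
  open import Data.Fin using (Fin; zero; suc)
  open import Data.Fin.Properties as Finₚ using (suc-injective)
  open import Data.Nat using (ℕ; zero; suc)
  open import Data.Product using (∃-syntax; _,_)
  open import Data.Rational hiding (_/_; NonZero)
  open import Data.Rational.Properties
  open import Function using (_∘_)
  open import Relation.Binary.PropositionalEquality
  open import Relation.Nullary using (¬_; Dec; yes; no; contradiction)
  open import Tactic.RingSolver using (solve-∀)
  open import Algebra.Properties.Semiring.Sum (CommutativeRing.semiring +-*-commutativeRing)
    using (sum; sum-cong-≗; ∑-distrib-+; ∑-comm; *-distribˡ-sum; *-distribʳ-sum)

  private
    variable
      n : ℕ
      P Q : Set

  𝟙 : Dec P → ℚ
  𝟙 (yes _) = 1ℚ
  𝟙 (no _)  = 0ℚ

  𝟙-yes : (P? : Dec P) → P → 𝟙 P? ≡ 1ℚ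
  𝟙-yes (yes _) _ = refl
  𝟙-yes (no ¬p) p = contradiction p ¬p

  𝟙-no : (P? : Dec P) → ¬ P → 𝟙 P? ≡ 0ℚ
  𝟙-no (yes p) ¬p = contradiction p ¬p
  𝟙-no (no _)  _  = refl

  0≤𝟙 : (P? : Dec P) → 0ℚ ≤ 𝟙 P?
  0≤𝟙 (yes _) = 0≤1
  0≤𝟙 (no _)  = ≤-refl

  𝟙≤1 : (P? : Dec P) → 𝟙 P? ≤ 1ℚ
  𝟙≤1 (yes _) = ≤-refl
  𝟙≤1 (no _)  = 0≤1

  𝟙-mono : (P? : Dec P) (Q? : Dec Q) → (P → Q) → 𝟙 P? ≤ 𝟙 Q?
  𝟙-mono (yes p) Q? f = ≤-reflexive (sym (𝟙-yes Q? (f p)))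
  𝟙-mono (no _)  Q? f = 0≤𝟙 Q?

  𝟙-cong : (P? : Dec P) (Q? : Dec Q) → (P → Q) → (Q → P) → 𝟙 P? ≡ 𝟙 Q?
  𝟙-cong P? Q? f g = ≤-antisym (𝟙-mono P? Q? f) (𝟙-mono Q? P? g)

  𝟙² : (P? : Dec P) → 𝟙 P? * 𝟙 P? ≡ 𝟙 P?
  𝟙² (yes _) = refl
  𝟙² (no _)  = refl

  ∑ : (Fin n → ℚ) → ℚ
  ∑ = sum

  ∑-cong : {f g : Fin n → ℚ} → (∀ i → f i ≡ g i) → ∑ f ≡ ∑ g
  ∑-cong = sum-cong-≗

  ∑-+ : (f g : Fin n → ℚ) → ∑ (λ i → f i + g i) ≡ ∑ f + ∑ g
  ∑-+ = ∑-distrib-+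

  ∑-*ˡ : ∀ p (f : Fin n → ℚ) → ∑ (λ i → p * f i) ≡ p * ∑ f
  ∑-*ˡ p f = sym (*-distribˡ-sum p f)

  ∑-*ʳ : ∀ p (f : Fin n → ℚ) → ∑ (λ i → f i * p) ≡ ∑ f * p
  ∑-*ʳ p f = sym (*-distribʳ-sum p f)

  ∑-swap : ∀ {m n} (f : Fin m → Fin n → ℚ) → ∑ (λ i → ∑ (f i)) ≡ ∑ (λ j → ∑ (λ i → f i j))
  ∑-swap = ∑-comm

  ∑-neg : (f : Fin n → ℚ) → ∑ (λ i → - f i) ≡ - ∑ f
  ∑-neg {zero}  f = refl
  ∑-neg {suc n} f = trans (cong (λ ζ → - f zero + ζ) (∑-neg (f ∘ suc)))
                          (sym (neg-distrib-+ (f zero) (∑ (f ∘ suc))))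

  ∑-- : (f g : Fin n → ℚ) → ∑ (λ i → f i - g i) ≡ ∑ f - ∑ g
  ∑-- f g = trans (∑-+ f (-_ ∘ g)) (cong (λ ζ → ∑ f + ζ) (∑-neg g))

  ∑-mono : {f g : Fin n → ℚ} → (∀ i → f i ≤ g i) → ∑ f ≤ ∑ g
  ∑-mono {zero}  f≤g = ≤-refl
  ∑-mono {suc n} f≤g = +-mono-≤ (f≤g zero) (∑-mono (f≤g ∘ suc))

  ∑-zero : {f : Fin n → ℚ} → (∀ i → f i ≡ 0ℚ) → ∑ f ≡ 0ℚ
  ∑-zero {zero}  f≡0 = refl
  ∑-zero {suc n} f≡0 = cong₂ _+_ (f≡0 zero) (∑-zero (f≡0 ∘ suc))

  0≤∑ : {f : Fin n → ℚ} → (∀ i → 0ℚ ≤ f i) → 0ℚ ≤ ∑ f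
  0≤∑ {zero}  0≤f = ≤-refl
  0≤∑ {suc n} 0≤f = 0≤f zero +₀ 0≤∑ (0≤f ∘ suc)

  ∑-const : ∀ n c → ∑ {n} (λ _ → c) ≡ fromℕ n * c
  ∑-const zero    c = sym (*-zeroˡ c)
  ∑-const (suc n) c = begin
    c + ∑ {n} (λ _ → c)     ≡⟨ cong (λ ζ → c + ζ) (∑-const n c) ⟩
    c + fromℕ n * c         ≡⟨ lemma c (fromℕ n) ⟩
    (1ℚ + fromℕ n) * c      ≡⟨ cong (_* c) (fromℕ-suc n) ⟨
    fromℕ (suc n) * c       ∎
    where
    open ≡-Reasoning
    lemma : ∀ c m → c + m * c ≡ (1ℚ + m) * c
    lemma = solve-∀ ring

  ∑-single : (i : Fin n) (f : Fin n → ℚ) → (∀ j → j ≢ i → f j ≡ 0ℚ) → ∑ f ≡ f i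
  ∑-single zero    f f≡0 = trans (cong (λ ζ → f zero + ζ) (∑-zero λ j → f≡0 (suc j) λ ()))
                                 (+-identityʳ (f zero))
  ∑-single (suc i) f f≡0 = trans (cong₂ _+_ (f≡0 zero λ ())
                                   (∑-single i (f ∘ suc) λ j j≢i → f≡0 (suc j) (j≢i ∘ suc-injective)))
                                 (+-identityˡ (f (suc i)))

  ∑-nonzero : (f : Fin n → ℚ) → ∑ f ≢ 0ℚ → ∃[ i ] f i ≢ 0ℚ
  ∑-nonzero f ∑≢0 with Finₚ.any? (λ i → Relation.Nullary.¬? (f i ≟ 0ℚ))
  ... | yes found = found
  ... | no none   = contradiction
    (∑-zero λ i → Relation.Nullary.decidable-stable (f i ≟ 0ℚ) (λ fi≢0 → none (i , fi≢0))) ∑≢0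

  infix 8 ⟨_,_⟩
  ⟨_,_⟩ : (f g : Fin n → ℚ) → ℚ
  ⟨ f , g ⟩ = ∑ λ i → f i * g i

  ∑-⊗ : ∀ {m n} (f : Fin m → ℚ) (g : Fin n → ℚ) → ∑ (λ i → ∑ λ j → f i * g j) ≡ ∑ f * ∑ g
  ∑-⊗ f g = trans (∑-cong λ i → ∑-*ˡ (f i) g) (∑-*ʳ (∑ g) f)

  -- Lagrange's identity: the sum of the squares (fᵢ gⱼ - fⱼ gᵢ)² is twice the
  -- difference of the two sides.
  cauchy-schwarz : (f g : Fin n → ℚ) → ⟨ f , g ⟩ * ⟨ f , g ⟩ ≤ ⟨ f , f ⟩ * ⟨ g , g ⟩
  cauchy-schwarz {n} f g = *-cancelˡ 2ℚ (positive⁻¹ 2ℚ) (≤-by _ (sym lagrange) (0≤∑ λ i → 0≤∑ λ j → 0≤² (minor i j)))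
    where
    open ≡-Reasoning
    minor : Fin n → Fin n → ℚ
    minor i j = f i * g j - f j * g i
    F = λ i → f i * f i
    G = λ i → g i * g i
    H = λ i → f i * g i
    expand : ∀ a b c d → (a * d - c * b) * (a * d - c * b) ≡ (a * a) * (d * d) + (b * b) * (c * c) - 2ℚ * ((a * b) * (c * d))
    expand = solve-∀ ring
    collect : ∀ a b c → a * b + b * a - 2ℚ * (c * c) ≡ 2ℚ * (a * b) - 2ℚ * (c * c)
    collect = solve-∀ ring
    lagrange : ∑ (λ i → ∑ λ j → minor i j * minor i j)
               ≡ 2ℚ * (⟨ f , f ⟩ * ⟨ g , g ⟩) - 2ℚ * (⟨ f , g ⟩ * ⟨ f , g ⟩)
    lagrange = begin
      ∑ (λ i → ∑ λ j → minor i j * minor i j)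
        ≡⟨ (∑-cong λ i → trans (∑-cong λ j → expand (f i) (g i) (f j) (g j))
             (trans (∑-- (λ j → F i * G j + G i * F j) (λ j → 2ℚ * (H i * H j)))
                    (cong₂ _-_ (∑-+ (λ j → F i * G j) (λ j → G i * F j)) (∑-*ˡ 2ℚ (λ j → H i * H j))))) ⟩
      ∑ (λ i → ∑ (λ j → F i * G j) + ∑ (λ j → G i * F j) - 2ℚ * ∑ (λ j → H i * H j))
        ≡⟨ trans (∑-- (λ i → ∑ (λ j → F i * G j) + ∑ (λ j → G i * F j)) (λ i → 2ℚ * ∑ (λ j → H i * H j)))
                 (cong₂ _-_ (∑-+ (λ i → ∑ (λ j → F i * G j)) (λ i → ∑ (λ j → G i * F j)))
                            (∑-*ˡ 2ℚ (λ i → ∑ (λ j → H i * H j)))) ⟩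
      ∑ (λ i → ∑ (λ j → F i * G j)) + ∑ (λ i → ∑ (λ j → G i * F j)) - 2ℚ * ∑ (λ i → ∑ (λ j → H i * H j))
        ≡⟨ cong₂ _-_ (cong₂ _+_ (∑-⊗ F G) (∑-⊗ G F)) (cong (2ℚ *_) (∑-⊗ H H)) ⟩
      ∑ F * ∑ G + ∑ G * ∑ F - 2ℚ * (∑ H * ∑ H)
        ≡⟨ collect (∑ F) (∑ G) (∑ H) ⟩
      2ℚ * (∑ F * ∑ G) - 2ℚ * (∑ H * ∑ H) ∎

  ⟨⟩-comm : (f g : Fin n → ℚ) → ⟨ f , g ⟩ ≡ ⟨ g , f ⟩
  ⟨⟩-comm f g = ∑-cong λ i → *-comm (f i) (g i)

  0≤⟨⟩ : (f : Fin n → ℚ) → 0ℚ ≤ ⟨ f , f ⟩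
  0≤⟨⟩ f = 0≤∑ λ i → 0≤² (f i)

  -- Operators given by a matrix: iterates, self-adjointness, moments.

  module Operator (a : Fin n → Fin n → ℚ) where

    A : (Fin n → ℚ) → Fin n → ℚ
    A f u = ∑ λ v → a u v * f v

    A^ : ℕ → (Fin n → ℚ) → Fin n → ℚ
    A^ zero    f = f
    A^ (suc k) f = A (A^ k f)

    A-cong : ∀ {f g} → (∀ v → f v ≡ g v) → ∀ u → A f u ≡ A g u
    A-cong f≡g u = ∑-cong λ v → cong (a u v *_) (f≡g v)

    A-+ : ∀ f g u → A (λ v → f v + g v) u ≡ A f u + A g u
    A-+ f g u = trans (∑-cong λ v → *-distribˡ-+ (a u v) (f v) (g v))
                      (∑-+ (λ v → a u v * f v) (λ v → a u v * g v))

    A-neg : ∀ f u → A (λ v → - f v) u ≡ - A f u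
    A-neg f u = trans (∑-cong λ v → sym (neg-distribʳ-* (a u v) (f v)))
                      (∑-neg (λ v → a u v * f v))

    A-* : ∀ c f u → A (λ v → c * f v) u ≡ c * A f u
    A-* c f u = trans (∑-cong λ v → lemma (a u v) c (f v)) (∑-*ˡ c (λ v → a u v * f v))
      where
      lemma : ∀ p q r → p * (q * r) ≡ q * (p * r)
      lemma = solve-∀ ring

    A^-+ : ∀ k f g u → A^ k (λ v → f v + g v) u ≡ A^ k f u + A^ k g u
    A^-+ zero    f g u = refl
    A^-+ (suc k) f g u = trans (A-cong (A^-+ k f g) u) (A-+ (A^ k f) (A^ k g) u)

    A^-neg : ∀ k f u → A^ k (λ v → - f v) u ≡ - A^ k f u
    A^-neg zero    f u = refl
    A^-neg (suc k) f u = trans (A-cong (A^-neg k f) u) (A-neg (A^ k f) u)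

    module Nonnegative (0≤a : ∀ u v → 0ℚ ≤ a u v) where

      0≤A : ∀ {f} → (∀ v → 0ℚ ≤ f v) → ∀ u → 0ℚ ≤ A f u
      0≤A 0≤f u = 0≤∑ λ v → 0≤a u v *₀ 0≤f v

      0≤A^ : ∀ k {f} → (∀ v → 0ℚ ≤ f v) → ∀ u → 0ℚ ≤ A^ k f u
      0≤A^ zero    0≤f = 0≤f
      0≤A^ (suc k) 0≤f = 0≤A (0≤A^ k 0≤f)

    module Symmetric (a-sym : ∀ u v → a u v ≡ a v u) where

      self-adjoint : ∀ f g → ⟨ f , A g ⟩ ≡ ⟨ A f , g ⟩
      self-adjoint f g = begin
        ∑ (λ u → f u * ∑ (λ v → a u v * g v))    ≡⟨ (∑-cong λ u → ∑-*ˡ (f u) (λ v → a u v * g v)) ⟨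
        ∑ (λ u → ∑ (λ v → f u * (a u v * g v)))  ≡⟨ ∑-swap (λ u v → f u * (a u v * g v)) ⟩
        ∑ (λ v → ∑ (λ u → f u * (a u v * g v)))  ≡⟨ (∑-cong λ v → ∑-cong λ u → move u v) ⟩
        ∑ (λ v → ∑ (λ u → a v u * f u * g v))    ≡⟨ (∑-cong λ v → ∑-*ʳ (g v) (λ u → a v u * f u)) ⟩
        ∑ (λ v → ∑ (λ u → a v u * f u) * g v)    ∎
        where
        open ≡-Reasoning
        lemma : ∀ p q r → p * (q * r) ≡ q * p * r
        lemma = solve-∀ ring
        move : ∀ u v → f u * (a u v * g v) ≡ a v u * f u * g v
        move u v = trans (lemma (f u) (a u v) (g v)) (cong (λ c → c * f u * g v) (a-sym u v))

      moment : ℕ → (Fin n → ℚ) → ℚ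
      moment k f = ⟨ A^ k f , A^ k f ⟩

      -- By self-adjointness the middle moment is also the inner product of `A^ k f` and
      -- `A^ (suc (suc k)) f`, and Cauchy-Schwarz applies to these.
      moment-log-convex : ∀ k f → moment (suc k) f * moment (suc k) f ≤ moment k f * moment (suc (suc k)) f
      moment-log-convex k f = subst (λ m → m * m ≤ moment k f * moment (suc (suc k)) f)
        (self-adjoint (A^ k f) (A^ (suc k) f))
        (cauchy-schwarz (A^ k f) (A^ (suc (suc k)) f))

      -- Ratios of consecutive moments do not decrease, by log-convexity. The products avoid
      -- dividing by a moment that may vanish.
      moment-ratio : ∀ k f → moment 1 f * moment k f ≤ moment 0 f * moment (suc k) f
      moment-ratio zero    f = ≤-reflexive (*-comm (moment 1 f) (moment 0 f))
      moment-ratio (suc k) f with moment (suc k) f ≤? 0ℚ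
      -- A vanishing moment cannot be cancelled, but then the left side is zero.
      ... | yes m≤0 = subst (λ m → moment 1 f * m ≤ moment 0 f * moment (suc (suc k)) f)
        (sym (≤-antisym m≤0 (0≤⟨⟩ (A^ (suc k) f))))
        (subst (_≤ moment 0 f * moment (suc (suc k)) f) (sym (*-zeroʳ (moment 1 f)))
          (0≤⟨⟩ f *₀ 0≤⟨⟩ (A^ (suc (suc k)) f)))
      ... | no m≰0 = *-cancelˡ m (≰⇒> m≰0) (begin
        m * (m₁ * m)    ≡⟨ rearrange₁ m m₁ ⟩
        m₁ * (m * m)    ≤⟨ *-monoˡ m₁ (0≤⟨⟩ (A^ 1 f)) (moment-log-convex k f) ⟩
        m₁ * (m⁻ * m⁺)  ≡⟨ *-assoc m₁ m⁻ m⁺ ⟨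
        m₁ * m⁻ * m⁺    ≤⟨ *-monoʳ m⁺ (0≤⟨⟩ (A^ (suc (suc k)) f)) (moment-ratio k f) ⟩
        m₀ * m * m⁺     ≡⟨ rearrange₂ m₀ m m⁺ ⟩
        m * (m₀ * m⁺)   ∎)
        where
        open ≤-Reasoning
        m₀ = moment 0 f
        m₁ = moment 1 f
        m⁻ = moment k f
        m  = moment (suc k) f
        m⁺ = moment (suc (suc k)) f
        rearrange₁ : ∀ p q → p * (q * p) ≡ q * (p * p)
        rearrange₁ = solve-∀ ring
        rearrange₂ : ∀ p q r → p * q * r ≡ q * (p * r)
        rearrange₂ = solve-∀ ring

      -- Iterates `moment-ratio`. Used twice: to bound a high moment of an indicator from below, and
      -- the first moment of a balanced function from above.
      moment-power : ∀ k f → moment 1 f ^ suc k ≤ moment (suc k) f * moment 0 f ^ k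
      moment-power zero    f = ≤-refl
      moment-power (suc k) f = begin
        m₁ * m₁ ^ suc k      ≤⟨ *-monoˡ m₁ (0≤⟨⟩ (A^ 1 f)) (moment-power k f) ⟩
        m₁ * (m * m₀ ^ k)    ≡⟨ *-assoc m₁ m (m₀ ^ k) ⟨
        m₁ * m * m₀ ^ k      ≤⟨ *-monoʳ (m₀ ^ k) (0≤^ k (0≤⟨⟩ f)) (moment-ratio (suc k) f) ⟩
        m₀ * m⁺ * m₀ ^ k     ≡⟨ rearrange m₀ m⁺ (m₀ ^ k) ⟩
        m⁺ * (m₀ * m₀ ^ k)   ∎
        where
        open ≤-Reasoning
        m₀ = moment 0 f
        m₁ = moment 1 f
        m  = moment (suc k) f
        m⁺ = moment (suc (suc k)) f
        rearrange : ∀ p q r → p * q * r ≡ q * (p * r)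
        rearrange = solve-∀ ring

-- Short non-backtracking walks in a graph without short even cycles.

module NonBacktrackingWalks where

  open Rationals
  open FiniteSums
  open import Data.Bool using (Bool; not)
  open import Data.Bool.Properties using (not-involutive; not-¬)
  import Data.Empty
  open import Data.Fin using (Fin; zero; suc; toℕ)
  open import Data.Fin.Subset using (Subset; _∈_; _∉_)
  open import Data.Fin.Subset.Properties using (_∈?_)
  import Data.Fin.Properties as Finₚ
  open import Data.List using (List; []; _∷_; _++_; length; lookup)
  open import Data.List.Membership.Propositional using () renaming (_∈_ to _∈ₗ_)
  open import Data.List.Membership.Propositional.Properties using (∈-∃++; ∈-lookup)
  open import Data.List.Properties using (length-++)
  open import Data.List.Relation.Unary.All as All using (All; []; _∷_)
  open import Data.List.Relation.Unary.All.Properties using (¬Any⇒All¬; ++⁻ˡ; ++⁻ʳ)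
  open import Data.List.Relation.Unary.AllPairs using ([]; _∷_)
  open import Data.List.Relation.Unary.Any using (here; there)
  open import Data.List.Relation.Unary.Linked using (Linked; []; [-]; _∷_)
  open import Data.List.Relation.Unary.Unique.Propositional using (Unique)
  open import Data.List.Relation.Unary.Unique.Propositional.Properties using (Unique[x∷xs]⇒x∉xs)
  open import Data.Nat as ℕ using (ℕ; zero; suc)
  open import Data.Nat.Divisibility using (_∣_; _∣0; ∣m∣n⇒∣m+n; ∣-refl)
  import Data.Nat.Properties as ℕₚ
  open import Data.Product using (∃-syntax; _×_; _,_; proj₁; proj₂)
  open import Data.Rational hiding (_/_; NonZero)
  open import Data.Rational.Properties
  open import Data.Sum using (inj₁; inj₂; [_,_]′)
  open import Function using (_∘_)
  open import Relation.Binary.PropositionalEquality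
  open import Relation.Nullary using (¬_; ¬?; yes; no; contradiction)

  lookup-unique : ∀ {a} {A : Set a} {xs : List A} → Unique xs →
                  ∀ {i j} → lookup xs i ≡ lookup xs j → i ≡ j
  lookup-unique {xs = x ∷ xs} u {zero} {zero} eq = refl
  lookup-unique {xs = x ∷ xs} u {zero} {suc j} eq =
    contradiction (subst (_∈ₗ xs) (sym eq) (∈-lookup j)) (Unique[x∷xs]⇒x∉xs u)
  lookup-unique {xs = x ∷ xs} u {suc i} {zero} eq =
    contradiction (subst (_∈ₗ xs) eq (∈-lookup i)) (Unique[x∷xs]⇒x∉xs u)
  lookup-unique (_ ∷ u) {suc i} {suc j} eq = cong suc (lookup-unique u eq)

  -- Made for a walk `x ∷ ys ++ x ∷ zs` whose tail has no repetition: cut just before the second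
  -- `x`, it gives the vertices of a cycle.
  unique-prefix : ∀ {a} {A : Set a} {x : A} ys {zs} → Unique (ys ++ x ∷ zs) → Unique (x ∷ ys)
  unique-prefix {x = x} ys u = x∉ys ys u ∷ ys-unique ys u
    where
    x∉ys : ∀ ys {zs} → Unique (ys ++ x ∷ zs) → All (x ≢_) ys
    x∉ys []       _        = []
    x∉ys (y ∷ ys) (y∉ ∷ u) = ≢-sym (All.head (++⁻ʳ ys y∉)) ∷ x∉ys ys u
    ys-unique : ∀ ys {zs} → Unique (ys ++ x ∷ zs) → Unique ys
    ys-unique []       _        = []
    ys-unique (y ∷ ys) (y∉ ∷ u) = ++⁻ˡ ys y∉ ∷ ys-unique ys u

  -- When `z` is the head of `xs`, the second component is the edge that closes the cycle through
  -- `xs`.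
  linked-lookup : ∀ {a} {A : Set a} {R : A → A → Set} xs {z zs} → Linked R (xs ++ z ∷ zs) →
    (∀ i j → suc (toℕ i) ≡ toℕ j → R (lookup xs i) (lookup xs j)) ×
    (∀ i → suc (toℕ i) ≡ length xs → R (lookup xs i) z)
  linked-lookup []           _       = (λ ()) , (λ ())
  linked-lookup (x ∷ [])     (r ∷ _) = (λ { zero zero () }) , (λ { zero _ → r })
  linked-lookup (x ∷ y ∷ xs) (r ∷ l) = next , last
    where
    ih = linked-lookup (y ∷ xs) l
    next : ∀ i j → suc (toℕ i) ≡ toℕ j → _
    next zero    (suc zero) _  = r
    next (suc i) (suc j)    eq = proj₁ ih i j (ℕₚ.suc-injective eq)
    last : ∀ i → suc (toℕ i) ≡ length (x ∷ y ∷ xs) → _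
    last zero    ()
    last (suc i) eq = proj₂ ih i (ℕₚ.suc-injective eq)

  nots : ℕ → Bool → Bool
  nots zero    b = b
  nots (suc k) b = not (nots k b)

  -- Each edge changes sides, so going around a cycle of length `k` applies `not` `k` times and
  -- returns the same Boolean. This is where the evenness of cycle lengths comes from.
  nots-even : ∀ k {b} → nots k b ≡ b → 2 ∣ k
  nots-even zero          _  = 2 ∣0
  nots-even (suc zero)    eq = contradiction (sym eq) (not-¬ refl)
  nots-even (suc (suc k)) eq = ∣m∣n⇒∣m+n ∣-refl (nots-even k (trans (sym (not-involutive _)) eq))

  module _ {n : ℕ} (G : Graph n) where

    open Graph G

    data NonBacktracking : List (Fin n) → Set where
      single : ∀ {u} → NonBacktracking (u ∷ [])
      edge   : ∀ {u v} → u ~ v → NonBacktracking (u ∷ v ∷ [])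
      extend : ∀ {u v w vs} → u ~ v → u ≢ w →
               NonBacktracking (v ∷ w ∷ vs) → NonBacktracking (u ∷ v ∷ w ∷ vs)

    nb-tail : ∀ {u v vs} → NonBacktracking (u ∷ v ∷ vs) → NonBacktracking (v ∷ vs)
    nb-tail (edge _)    = single
    nb-tail (extend _ _ p) = p

    nb-linked : ∀ {vs} → NonBacktracking vs → Linked _~_ vs
    nb-linked single        = [-]
    nb-linked (edge e)      = e ∷ [-]
    nb-linked (extend e _ p) = e ∷ nb-linked p

    -- The index `p` is the vertex visited just before `u`, all the history that backtracking
    -- depends on. This form follows the recursion of `nbCount`, whereas cycles are read off the
    -- vertex lists of `NonBacktracking`.
    data Walk : ℕ → (p u w : Fin n) → Set where
      stop : ∀ {p u} → Walk zero p u u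
      step : ∀ {k p u v w} → u ~ v → v ≢ p → Walk k u v w → Walk (suc k) p u w

    walk-forward : ∀ {k p u w} → p ~ u → Walk k p u w →
      ∃[ vs ] NonBacktracking (p ∷ u ∷ vs) × length vs ≡ k × w ∈ₗ u ∷ vs
    walk-forward p~u stop = [] , edge p~u , refl , here refl
    walk-forward p~u (step {v = v} u~v v≢p ω) with walk-forward u~v ω
    ... | vs , nb , len , w∈ = v ∷ vs , extend p~u (≢-sym v≢p) nb , cong suc len , there w∈

    -- The list is an accumulator headed by the current and the previous vertex, and every step of
    -- the walk is pushed onto it. The final inclusion keeps track of `bs`, where `w` will be found
    -- a second time.
    walk-reverse : ∀ {k p u w bs} → Walk k p u w → NonBacktracking (u ∷ p ∷ bs) →
      ∃[ cs ] NonBacktracking (w ∷ cs) × length cs ≡ k ℕ.+ suc (length bs) × (∀ {z} → z ∈ₗ bs → z ∈ₗ cs)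
    walk-reverse {p = p} {bs = bs} stop nb = p ∷ bs , nb , refl , there
    walk-reverse {suc k} {p} {bs = bs} (step u~v v≢p ω) nb with walk-reverse ω (extend (~-sym u~v) v≢p nb)
    ... | cs , nb′ , len , ⊆cs = cs , nb′ , trans len (ℕₚ.+-suc k (suc (length bs))) , ⊆cs ∘ there

    -- The number of non-backtracking walks of length k from u to w whose first
    -- step does not go to p.
    nbCount : ℕ → (p u w : Fin n) → ℚ
    nbCount zero    p u w = 𝟙 (u Finₚ.≟ w)
    nbCount (suc k) p u w = ∑ λ v → 𝟙 (u ~? v) * 𝟙 (¬? (v Finₚ.≟ p)) * nbCount k u v w

    nbCount-term : ∀ k {p u v w} → 𝟙 (u ~? v) * 𝟙 (¬? (v Finₚ.≟ p)) * nbCount k u v w ≢ 0ℚ →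
                   u ~ v × v ≢ p × nbCount k u v w ≢ 0ℚ
    nbCount-term k {p} {u} {v} {w} ≢0 with u ~? v | v Finₚ.≟ p
    ... | no _    | yes _  = contradiction (*-zeroˡ (nbCount k u v w)) ≢0
    ... | no _    | no _   = contradiction (*-zeroˡ (nbCount k u v w)) ≢0
    ... | yes _   | yes _  = contradiction (*-zeroˡ (nbCount k u v w)) ≢0
    ... | yes u~v | no v≢p = u~v , v≢p , λ N≡0 → ≢0 (trans (cong (1ℚ * 1ℚ *_) N≡0) (*-zeroʳ (1ℚ * 1ℚ)))

    nbCount-walk : ∀ k {p u w} → nbCount k p u w ≢ 0ℚ → Walk k p u w
    nbCount-walk zero {p} {u} {w} ≢0 with u Finₚ.≟ w
    ... | yes refl = stop
    ... | no _     = contradiction refl ≢0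
    nbCount-walk (suc k) {p} {u} {w} ≢0
      with ∑-nonzero (λ v → 𝟙 (u ~? v) * 𝟙 (¬? (v Finₚ.≟ p)) * nbCount k u v w) ≢0
    ... | v , ≢0ᵥ with nbCount-term k ≢0ᵥ
    ... | u~v , v≢p , N≢0 = step u~v v≢p (nbCount-walk k N≢0)

    0≤nbCount : ∀ k p u w → 0ℚ ≤ nbCount k p u w
    0≤nbCount zero    p u w = 0≤𝟙 (u Finₚ.≟ w)
    0≤nbCount (suc k) p u w = 0≤∑ λ v → 0≤𝟙 (u ~? v) *₀ 0≤𝟙 (¬? (v Finₚ.≟ p)) *₀ 0≤nbCount k u v w

    module Girth {X Y : Subset n} (parts : HasParts G X Y) {ℓ : ℕ} (free : EvenCycleFree ℓ G) where

      open HasParts parts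

      side : Fin n → Bool
      side v = Relation.Nullary.does (v ∈? X)

      side-alternates : ∀ {u v} → u ~ v → side u ≡ not (side v)
      side-alternates {u} {v} u~v with u ∈? X | v ∈? X
      ... | yes u∈X | yes v∈X = contradiction u~v (X-indep u∈X v∈X)
      ... | yes _   | no _    = refl
      ... | no _    | yes _   = refl
      ... | no u∉X  | no v∉X  = contradiction u~v (Y-indep (in-Y u∉X) (in-Y v∉X))
        where
        in-Y : ∀ {w} → w ∉ X → w Data.Fin.Subset.∈ Y
        in-Y {w} w∉X = [ (λ w∈X → contradiction w∈X w∉X) , (λ w∈Y → w∈Y) ]′ (cover w)

      side-along : ∀ x xs {z zs} → Linked _~_ (x ∷ xs ++ z ∷ zs) → side x ≡ nots (length (x ∷ xs)) (side z)
      side-along x []       (x~z ∷ _) = side-alternates x~z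
      side-along x (y ∷ xs) (x~y ∷ l) = trans (side-alternates x~y) (cong not (side-along y xs l))

      cycle : ∀ x y z ys {zs} → Unique (x ∷ y ∷ z ∷ ys) → Linked _~_ (x ∷ y ∷ z ∷ ys ++ x ∷ zs) →
              Cycle (length (x ∷ y ∷ z ∷ ys)) (ℕ.s≤s (ℕ.s≤s (ℕ.s≤s ℕ.z≤n))) ⊑ G
      cycle x y z ys u l = lookup (x ∷ y ∷ z ∷ ys) , lookup-unique u ,
        λ i j → [ next i j , ~-sym ∘ next j i ]′
        where
        adj = linked-lookup (x ∷ y ∷ z ∷ ys) l
        next : ∀ i j → Next i j → lookup (x ∷ y ∷ z ∷ ys) i ~ lookup (x ∷ y ∷ z ∷ ys) j
        next i j       (inj₁ eq)        = proj₁ adj i j eq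
        next i zero    (inj₂ (eq , _))  = proj₂ adj i eq
        next i (suc j) (inj₂ (_ , ()))

      -- The first return of a non-backtracking walk to one of its vertices closes a cycle,
      -- which is even because the sides alternate.
      nb-no-return : ∀ {x xs} → NonBacktracking (x ∷ xs) → length (x ∷ xs) ℕ.≤ suc (2 ℕ.* ℓ) →
                     Unique xs → ¬ (x ∈ₗ xs)
      nb-no-return {x} {xs} nb len u x∈ with ∈-∃++ x∈
      ... | ys , zs , eq = no-return ys eq (subst (NonBacktracking ∘ (x ∷_)) eq nb)
        where
        no-return : ∀ ys {zs} → xs ≡ ys ++ x ∷ zs → NonBacktracking (x ∷ ys ++ x ∷ zs) → Data.Empty.⊥
        no-return []          _  (edge x~x)      = ~-irrefl x~x
        no-return []          _  (extend x~x _ _) = ~-irrefl x~x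
        no-return (_ ∷ [])    _  (extend _ x≢x _) = x≢x refl
        no-return (y′ ∷ z ∷ ys) {zs} eq nb′ =
          free (length (x ∷ y′ ∷ z ∷ ys)) (ℕ.s≤s (ℕ.s≤s (ℕ.s≤s ℕ.z≤n)))
            (nots-even (length (x ∷ y′ ∷ z ∷ ys)) (sym (side-along x (y′ ∷ z ∷ ys) (nb-linked nb′))))
            short
            (cycle x y′ z ys (unique-prefix (y′ ∷ z ∷ ys) (subst Unique eq u)) (nb-linked nb′))
          where
          short : length (x ∷ y′ ∷ z ∷ ys) ℕ.≤ 2 ℕ.* ℓ
          short = ℕₚ.≤-pred (begin
            suc (length (x ∷ y′ ∷ z ∷ ys))              ≡⟨ cong suc (ℕₚ.+-comm 1 (length (y′ ∷ z ∷ ys))) ⟩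
            suc (length (y′ ∷ z ∷ ys) ℕ.+ 1)
              ≤⟨ ℕ.s≤s (ℕₚ.+-monoʳ-≤ (length (y′ ∷ z ∷ ys)) (ℕ.s≤s ℕ.z≤n)) ⟩
            suc (length (y′ ∷ z ∷ ys) ℕ.+ length (x ∷ zs)) ≡⟨ cong suc (length-++ (y′ ∷ z ∷ ys)) ⟨
            suc (length (y′ ∷ z ∷ ys ++ x ∷ zs))        ≡⟨ cong (suc ∘ length) eq ⟨
            length (x ∷ xs)                             ≤⟨ len ⟩
            suc (2 ℕ.* ℓ)                               ∎)
            where open ℕₚ.≤-Reasoning

      -- The bound on the length counts vertices and so allows 2ℓ edges: a repetition would close a
      -- cycle of length at most 2ℓ.
      nb-unique : ∀ vs → NonBacktracking vs → length vs ℕ.≤ suc (2 ℕ.* ℓ) → Unique vs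
      nb-unique (x ∷ [])     _  _   = [] ∷ []
      nb-unique (x ∷ y ∷ vs) nb len with nb-unique (y ∷ vs) (nb-tail nb) (ℕₚ.≤-trans (ℕₚ.n≤1+n _) len)
      ... | u = ¬Any⇒All¬ _ (nb-no-return nb len u) ∷ u

      -- If `v` and `v′` differ, one walk reversed and continued by the other does not backtrack at
      -- `u`. It meets its starting point `w` again within 2(k+1) ≤ 2ℓ edges, against `nb-unique`.
      first-step-unique : ∀ {k u v v′ w} → suc k ℕ.≤ ℓ → u ~ v → u ~ v′ →
                          Walk k u v w → Walk k u v′ w → v ≡ v′
      first-step-unique {k} {u} {v} {v′} {w} k<ℓ u~v u~v′ ω ω′ with v Finₚ.≟ v′
      ... | yes v≡v′ = v≡v′
      ... | no v≢v′ with walk-forward u~v′ ω′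
      ... | vs , nb , len , w∈ with walk-reverse ω (extend (~-sym u~v) v≢v′ nb)
      ... | cs , nb′ , len′ , ⊆cs = contradiction (⊆cs w∈) (Unique[x∷xs]⇒x∉xs (nb-unique (w ∷ cs) nb′ short))
        where
        lemma : ∀ k → suc (k ℕ.+ suc (suc k)) ≡ suc (2 ℕ.* suc k)
        lemma k = cong suc (trans (ℕₚ.+-suc k (suc k)) (cong (λ m → suc (k ℕ.+ m)) (sym (ℕₚ.+-identityʳ (suc k)))))
        short : suc (length cs) ℕ.≤ suc (2 ℕ.* ℓ)
        short = subst (ℕ._≤ suc (2 ℕ.* ℓ))
          (sym (trans (cong suc (trans len′ (cong (λ m → k ℕ.+ suc (suc m)) len))) (lemma k)))
          (ℕ.s≤s (ℕₚ.*-monoʳ-≤ 2 k<ℓ))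

      -- By `first-step-unique` at most one first step contributes to the sum, and induction bounds
      -- its term.
      nbCount≤1 : ∀ k → k ℕ.≤ ℓ → ∀ p u w → nbCount k p u w ≤ 1ℚ
      nbCount≤1 zero    _   p u w = 𝟙≤1 (u Finₚ.≟ w)
      nbCount≤1 (suc k) k<ℓ p u w with ∑ f ≟ 0ℚ
        where f = λ v → 𝟙 (u ~? v) * 𝟙 (¬? (v Finₚ.≟ p)) * nbCount k u v w
      ... | yes ∑≡0 = subst (_≤ 1ℚ) (sym ∑≡0) 0≤1
      ... | no ∑≢0 with ∑-nonzero (λ v → 𝟙 (u ~? v) * 𝟙 (¬? (v Finₚ.≟ p)) * nbCount k u v w) ∑≢0
      ... | v , fv≢0 = subst (_≤ 1ℚ) (sym (∑-single v f others)) fv≤1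
        where
        f = λ v → 𝟙 (u ~? v) * 𝟙 (¬? (v Finₚ.≟ p)) * nbCount k u v w
        others : ∀ v′ → v′ ≢ v → f v′ ≡ 0ℚ
        others v′ v′≢v with f v′ ≟ 0ℚ
        ... | yes f≡0 = f≡0
        ... | no fv′≢0 with nbCount-term k fv≢0 | nbCount-term k fv′≢0
        ... | u~v , _ , N≢0 | u~v′ , _ , N′≢0 = contradiction
          (first-step-unique k<ℓ u~v′ u~v (nbCount-walk k N′≢0) (nbCount-walk k N≢0)) v′≢v
        fv≤1 : f v ≤ 1ℚ
        fv≤1 = *-mono (0≤𝟙 (u ~? v) *₀ 0≤𝟙 (¬? (v Finₚ.≟ p)))
          (*-mono (0≤𝟙 (u ~? v)) (𝟙≤1 (u ~? v)) (0≤𝟙 (¬? (v Finₚ.≟ p))) (𝟙≤1 (¬? (v Finₚ.≟ p))))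
          (0≤nbCount k u v w) (nbCount≤1 k (ℕₚ.≤-trans (ℕₚ.n≤1+n k) k<ℓ) u v w)

-- Comparison of all walks with non-backtracking walks.

module WalkCounts where

  open Rationals
  open FiniteSums
  open NonBacktrackingWalks
  open import Data.Fin using (Fin; zero; suc)
  import Data.Fin.Properties as Finₚ
  open import Data.Fin.Subset using (Subset)
  open import Data.Nat using (ℕ; zero; suc; pred)
  import Data.Nat.Properties as ℕₚ
  open import Data.Rational hiding (_/_; NonZero)
  open import Data.Rational.Properties
  open import Relation.Binary.PropositionalEquality
  open import Relation.Nullary using (¬?; Dec; yes; no)
  open import Tactic.RingSolver using (solve-∀)

  𝟙-¬ : ∀ {P : Set} (P? : Dec P) → 𝟙 (¬? P?) ≡ 1ℚ - 𝟙 P?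
  𝟙-¬ (yes _) = refl
  𝟙-¬ (no _)  = refl

  𝟙-*-mono : ∀ {P : Set} (P? : Dec P) {p q} → (P → p ≤ q) → 𝟙 P? * p ≤ 𝟙 P? * q
  𝟙-*-mono (yes p) f = *-monoˡ 1ℚ 0≤1 (f p)
  𝟙-*-mono (no _) {p} {q} f = ≤-reflexive (trans (*-zeroˡ p) (sym (*-zeroˡ q)))

  ∑-point : ∀ {n} (p : Fin n) (f : Fin n → ℚ) → ∑ (λ v → f v * 𝟙 (v Finₚ.≟ p)) ≡ f p
  ∑-point p f = trans
    (∑-single p (λ v → f v * 𝟙 (v Finₚ.≟ p)) λ v v≢p →
      trans (cong (f v *_) (𝟙-no (v Finₚ.≟ p) v≢p)) (*-zeroʳ (f v)))
    (trans (cong (f p *_) (𝟙-yes (p Finₚ.≟ p) refl)) (*-identityʳ (f p)))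

  ∑-≢ : ∀ {n} (p : Fin n) (f : Fin n → ℚ) → ∑ (λ v → f v * 𝟙 (¬? (v Finₚ.≟ p))) ≡ ∑ f - f p
  ∑-≢ p f = begin
    ∑ (λ v → f v * 𝟙 (¬? (v Finₚ.≟ p)))
      ≡⟨ (∑-cong λ v → trans (cong (f v *_) (𝟙-¬ (v Finₚ.≟ p))) (lemma (f v) _)) ⟩
    ∑ (λ v → f v - f v * 𝟙 (v Finₚ.≟ p))  ≡⟨ ∑-- f (λ v → f v * 𝟙 (v Finₚ.≟ p)) ⟩
    ∑ f - ∑ (λ v → f v * 𝟙 (v Finₚ.≟ p))  ≡⟨ cong (_-_ (∑ f)) (∑-point p f) ⟩
    ∑ f - f p                             ∎
    where
    open ≡-Reasoning
    lemma : ∀ p q → p * (1ℚ - q) ≡ p - p * q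
    lemma = solve-∀ ring

  module Adjacency {n : ℕ} (G : Graph n) where

    open Graph G

    adj : Fin n → Fin n → ℚ
    adj u v = 𝟙 (u ~? v)

    adj-sym : ∀ u v → adj u v ≡ adj v u
    adj-sym u v = 𝟙-cong (u ~? v) (v ~? u) ~-sym ~-sym

    0≤adj : ∀ u v → 0ℚ ≤ adj u v
    0≤adj u v = 0≤𝟙 (u ~? v)

    open Operator adj public
    open Nonnegative 0≤adj public
    open Symmetric adj-sym public

    deg : Fin n → ℚ
    deg u = ∑ (adj u)

    0≤deg : ∀ u → 0ℚ ≤ deg u
    0≤deg u = 0≤∑ (0≤adj u)

    adj≢ : (p u v : Fin n) → ℚ
    adj≢ p u v = adj u v * 𝟙 (¬? (v Finₚ.≟ p))

    0≤adj≢ : ∀ p u v → 0ℚ ≤ adj≢ p u v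
    0≤adj≢ p u v = 0≤adj u v *₀ 0≤𝟙 (¬? (v Finₚ.≟ p))

    adj≢≤adj : ∀ p u v → adj≢ p u v ≤ adj u v
    adj≢≤adj p u v = subst (adj≢ p u v ≤_) (*-identityʳ (adj u v))
      (*-monoˡ (adj u v) (0≤adj u v) (𝟙≤1 (¬? (v Finₚ.≟ p))))

    nbSum : ℕ → (p u : Fin n) → (Fin n → ℚ) → ℚ
    nbSum k p u f = ∑ λ w → nbCount G k p u w * f w

    nbSum-zero : ∀ p u f → nbSum zero p u f ≡ f u
    nbSum-zero p u f = trans
      (∑-single u (λ w → 𝟙 (u Finₚ.≟ w) * f w) λ w w≢u →
        trans (cong (_* f w) (𝟙-no (u Finₚ.≟ w) (≢-sym w≢u))) (*-zeroˡ (f w)))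
      (trans (cong (_* f u) (𝟙-yes (u Finₚ.≟ u) refl)) (*-identityˡ (f u)))

    nbSum-suc : ∀ k p u f → nbSum (suc k) p u f ≡ ∑ λ v → adj≢ p u v * nbSum k u v f
    nbSum-suc k p u f = begin
      ∑ (λ w → ∑ (λ v → adj≢ p u v * nbCount G k u v w) * f w)
        ≡⟨ (∑-cong λ w → ∑-*ʳ (f w) (λ v → adj≢ p u v * nbCount G k u v w)) ⟨
      ∑ (λ w → ∑ (λ v → adj≢ p u v * nbCount G k u v w * f w))
        ≡⟨ ∑-swap (λ w v → adj≢ p u v * nbCount G k u v w * f w) ⟩
      ∑ (λ v → ∑ (λ w → adj≢ p u v * nbCount G k u v w * f w))
        ≡⟨ (∑-cong λ v → trans (∑-cong λ w → *-assoc (adj≢ p u v) (nbCount G k u v w) (f w))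
                               (∑-*ˡ (adj≢ p u v) (λ w → nbCount G k u v w * f w))) ⟩
      ∑ (λ v → adj≢ p u v * nbSum k u v f) ∎
      where open ≡-Reasoning

    module MaxDegree {Δ : ℚ} (0≤Δ : 0ℚ ≤ Δ) (deg≤Δ : ∀ u → deg u ≤ Δ)
                     {f : Fin n → ℚ} {F : ℚ} (0≤f : ∀ v → 0ℚ ≤ f v) (f≤F : ∀ v → f v ≤ F) where

      walks≤ : 0ℚ ≤ F → ∀ k u → A^ k f u ≤ Δ ^ k * F
      walks≤ 0≤F zero    u = subst (f u ≤_) (sym (*-identityˡ F)) (f≤F u)
      walks≤ 0≤F (suc k) u = begin
        ∑ (λ v → adj u v * A^ k f v)  ≤⟨ (∑-mono λ v → *-monoˡ (adj u v) (0≤adj u v) (walks≤ 0≤F k v)) ⟩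
        ∑ (λ v → adj u v * M)         ≡⟨ ∑-*ʳ M (adj u) ⟩
        deg u * M                     ≤⟨ *-monoʳ M (0≤^ k 0≤Δ *₀ 0≤F) (deg≤Δ u) ⟩
        Δ * (Δ ^ k * F)               ≡⟨ *-assoc Δ (Δ ^ k) F ⟨
        Δ ^ suc k * F                 ∎
        where
        open ≤-Reasoning
        M = Δ ^ k * F

      -- A walk is non-backtracking, or it first steps to p, or it backtracks later on.
      walks≤nbSum : 0ℚ ≤ F → ∀ k p u → A^ k f u ≤ nbSum k p u f + fromℕ k * Δ ^ pred k * F
      walks≤nbSum 0≤F zero p u = ≤-reflexive (trans (sym (nbSum-zero p u f)) (lemma (nbSum zero p u f) F))
        where
        lemma : ∀ a F → a ≡ a + 0ℚ * 1ℚ * F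
        lemma = solve-∀ ring
      walks≤nbSum 0≤F (suc k) p u = begin
        ∑ (λ v → adj u v * A^ k f v)
          ≡⟨ split ⟩
        ∑ (λ v → adj≢ p u v * A^ k f v) + adj u p * A^ k f p
          ≤⟨ +-mono-≤ (∑-mono λ v → *-monoˡ (adj≢ p u v) (0≤adj≢ p u v) (walks≤nbSum 0≤F k u v))
                      (*-mono (0≤adj u p) (𝟙≤1 (u ~? p)) (0≤A^ k 0≤f p) (walks≤ 0≤F k p)) ⟩
        ∑ (λ v → adj≢ p u v * (nbSum k u v f + B)) + 1ℚ * (Δ ^ k * F)
          ≡⟨ cong (_+ 1ℚ * (Δ ^ k * F)) distribute ⟩
        nbSum (suc k) p u f + ∑ (adj≢ p u) * B + 1ℚ * (Δ ^ k * F)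
          ≤⟨ +-monoˡ-≤ (1ℚ * (Δ ^ k * F)) (+-monoʳ-≤ (nbSum (suc k) p u f)
               (*-monoʳ B (0≤fromℕ k *₀ 0≤^ (pred k) 0≤Δ *₀ 0≤F)
                 (≤-trans (∑-mono (adj≢≤adj p u)) (deg≤Δ u)))) ⟩
        nbSum (suc k) p u f + Δ * B + 1ℚ * (Δ ^ k * F)
          ≡⟨ cong (λ b → nbSum (suc k) p u f + b + 1ℚ * (Δ ^ k * F)) (ΔB k) ⟩
        nbSum (suc k) p u f + fromℕ k * Δ ^ k * F + 1ℚ * (Δ ^ k * F)
          ≡⟨ collect (nbSum (suc k) p u f) (fromℕ k) (Δ ^ k) F ⟩
        nbSum (suc k) p u f + (1ℚ + fromℕ k) * Δ ^ k * F
          ≡⟨ cong (λ m → nbSum (suc k) p u f + m * Δ ^ k * F) (fromℕ-suc k) ⟨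
        nbSum (suc k) p u f + fromℕ (suc k) * Δ ^ k * F ∎
        where
        open ≤-Reasoning
        B = fromℕ k * Δ ^ pred k * F
        -- `Δ * Δ ^ pred k` is `Δ ^ k` only for positive `k`; at zero the factor `fromℕ k` makes
        -- both sides vanish.
        ΔB : ∀ k → Δ * (fromℕ k * Δ ^ pred k * F) ≡ fromℕ k * Δ ^ k * F
        ΔB zero    = lemma Δ F
          where
          lemma : ∀ Δ F → Δ * (0ℚ * 1ℚ * F) ≡ 0ℚ * 1ℚ * F
          lemma = solve-∀ ring
        ΔB (suc k) = lemma Δ (fromℕ (suc k)) (Δ ^ k) F
          where
          lemma : ∀ Δ m D F → Δ * (m * D * F) ≡ m * (Δ * D) * F
          lemma = solve-∀ ring
        collect : ∀ a m D F → a + m * D * F + 1ℚ * (D * F) ≡ a + (1ℚ + m) * D * F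
        collect = solve-∀ ring
        g = λ v → adj u v * A^ k f v
        rearrange : ∀ a b c → a * b * c ≡ a * c * b
        rearrange = solve-∀ ring
        cancel : ∀ a b → a ≡ a - b + b
        cancel = solve-∀ ring
        split : ∑ g ≡ ∑ (λ v → adj≢ p u v * A^ k f v) + g p
        split = trans (cancel (∑ g) (g p)) (cong (_+ g p) (trans (sym (∑-≢ p g))
          (∑-cong λ v → rearrange (adj u v) (A^ k f v) (𝟙 (¬? (v Finₚ.≟ p))))))
        distribute : ∑ (λ v → adj≢ p u v * (nbSum k u v f + B)) ≡ nbSum (suc k) p u f + ∑ (adj≢ p u) * B
        distribute = trans (∑-cong λ v → *-distribˡ-+ (adj≢ p u v) (nbSum k u v f) B)
          (trans (∑-+ (λ v → adj≢ p u v * nbSum k u v f) (λ v → adj≢ p u v * B))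
            (cong₂ _+_ (sym (nbSum-suc k p u f)) (∑-*ʳ B (adj≢ p u))))

    -- Asked only of vertices that have a neighbour: low-degree vertices will be isolated and not
    -- deleted, so that the vertex type `Fin n` and all subsets of it stay the same.
    MinDegree : ℚ → Set
    MinDegree θ = ∀ {u v} → u ~ v → θ ≤ deg u

    module _ {θ : ℚ} (1≤θ : 1ℚ ≤ θ) (minDegree : MinDegree θ) where

      0≤θ-1 : 0ℚ ≤ θ - 1ℚ
      0≤θ-1 = 0≤- 1≤θ

      nbSum-neighbours : ∀ k p u → (∀ v → u ~ v → (θ - 1ℚ) ^ k ≤ nbSum k u v (λ _ → 1ℚ)) →
                         (deg u - adj u p) * (θ - 1ℚ) ^ k ≤ nbSum (suc k) p u (λ _ → 1ℚ)
      nbSum-neighbours k p u bound = begin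
        (deg u - adj u p) * c                ≡⟨ cong (_* c) (∑-≢ p (adj u)) ⟨
        ∑ (adj≢ p u) * c                     ≡⟨ ∑-*ʳ c (adj≢ p u) ⟨
        ∑ (λ v → adj≢ p u v * c)             ≤⟨ ∑-mono term ⟩
        ∑ (λ v → adj≢ p u v * nbSum k u v (λ _ → 1ℚ)) ≡⟨ nbSum-suc k p u (λ _ → 1ℚ) ⟨
        nbSum (suc k) p u (λ _ → 1ℚ)         ∎
        where
        open ≤-Reasoning
        c = (θ - 1ℚ) ^ k
        term : ∀ v → adj≢ p u v * c ≤ adj≢ p u v * nbSum k u v (λ _ → 1ℚ)
        term v = subst₂ _≤_ (sym (*-assoc (adj u v) (𝟙 (¬? (v Finₚ.≟ p))) c))
                            (sym (*-assoc (adj u v) (𝟙 (¬? (v Finₚ.≟ p))) (nbSum k u v (λ _ → 1ℚ))))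
          (𝟙-*-mono (u ~? v) λ u~v → *-monoˡ (𝟙 (¬? (v Finₚ.≟ p))) (0≤𝟙 (¬? (v Finₚ.≟ p))) (bound v u~v))

      -- Every vertex reached has degree at least `θ`, and excluding the predecessor leaves at least
      -- `θ - 1` continuations.
      nbSum≥ : ∀ k p u → θ ≤ deg u → (θ - 1ℚ) ^ k ≤ nbSum k p u (λ _ → 1ℚ)
      nbSum≥ zero    p u _   = ≤-reflexive (sym (nbSum-zero p u (λ _ → 1ℚ)))
      nbSum≥ (suc k) p u θ≤d = ≤-trans
        (*-monoʳ ((θ - 1ℚ) ^ k) (0≤^ k 0≤θ-1) (+-mono-≤ θ≤d (neg-antimono-≤ (𝟙≤1 (u ~? p)))))
        (nbSum-neighbours k p u λ v u~v → nbSum≥ k u v (minDegree (~-sym u~v)))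

      -- Naming `u` as its own predecessor excludes nothing, since `u` is not adjacent to itself.
      -- The first step therefore keeps all `deg u` choices.
      nbSum-from : ∀ k u → deg u * (θ - 1ℚ) ^ k ≤ nbSum (suc k) u u (λ _ → 1ℚ)
      nbSum-from k u = subst (λ d → d * (θ - 1ℚ) ^ k ≤ nbSum (suc k) u u (λ _ → 1ℚ))
        (trans (cong (_-_ (deg u)) (𝟙-no (u ~? u) ~-irrefl)) (+-identityʳ (deg u)))
        (nbSum-neighbours k u u λ v u~v → nbSum≥ k u v (minDegree (~-sym u~v)))

    module _ {X Y : Subset n} (parts : HasParts G X Y) {ℓ : ℕ} (free : EvenCycleFree ℓ G) where

      nbSum≤∑ : ∀ {f} → (∀ v → 0ℚ ≤ f v) → ∀ p u → nbSum ℓ p u f ≤ ∑ f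
      nbSum≤∑ {f} 0≤f p u = ∑-mono λ w → subst (nbCount G ℓ p u w * f w ≤_) (*-identityˡ (f w))
        (*-monoʳ (f w) (0≤f w) (Girth.nbCount≤1 G parts free ℓ ℕₚ.≤-refl p u w))

      -- Between two vertices there is at most one non-backtracking walk of length ℓ.
      walks≤∑ : ∀ {Δ} → 0ℚ ≤ Δ → (∀ u → deg u ≤ Δ) →
                ∀ {f F} → 0ℚ ≤ F → (∀ v → 0ℚ ≤ f v) → (∀ v → f v ≤ F) →
                ∀ u → A^ ℓ f u ≤ ∑ f + fromℕ ℓ * Δ ^ pred ℓ * F
      walks≤∑ {Δ} 0≤Δ deg≤Δ {f} {F} 0≤F 0≤f f≤F u = ≤-trans
        (MaxDegree.walks≤nbSum 0≤Δ deg≤Δ 0≤f f≤F 0≤F ℓ u u)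
        (+-monoˡ-≤ (fromℕ ℓ * Δ ^ pred ℓ * F) (nbSum≤∑ 0≤f u u))

      -- The walks counted by `nbSum-from` end at distinct vertices, of which there are `n`. This is
      -- the source of the maximum degree.
      deg*-≤n : ∀ {θ} → 1ℚ ≤ θ → MinDegree θ → ∀ {k} → ℓ ≡ suc k → ∀ u → deg u * (θ - 1ℚ) ^ k ≤ fromℕ n
      deg*-≤n {θ} 1≤θ min {k} refl u = begin
        deg u * (θ - 1ℚ) ^ k          ≤⟨ nbSum-from 1≤θ min k u ⟩
        nbSum (suc k) u u (λ _ → 1ℚ)  ≤⟨ nbSum≤∑ (λ _ → 0≤1) u u ⟩
        ∑ {n} (λ _ → 1ℚ)              ≡⟨ trans (∑-const n 1ℚ) (*-identityʳ (fromℕ n)) ⟩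
        fromℕ n                       ∎
        where open ≤-Reasoning

-- Isolating the vertices of low degree.

module Trimming where

  open Rationals
  open FiniteSums
  open WalkCounts
  open import Data.Fin using (Fin; zero; suc)
  import Data.Fin.Properties as Finₚ
  open import Data.Fin.Subset using (Subset; _∈_; ⊤) renaming (∣_∣ to ∣_∣ˢ; _-_ to _-ˢ_)
  open import Data.Fin.Subset.Properties using (x∈p⇒∣p-x∣<∣p∣; x∈p∧x≢y⇒x∈p-y; ∣⊤∣≡n; ∈⊤)
  open import Data.Nat as ℕ using (ℕ; zero; suc)
  import Data.Nat.Properties as ℕₚ
  open import Data.Product using (Σ-syntax; _×_; _,_; proj₁)
  open import Data.Rational hiding (_/_; NonZero)
  open import Data.Rational.Properties
  open import Function using (_∘_; id)
  open import Relation.Binary.PropositionalEquality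
  open import Relation.Nullary using (¬?; yes; no; contradiction)
  open import Relation.Nullary.Decidable using (_×-dec_)
  open import Tactic.RingSolver using (solve-∀)

  open Graph using (_~_; _~?_; ~-sym; ~-irrefl)
  open Adjacency using (adj; deg; MinDegree)

  private
    variable
      n : ℕ

  infix 4 _⊆ᴳ_
  _⊆ᴳ_ : Graph n → Graph n → Set
  H ⊆ᴳ G = ∀ {u v} → _~_ H u v → _~_ G u v

  ⊆ᴳ-free : ∀ {H G : Graph n} {ℓ} → H ⊆ᴳ G → EvenCycleFree ℓ G → EvenCycleFree ℓ H
  ⊆ᴳ-free H⊆G free j 3≤j even j≤ (f , inj , hom) = free j 3≤j even j≤ (f , inj , λ u v → H⊆G ∘ hom u v)

  ⊆ᴳ-parts : ∀ {H G : Graph n} {X Y} → H ⊆ᴳ G → HasParts G X Y → HasParts H X Y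
  ⊆ᴳ-parts H⊆G parts = record
    { cover    = cover
    ; disjoint = disjoint
    ; X-indep  = λ u∈ v∈ → X-indep u∈ v∈ ∘ H⊆G
    ; Y-indep  = λ u∈ v∈ → Y-indep u∈ v∈ ∘ H⊆G
    }
    where open HasParts parts

  ⊆ᴳ-adj : ∀ {H G : Graph n} → H ⊆ᴳ G → ∀ u v → adj H u v ≤ adj G u v
  ⊆ᴳ-adj {H = H} {G} H⊆G u v = 𝟙-mono (_~?_ H u v) (_~?_ G u v) H⊆G

  total : Graph n → ℚ
  total G = ∑ (deg G)

  isolate : Graph n → Fin n → Graph n
  isolate G z = record
    { _~_      = λ u v → _~_ G u v × u ≢ z × v ≢ z
    ; _~?_     = λ u v → _~?_ G u v ×-dec ¬? (u Finₚ.≟ z) ×-dec ¬? (v Finₚ.≟ z)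
    ; ~-sym    = λ (u~v , u≢z , v≢z) → ~-sym G u~v , v≢z , u≢z
    ; ~-irrefl = ~-irrefl G ∘ proj₁
    }

  adj-isolate : ∀ (G : Graph n) z u v →
    adj G u v ≤ adj (isolate G z) u v + (adj G u v * 𝟙 (v Finₚ.≟ z) + adj G u v * 𝟙 (u Finₚ.≟ z))
  adj-isolate G z u v with _~?_ G u v | u Finₚ.≟ z | v Finₚ.≟ z
  ... | no _  | yes _ | yes _ = ≤-refl
  ... | no _  | yes _ | no _  = ≤-refl
  ... | no _  | no _  | yes _ = ≤-refl
  ... | no _  | no _  | no _  = ≤-refl
  ... | yes _ | yes _ | yes _ = +-monoʳ-≤ 1ℚ 0≤1
  ... | yes _ | yes _ | no _  = ≤-refl
  ... | yes _ | no _  | yes _ = ≤-refl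
  ... | yes _ | no _  | no _  = ≤-refl

  -- `total` counts ordered pairs, so the edges at `z` are lost once in its row and once in its
  -- column.
  total-isolate : ∀ (G : Graph n) z → total G ≤ total (isolate G z) + 2ℚ * deg G z
  total-isolate G z = begin
    ∑ (λ u → ∑ (adj G u))
      ≤⟨ (∑-mono λ u → ∑-mono (adj-isolate G z u)) ⟩
    ∑ (λ u → ∑ λ v → adj (isolate G z) u v + (adj G u v * 𝟙 (v Finₚ.≟ z) + adj G u v * 𝟙 (u Finₚ.≟ z)))
      ≡⟨ (∑-cong λ u → trans (∑-+ (adj (isolate G z) u) (λ v → adj G u v * 𝟙 (v Finₚ.≟ z) + adj G u v * 𝟙 (u Finₚ.≟ z)))
           (cong (λ ζ → deg (isolate G z) u + ζ) (trans (∑-+ (λ v → adj G u v * 𝟙 (v Finₚ.≟ z)) (λ v → adj G u v * 𝟙 (u Finₚ.≟ z)))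
             (cong₂ _+_ (∑-point z (adj G u)) (∑-*ʳ (𝟙 (u Finₚ.≟ z)) (adj G u)))))) ⟩
    ∑ (λ u → deg (isolate G z) u + (adj G u z + deg G u * 𝟙 (u Finₚ.≟ z)))
      ≡⟨ trans (∑-+ (deg (isolate G z)) (λ u → adj G u z + deg G u * 𝟙 (u Finₚ.≟ z)))
           (cong (λ ζ → total (isolate G z) + ζ) (trans (∑-+ (λ u → adj G u z) (λ u → deg G u * 𝟙 (u Finₚ.≟ z)))
             (cong₂ _+_ (∑-cong λ u → Adjacency.adj-sym G u z) (∑-point z (deg G))))) ⟩
    total (isolate G z) + (deg G z + deg G z)
      ≡⟨ cong (λ ζ → total (isolate G z) + ζ) (lemma (deg G z)) ⟩
    total (isolate G z) + 2ℚ * deg G z ∎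
    where
    open ≤-Reasoning
    lemma : ∀ d → d + d ≡ 2ℚ * d
    lemma = solve-∀ ring

  -- `W` contains every vertex that still has an edge. Isolating a vertex of degree below `θ` takes
  -- it out of `W` and costs at most `2ℚ * θ`, so `m` bounds both the number of rounds and the loss.
  trim-within : ∀ {θ} → 0ℚ ≤ θ → ∀ m (G : Graph n) (W : Subset n) → ∣ W ∣ˢ ℕ.≤ m → (∀ {u v} → _~_ G u v → u ∈ W) →
    Σ[ H ∈ Graph n ] H ⊆ᴳ G × MinDegree H θ × total G ≤ total H + fromℕ m * (2ℚ * θ)
  trim-within {n} {θ} 0≤θ m G W ∣W∣≤m within
    with Finₚ.any? (λ u → Finₚ.any? (λ v → _~?_ G u v) ×-dec (deg G u <? θ))
  ... | no none = G , id , (λ {u} {v} u~v → ≮⇒≥ λ d<θ → none (u , (v , u~v) , d<θ)) ,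
    subst (_≤ total G + fromℕ m * (2ℚ * θ)) (+-identityʳ (total G))
      (+-monoʳ-≤ (total G) (0≤fromℕ m *₀ (nonNegative⁻¹ 2ℚ *₀ 0≤θ)))
  trim-within {n} {θ} 0≤θ zero G W ∣W∣≤m within | yes (z , (v , z~v) , d<θ) =
    contradiction (ℕₚ.<-≤-trans (x∈p⇒∣p-x∣<∣p∣ (within z~v)) ∣W∣≤m) λ ()
  trim-within {n} {θ} 0≤θ (suc m) G W ∣W∣≤m within | yes (z , (v , z~v) , d<θ)
    with trim-within 0≤θ m (isolate G z) (W -ˢ z)
           (ℕₚ.≤-pred (ℕₚ.<-≤-trans (x∈p⇒∣p-x∣<∣p∣ (within z~v)) ∣W∣≤m))
           (λ (u~v , u≢z , _) → x∈p∧x≢y⇒x∈p-y (within u~v) u≢z)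
  ... | H , H⊆ , min , loss = H , proj₁ ∘ H⊆ , min , (begin
    total G                                              ≤⟨ total-isolate G z ⟩
    total (isolate G z) + 2ℚ * deg G z
      ≤⟨ +-mono-≤ loss (*-monoˡ 2ℚ (nonNegative⁻¹ 2ℚ) (<⇒≤ d<θ)) ⟩
    total H + fromℕ m * (2ℚ * θ) + 2ℚ * θ                ≡⟨ lemma (total H) (fromℕ m) θ ⟩
    total H + (1ℚ + fromℕ m) * (2ℚ * θ)
      ≡⟨ cong (λ k → total H + k * (2ℚ * θ)) (fromℕ-suc m) ⟨
    total H + fromℕ (suc m) * (2ℚ * θ)                   ∎)
    where
    open ≤-Reasoning
    lemma : ∀ t m θ → t + m * (2ℚ * θ) + 2ℚ * θ ≡ t + (1ℚ + m) * (2ℚ * θ)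
    lemma = solve-∀ ring

  trim : ∀ {θ} → 0ℚ ≤ θ → (G : Graph n) →
    Σ[ H ∈ Graph n ] H ⊆ᴳ G × MinDegree H θ × total G ≤ total H + fromℕ n * (2ℚ * θ)
  trim {n} 0≤θ G = trim-within 0≤θ n G ⊤ (ℕₚ.≤-reflexive (∣⊤∣≡n n)) (λ _ → ∈⊤)

-- Polynomial inequalities for the sizes of the two parts.

module PartSizeBounds where

  open Rationals
  open import Data.Rational hiding (_/_; NonZero)
  open import Data.Rational.Properties
  open import Relation.Binary.PropositionalEquality
  open import Tactic.RingSolver using (solve-∀)

  ²-cancel : ∀ {p q} → 0ℚ ≤ q → p * p ≤ q * q → p ≤ q
  ²-cancel {p} {q} 0≤q p²≤q² = ^-cancelˡ 1 0≤q
    (subst₂ _≤_ (cong (p *_) (sym (*-identityʳ p))) (cong (q *_) (sym (*-identityʳ q))) p²≤q²)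

  am-gm : ∀ {x y N} → x + y ≡ N → 4ℚ * (x * y) ≤ N * N
  am-gm {x} {y} refl = ≤-by ((x - y) * (x - y)) (lemma x y) (0≤² (x - y))
    where
    lemma : ∀ x y → (x + y) * (x + y) - 4ℚ * (x * y) ≡ (x - y) * (x - y)
    lemma = solve-∀ ring

  -- `x` and `y` are the sizes of the parts, `q` is the ℓ-th power of the average degree, and `b` is
  -- the number of walks lost to backtracking. `τ` measures how far `q` may fall below `N / 2`, and
  -- `β` the size of `b` relative to `N`.
  module PartSizes {N b q τ β x y : ℚ} (x+y≡N : x + y ≡ N) (0<x : 0ℚ < x) (0<y : 0ℚ < y)
    (0≤b : 0ℚ ≤ b) (b≤βN : b ≤ β * N) (0≤τ : 0ℚ ≤ τ) (τ≤1 : τ ≤ 1ℚ) (0≤β : 0ℚ ≤ β) (β≤1 : β ≤ 1ℚ)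
    (0≤q : 0ℚ ≤ q) (2q≥ : (1ℚ - τ) * N ≤ 2ℚ * q) where

    κ : ℚ
    κ = 3ℚ * (τ + 2ℚ * β)

    0≤x = <⇒≤ 0<x
    0≤y = <⇒≤ 0<y

    0≤N : 0ℚ ≤ N
    0≤N = subst (0ℚ ≤_) x+y≡N (0≤x +₀ 0≤y)

    0≤4q²- : 0ℚ ≤ 4ℚ * (q * q) - (1ℚ - τ) * N * ((1ℚ - τ) * N)
    0≤4q²- = subst (λ p → 0ℚ ≤ p - (1ℚ - τ) * N * ((1ℚ - τ) * N)) (lemma q)
      (0≤- (*-mono 0≤⟨1-τ⟩N 2q≥ 0≤⟨1-τ⟩N 2q≥))
      where
      0≤⟨1-τ⟩N = 0≤- τ≤1 *₀ 0≤N
      lemma : ∀ q → 2ℚ * q * (2ℚ * q) ≡ 4ℚ * (q * q)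
      lemma = solve-∀ ring

    0≤β²N²-b² : 0ℚ ≤ β * N * (β * N) - b * b
    0≤β²N²-b² = 0≤- (*-mono 0≤b b≤βN 0≤b b≤βN)

    -- For walks that end in the other part. The main terms cancel: `x * x * y` is at most `x` times
    -- a quarter of `N * N` by AM-GM, and `q * q` is nearly that quarter or more. What remains is of
    -- order `τ` and `β`.
    defect-across : y * ((x + b) * (x + b)) - x * (q * q) ≤ κ * (N * N * N)
    defect-across = *-cancelˡ 4ℚ (positive⁻¹ 4ℚ) (≤-by
      -- One slack term for each inequality used, then what is left over of `4ℚ * κ * (N * N * N)`.
      ((x + 2ℚ * b) * (N * N - 4ℚ * (x * y)) + x * (4ℚ * (q * q) - (1ℚ - τ) * N * ((1ℚ - τ) * N))
        + 2ℚ * (β * N - b) * (N * N) + 4ℚ * y * (β * N * (β * N) - b * b)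
        + (4ℚ * x * (β * N * (β * N)) + 4ℚ * (β * (1ℚ - β)) * (N * N * N)
        + (2ℚ * τ * y * (N * N) + x * (τ * τ) * (N * N) + (2ℚ * τ + 8ℚ * τ + 2ℚ * β + 8ℚ * β + 8ℚ * β) * (N * N * N))))
      (subst (λ N → 4ℚ * (κ * (N * N * N)) - 4ℚ * (y * ((x + b) * (x + b)) - x * (q * q)) ≡
        (x + 2ℚ * b) * (N * N - 4ℚ * (x * y)) + x * (4ℚ * (q * q) - (1ℚ - τ) * N * ((1ℚ - τ) * N))
        + 2ℚ * (β * N - b) * (N * N) + 4ℚ * y * (β * N * (β * N) - b * b)
        + (4ℚ * x * (β * N * (β * N)) + 4ℚ * (β * (1ℚ - β)) * (N * N * N)
        + (2ℚ * τ * y * (N * N) + x * (τ * τ) * (N * N) + (2ℚ * τ + 8ℚ * τ + 2ℚ * β + 8ℚ * β + 8ℚ * β) * (N * N * N))))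
        x+y≡N (lemma x y b q τ β))
      ((0≤x +₀ 0≤2 *₀ 0≤b) *₀ 0≤- (am-gm {x} {y} x+y≡N) +₀ 0≤x *₀ 0≤4q²-
        +₀ 0≤2 *₀ 0≤- b≤βN *₀ 0≤N² +₀ 0≤4 *₀ 0≤y *₀ 0≤β²N²-b²
        +₀ (0≤4 *₀ 0≤x *₀ 0≤² (β * N) +₀ 0≤4 *₀ (0≤β *₀ 0≤- β≤1) *₀ 0≤N³
        +₀ (0≤2 *₀ 0≤τ *₀ 0≤y *₀ 0≤N² +₀ 0≤x *₀ 0≤² τ *₀ 0≤N²
        +₀ (0≤2 *₀ 0≤τ +₀ 0≤8 *₀ 0≤τ +₀ 0≤2 *₀ 0≤β +₀ 0≤8 *₀ 0≤β +₀ 0≤8 *₀ 0≤β) *₀ 0≤N³))))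
      where
      0≤2 = nonNegative⁻¹ 2ℚ
      0≤4 = nonNegative⁻¹ 4ℚ
      0≤8 = nonNegative⁻¹ 8ℚ
      0≤N² = 0≤² N
      0≤N³ = 0≤N² *₀ 0≤N
      lemma : ∀ x y b q τ β →
        4ℚ * (3ℚ * (τ + 2ℚ * β) * ((x + y) * (x + y) * (x + y))) - 4ℚ * (y * ((x + b) * (x + b)) - x * (q * q)) ≡
        (x + 2ℚ * b) * ((x + y) * (x + y) - 4ℚ * (x * y))
        + x * (4ℚ * (q * q) - (1ℚ - τ) * (x + y) * ((1ℚ - τ) * (x + y)))
        + 2ℚ * (β * (x + y) - b) * ((x + y) * (x + y)) + 4ℚ * y * (β * (x + y) * (β * (x + y)) - b * b)
        + (4ℚ * x * (β * (x + y) * (β * (x + y))) + 4ℚ * (β * (1ℚ - β)) * ((x + y) * (x + y) * (x + y))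
        + (2ℚ * τ * y * ((x + y) * (x + y)) + x * (τ * τ) * ((x + y) * (x + y))
           + (2ℚ * τ + 8ℚ * τ + 2ℚ * β + 8ℚ * β + 8ℚ * β) * ((x + y) * (x + y) * (x + y))))
      lemma = solve-∀ ring

    -- For walks that end in the part where they start. The difference of squares has the factor
    -- `x + b - q`; as `x = N - y` and `y ≥ q - b`, this factor is at most `N - 2q + 2b`, hence at
    -- most `(τ + 2β) N`.
    defect-within : q ≤ x + b → q ≤ y + b → x * ((x + b) * (x + b)) - x * (q * q) ≤ κ * (N * N * N)
    defect-within q≤x+b q≤y+b = begin
      x * ((x + b) * (x + b)) - x * (q * q)   ≡⟨ lemma₁ x b q ⟩
      x * ((x + b - q) * (x + b + q))         ≤⟨ *-mono 0≤x x≤N (0≤u *₀ (0≤x +₀ 0≤b +₀ 0≤q))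
                                                   (*-mono 0≤u u≤ (0≤x +₀ 0≤b +₀ 0≤q) s≤) ⟩
      N * ((τ + 2ℚ * β) * N * (3ℚ * N))       ≡⟨ lemma₂ N τ β ⟩
      κ * (N * N * N)                         ∎
      where
      open ≤-Reasoning
      lemma₁ : ∀ x b q → x * ((x + b) * (x + b)) - x * (q * q) ≡ x * ((x + b - q) * (x + b + q))
      lemma₁ = solve-∀ ring
      lemma₂ : ∀ N τ β → N * ((τ + 2ℚ * β) * N * (3ℚ * N)) ≡ 3ℚ * (τ + 2ℚ * β) * (N * N * N)
      lemma₂ = solve-∀ ring
      0≤u : 0ℚ ≤ x + b - q
      0≤u = 0≤- q≤x+b
      x≤N : x ≤ N
      x≤N = ≤-by y (subst (λ N → N - x ≡ y) x+y≡N (l x y)) 0≤y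
        where
        l : ∀ x y → x + y - x ≡ y
        l = solve-∀ ring
      u≤ : x + b - q ≤ (τ + 2ℚ * β) * N
      u≤ = ≤-by ((y + b - q) + (2ℚ * q - (1ℚ - τ) * N) + 2ℚ * (β * N - b))
        (subst (λ N → (τ + 2ℚ * β) * N - (x + b - q) ≡ (y + b - q) + (2ℚ * q - (1ℚ - τ) * N) + 2ℚ * (β * N - b))
          x+y≡N (l x y b q τ β))
        (0≤- q≤y+b +₀ 0≤- 2q≥ +₀ nonNegative⁻¹ 2ℚ *₀ 0≤- b≤βN)
        where
        l : ∀ x y b q τ β → (τ + 2ℚ * β) * (x + y) - (x + b - q)
          ≡ (y + b - q) + (2ℚ * q - (1ℚ - τ) * (x + y)) + 2ℚ * (β * (x + y) - b)
        l = solve-∀ ring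
      s≤ : x + b + q ≤ 3ℚ * N
      s≤ = ≤-by ((y + b - q) + 2ℚ * (β * N - b) + 2ℚ * (1ℚ - β) * N)
        (subst (λ N → 3ℚ * N - (x + b + q) ≡ (y + b - q) + 2ℚ * (β * N - b) + 2ℚ * (1ℚ - β) * N)
          x+y≡N (l x y b q β))
        (0≤- q≤y+b +₀ nonNegative⁻¹ 2ℚ *₀ 0≤- b≤βN +₀ nonNegative⁻¹ 2ℚ *₀ 0≤- β≤1 *₀ 0≤N)
        where
        l : ∀ x y b q β → 3ℚ * (x + y) - (x + b + q)
          ≡ (y + b - q) + 2ℚ * (β * (x + y) - b) + 2ℚ * (1ℚ - β) * (x + y)
        l = solve-∀ ring

    0<x*y : 0ℚ < x * y
    0<x*y = 0<* 0<x 0<y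

    -- Multiplying the two hypotheses makes `x * y` cancel and leaves squares on both sides.
    product-across : x * (q * q) ≤ y * ((x + b) * (x + b)) → y * (q * q) ≤ x * ((y + b) * (y + b)) →
                     q * q ≤ (x + b) * (y + b)
    product-across h₁ h₂ = ²-cancel ((0≤x +₀ 0≤b) *₀ (0≤y +₀ 0≤b)) (*-cancelˡ (x * y) 0<x*y
      (subst₂ _≤_ (l₁ x y q) (l₂ x y b) (*-mono (0≤x *₀ 0≤² q) h₁ (0≤y *₀ 0≤² q) h₂)))
      where
      l₁ : ∀ x y q → x * (q * q) * (y * (q * q)) ≡ x * y * (q * q * (q * q))
      l₁ = solve-∀ ring
      l₂ : ∀ x y b → y * ((x + b) * (x + b)) * (x * ((y + b) * (y + b))) ≡
                     x * y * ((x + b) * (y + b) * ((x + b) * (y + b)))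
      l₂ = solve-∀ ring

    -- The loss `2τ` comes from squaring `1 - τ`, and `8β` from `4bN + 4b² ≤ 8βN²`, which uses
    -- `β ≤ 1`.
    parts-balanced : q * q ≤ (x + b) * (y + b) → (1ℚ - 2ℚ * τ - 8ℚ * β) * (N * N) ≤ 4ℚ * (x * y)
    parts-balanced h = ≤-by
      (4ℚ * ((x + b) * (y + b) - q * q) + (4ℚ * (q * q) - (1ℚ - τ) * N * ((1ℚ - τ) * N))
        + τ * τ * (N * N) + 4ℚ * N * (β * N - b) + 4ℚ * (β * N * (β * N) - b * b) + 4ℚ * (β * (1ℚ - β)) * (N * N))
      (subst (λ N → 4ℚ * (x * y) - (1ℚ - 2ℚ * τ - 8ℚ * β) * (N * N) ≡
        4ℚ * ((x + b) * (y + b) - q * q) + (4ℚ * (q * q) - (1ℚ - τ) * N * ((1ℚ - τ) * N))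
        + τ * τ * (N * N) + 4ℚ * N * (β * N - b) + 4ℚ * (β * N * (β * N) - b * b) + 4ℚ * (β * (1ℚ - β)) * (N * N))
        x+y≡N (l x y b q τ β))
      (0≤4 *₀ 0≤- h +₀ 0≤4q²- +₀ 0≤² τ *₀ 0≤² N +₀ 0≤4 *₀ 0≤N *₀ 0≤- b≤βN +₀ 0≤4 *₀ 0≤β²N²-b²
        +₀ 0≤4 *₀ (0≤β *₀ 0≤- β≤1) *₀ 0≤² N)
      where
      0≤4 = nonNegative⁻¹ 4ℚ
      l : ∀ x y b q τ β → 4ℚ * (x * y) - (1ℚ - 2ℚ * τ - 8ℚ * β) * ((x + y) * (x + y)) ≡
        4ℚ * ((x + b) * (y + b) - q * q) + (4ℚ * (q * q) - (1ℚ - τ) * (x + y) * ((1ℚ - τ) * (x + y)))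
        + τ * τ * ((x + y) * (x + y)) + 4ℚ * (x + y) * (β * (x + y) - b) + 4ℚ * (β * (x + y) * (β * (x + y)) - b * b)
        + 4ℚ * (β * (1ℚ - β)) * ((x + y) * (x + y))
      l = solve-∀ ring

-- Mixing in a bipartite graph that satisfies a walk bound.

module BipartiteMixing where

  open Rationals
  open FiniteSums
  open WalkCounts
  open Trimming
  open PartSizeBounds
  open import Data.Fin using (Fin; zero; suc)
  open import Data.Fin.Subset using (Subset; _∈_; _∉_; _⊆_)
  open import Data.Fin.Subset.Properties using (_∈?_)
  open import Data.Nat using (ℕ; zero; suc)
  open import Data.Product using (_×_; _,_)
  open import Data.Rational hiding (_/_; NonZero)
  open import Data.Rational.Properties
  open import Data.Sum using (_⊎_; inj₁; inj₂; swap; [_,_]′)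
  open import Function using (_∘_; id)
  open import Relation.Binary.PropositionalEquality
  open import Relation.Nullary using (yes; no; contradiction)
  open import Tactic.RingSolver using (solve-∀)

  ⟦_⟧ : ∀ {n} → Subset n → Fin n → ℚ
  ⟦ S ⟧ v = 𝟙 (v ∈? S)

  card : ∀ {n} → Subset n → ℚ
  card S = ∑ ⟦ S ⟧

  0≤⟦⟧ : ∀ {n} (S : Subset n) v → 0ℚ ≤ ⟦ S ⟧ v
  0≤⟦⟧ S v = 0≤𝟙 (v ∈? S)

  ⟦⟧-mono : ∀ {n} {S T : Subset n} → S ⊆ T → ∀ v → ⟦ S ⟧ v ≤ ⟦ T ⟧ v
  ⟦⟧-mono {S = S} {T} S⊆T v = 𝟙-mono (v ∈? S) (v ∈? T) S⊆T

  0≤card : ∀ {n} (S : Subset n) → 0ℚ ≤ card S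
  0≤card S = 0≤∑ (0≤⟦⟧ S)

  card-⟨⟩ : ∀ {n} (S : Subset n) → ⟨ ⟦ S ⟧ , ⟦ S ⟧ ⟩ ≡ card S
  card-⟨⟩ S = ∑-cong λ v → 𝟙² (v ∈? S)

  card≤n : ∀ {n} (S : Subset n) → card S ≤ fromℕ n
  card≤n {n} S = subst (card S ≤_) (trans (∑-const n 1ℚ) (*-identityʳ (fromℕ n))) (∑-mono λ v → 𝟙≤1 (v ∈? S))

  ²-^ : ∀ p k → (p * p) ^ k ≡ p ^ k * p ^ k
  ²-^ p k = ^-distrib-* p p k

  flip-parts : ∀ {n} {G : Graph n} {X Y} → HasParts G X Y → HasParts G Y X
  flip-parts parts = record
    { cover    = swap ∘ cover
    ; disjoint = λ v∈Y v∈X → disjoint v∈X v∈Y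
    ; X-indep  = Y-indep
    ; Y-indep  = X-indep
    }
    where open HasParts parts

  -- The part in which walks of length k from X end.
  end-part : ∀ {n} → ℕ → Subset n → Subset n → Subset n
  end-part zero    X Y = X
  end-part (suc k) X Y = end-part k Y X

  end-part-cases : ∀ {n} k (X Y : Subset n) →
    (end-part k X Y ≡ X × end-part k Y X ≡ Y) ⊎ (end-part k X Y ≡ Y × end-part k Y X ≡ X)
  end-part-cases zero    X Y = inj₁ (refl , refl)
  end-part-cases (suc k) X Y = swap (end-part-cases k Y X)

  VanishesOff : ∀ {n} → Subset n → (Fin n → ℚ) → Set
  VanishesOff S f = ∀ v → v ∉ S → f v ≡ 0ℚ

  module _ {n : ℕ} (G : Graph n) where

    open Graph G
    open Adjacency G

    vanishes-A : ∀ {X Y f} → HasParts G X Y → VanishesOff X f → VanishesOff Y (A f)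
    vanishes-A {X} {Y} {f} parts off u u∉Y = ∑-zero term
      where
      open HasParts parts
      u∈X : u ∈ X
      u∈X = [ id , (λ u∈Y → contradiction u∈Y u∉Y) ]′ (cover u)
      term : ∀ v → adj u v * f v ≡ 0ℚ
      term v with u ~? v
      ... | yes u~v = trans (*-identityˡ (f v)) (off v λ v∈X → X-indep u∈X v∈X u~v)
      ... | no _    = *-zeroˡ (f v)

    vanishes-A-end : ∀ {X Y f} → HasParts G X Y → ∀ k → VanishesOff (end-part k X Y) f →
                     VanishesOff (end-part k Y X) (A f)
    vanishes-A-end parts zero    = vanishes-A parts
    vanishes-A-end parts (suc k) = vanishes-A-end (flip-parts parts) k

    vanishes-A^ : ∀ {X Y f} → HasParts G X Y → VanishesOff X f → ∀ k → VanishesOff (end-part k X Y) (A^ k f)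
    vanishes-A^ parts off zero    = off
    vanishes-A^ parts off (suc k) = vanishes-A-end parts k (vanishes-A^ parts off k)

    card-parts : ∀ {X Y} → HasParts G X Y → card X + card Y ≡ fromℕ n
    card-parts {X} {Y} parts = trans (sym (∑-+ ⟦ X ⟧ ⟦ Y ⟧))
      (trans (∑-cong one) (trans (∑-const n 1ℚ) (*-identityʳ (fromℕ n))))
      where
      open HasParts parts
      one : ∀ v → ⟦ X ⟧ v + ⟦ Y ⟧ v ≡ 1ℚ
      one v with v ∈? X | v ∈? Y
      ... | yes v∈X | yes v∈Y = contradiction v∈Y (disjoint v∈X)
      ... | yes _   | no _    = refl
      ... | no _    | yes _   = refl
      ... | no v∉X  | no v∉Y  = [ (λ p → contradiction p v∉X) , (λ p → contradiction p v∉Y) ]′ (cover v)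

    deg-X : ∀ {X Y} → HasParts G X Y → ∀ u → ⟦ X ⟧ u * deg u ≡ ⟦ X ⟧ u * A ⟦ Y ⟧ u
    deg-X {X} {Y} parts u with u ∈? X
    ... | no _    = trans (*-zeroˡ (deg u)) (sym (*-zeroˡ (A ⟦ Y ⟧ u)))
    ... | yes u∈X = cong (1ℚ *_) (∑-cong term)
      where
      open HasParts parts
      term : ∀ v → adj u v ≡ adj u v * ⟦ Y ⟧ v
      term v with u ~? v | v ∈? Y
      ... | yes u~v | yes _  = refl
      ... | yes u~v | no v∉Y = [ (λ v∈X → contradiction u~v (X-indep u∈X v∈X)) , (λ v∈Y → contradiction v∈Y v∉Y) ]′ (cover v)
      ... | no _    | yes _  = refl
      ... | no _    | no _   = refl

    edges : (X Y : Subset n) → ℚ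
    edges X Y = ⟨ ⟦ X ⟧ , A ⟦ Y ⟧ ⟩

    edges-sym : ∀ X Y → edges X Y ≡ edges Y X
    edges-sym X Y = trans (self-adjoint ⟦ X ⟧ ⟦ Y ⟧) (⟨⟩-comm (A ⟦ X ⟧) ⟦ Y ⟧)

    total-edges : ∀ {X Y} → HasParts G X Y → total G ≡ 2ℚ * edges X Y
    total-edges {X} {Y} parts = begin
      ∑ deg                                         ≡⟨ ∑-cong split ⟩
      ∑ (λ u → ⟦ X ⟧ u * deg u + ⟦ Y ⟧ u * deg u)   ≡⟨ ∑-+ (λ u → ⟦ X ⟧ u * deg u) (λ u → ⟦ Y ⟧ u * deg u) ⟩
      ∑ (λ u → ⟦ X ⟧ u * deg u) + ∑ (λ u → ⟦ Y ⟧ u * deg u)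
        ≡⟨ cong₂ _+_ (∑-cong (deg-X parts)) (∑-cong (deg-X (flip-parts parts))) ⟩
      edges X Y + edges Y X                         ≡⟨ cong (λ ζ → edges X Y + ζ) (edges-sym Y X) ⟩
      edges X Y + edges X Y                         ≡⟨ lemma (edges X Y) ⟩
      2ℚ * edges X Y                                ∎
      where
      open ≡-Reasoning
      open HasParts parts
      lemma : ∀ p → p + p ≡ 2ℚ * p
      lemma = solve-∀ ring
      split : ∀ u → deg u ≡ ⟦ X ⟧ u * deg u + ⟦ Y ⟧ u * deg u
      split u with u ∈? X | u ∈? Y
      ... | yes u∈X | yes u∈Y = contradiction u∈Y (disjoint u∈X)
      ... | yes _   | no _    = l (deg u)
        where
        l : ∀ d → d ≡ 1ℚ * d + 0ℚ * d
        l = solve-∀ ring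
      ... | no _    | yes _   = l (deg u)
        where
        l : ∀ d → d ≡ 0ℚ * d + 1ℚ * d
        l = solve-∀ ring
      ... | no u∉X  | no u∉Y  = [ (λ p → contradiction p u∉X) , (λ p → contradiction p u∉Y) ]′ (cover u)

    -- The cycle hypothesis survives only as `walks≤`. Values up to 2 occur because it is applied to
    -- `⟦ X ⟧` plus a function bounded by `⟦ X ⟧`.
    module WalkBound {k : ℕ} {b D : ℚ} (0<D : 0ℚ < D) (total≡ : total G ≡ fromℕ n * D) (0<n : 0ℚ < fromℕ n)
      (walks≤ : ∀ f → (∀ v → 0ℚ ≤ f v) → (∀ v → f v ≤ 2ℚ) → ∀ u → A^ (suc k) f u ≤ ∑ f + b) where

      N q : ℚ
      N = fromℕ n
      q = D ^ suc k

      module Part {X Y : Subset n} (parts : HasParts G X Y) where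

        x y E : ℚ
        x = card X
        y = card Y
        E = edges X Y

        x+y≡N : x + y ≡ N
        x+y≡N = card-parts parts

        2E≡ND : 2ℚ * E ≡ N * D
        2E≡ND = trans (sym (total-edges parts)) total≡

        0<E : 0ℚ < E
        0<E = *-cancelˡ-<-nonNeg 2ℚ (subst₂ _<_ (sym (*-zeroʳ 2ℚ)) (sym 2E≡ND) (0<* 0<n 0<D))

        E²≤ : E * E ≤ moment 1 ⟦ X ⟧ * y
        E²≤ = subst₂ _≤_ (cong (λ e → e * e) (sym (self-adjoint ⟦ X ⟧ ⟦ Y ⟧)))
          (cong (moment 1 ⟦ X ⟧ *_) (card-⟨⟩ Y)) (cauchy-schwarz (A ⟦ X ⟧) ⟦ Y ⟧)

        0<y : 0ℚ < y
        0<y with 0ℚ <? y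
        ... | yes 0<y = 0<y
        ... | no y≯0  = contradiction (<-≤-trans (0<* 0<E 0<E) (subst (E * E ≤_) m*y≡0 E²≤)) (<-irrefl refl)
          where
          m*y≡0 : moment 1 ⟦ X ⟧ * y ≡ 0ℚ
          m*y≡0 = trans (cong (moment 1 ⟦ X ⟧ *_) (≤-antisym (≮⇒≥ y≯0) (0≤card Y))) (*-zeroʳ (moment 1 ⟦ X ⟧))

        -- Cauchy-Schwarz against the indicator of `Y` gives at least `E * E / y`. Since `2E = ND`
        -- and `4xy ≤ N²`, unequal parts do no harm to this lower bound.
        xD²≤m₁ : x * (D * D) ≤ moment 1 ⟦ X ⟧
        xD²≤m₁ = *-cancelˡ 4ℚ (positive⁻¹ 4ℚ) (*-cancelˡ y 0<y (begin
          y * (4ℚ * (x * (D * D)))     ≡⟨ lemma₁ x y D ⟩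
          4ℚ * (x * y) * (D * D)       ≤⟨ *-monoʳ (D * D) (0≤² D) (am-gm {x} {y} x+y≡N) ⟩
          N * N * (D * D)              ≡⟨ lemma₂ N D ⟩
          N * D * (N * D)              ≡⟨ cong (λ e → e * e) 2E≡ND ⟨
          2ℚ * E * (2ℚ * E)            ≡⟨ lemma₃ E ⟩
          4ℚ * (E * E)                 ≤⟨ *-monoˡ 4ℚ (nonNegative⁻¹ 4ℚ) E²≤ ⟩
          4ℚ * (moment 1 ⟦ X ⟧ * y)    ≡⟨ lemma₄ (moment 1 ⟦ X ⟧) y ⟩
          y * (4ℚ * moment 1 ⟦ X ⟧)    ∎))
          where
          open ≤-Reasoning
          lemma₁ : ∀ x y D → y * (4ℚ * (x * (D * D))) ≡ 4ℚ * (x * y) * (D * D)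
          lemma₁ = solve-∀ ring
          lemma₂ : ∀ N D → N * N * (D * D) ≡ N * D * (N * D)
          lemma₂ = solve-∀ ring
          lemma₃ : ∀ E → 2ℚ * E * (2ℚ * E) ≡ 4ℚ * (E * E)
          lemma₃ = solve-∀ ring
          lemma₄ : ∀ m y → 4ℚ * (m * y) ≡ y * (4ℚ * m)
          lemma₄ = solve-∀ ring

      module _ {X Y : Subset n} (parts : HasParts G X Y) where

        open Part parts
        open Part (flip-parts parts) using () renaming (0<y to 0<x)

        Z : Subset n
        Z = end-part (suc k) X Y

        z c : ℚ
        z = card Z
        c = x + b

        xq²≤m : x * (q * q) ≤ moment (suc k) ⟦ X ⟧
        xq²≤m = *-cancelˡ (x ^ k) (0<^ k 0<x) (begin
          x ^ k * (x * (q * q))                ≡⟨ lemma₁ (x ^ k) x (q * q) ⟩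
          x ^ suc k * (q * q)                  ≡⟨ cong (x ^ suc k *_) (²-^ D (suc k)) ⟨
          x ^ suc k * (D * D) ^ suc k          ≡⟨ ^-distrib-* x (D * D) (suc k) ⟨
          (x * (D * D)) ^ suc k                ≤⟨ ^-monoˡ (suc k) (<⇒≤ 0<x *₀ 0≤² D) xD²≤m₁ ⟩
          moment 1 ⟦ X ⟧ ^ suc k               ≤⟨ moment-power k ⟦ X ⟧ ⟩
          moment (suc k) ⟦ X ⟧ * moment 0 ⟦ X ⟧ ^ k
            ≡⟨ cong (λ m → moment (suc k) ⟦ X ⟧ * m ^ k) (card-⟨⟩ X) ⟩
          moment (suc k) ⟦ X ⟧ * x ^ k         ≡⟨ *-comm (moment (suc k) ⟦ X ⟧) (x ^ k) ⟩
          x ^ k * moment (suc k) ⟦ X ⟧         ∎)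
          where
          open ≤-Reasoning
          lemma₁ : ∀ p x r → p * (x * r) ≡ x * p * r
          lemma₁ = solve-∀ ring

        -- The two bounds together say that |φ| is at most `⟦ X ⟧`; each one makes one of
        -- `⟦ X ⟧ - φ` and `⟦ X ⟧ + φ` nonnegative.
        record Balanced (φ : Fin n → ℚ) : Set where
          field
            upper    : ∀ v → φ v ≤ ⟦ X ⟧ v
            lower    : ∀ v → - φ v ≤ ⟦ X ⟧ v
            mean     : ∑ φ ≡ 0ℚ

        balanced-0 : Balanced (λ _ → 0ℚ)
        balanced-0 = record { upper = 0≤⟦⟧ X ; lower = 0≤⟦⟧ X ; mean = ∑-zero {n} λ _ → refl }

        module _ {φ : Fin n → ℚ} (balanced : Balanced φ) where

          open Balanced balanced

          balanced-vanishes : VanishesOff X φ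
          balanced-vanishes v v∉X = ≤-antisym (subst (φ v ≤_) ⟦X⟧≡0 (upper v))
            (≤-by (0ℚ - - φ v) (lemma (φ v)) (0≤- (subst (- φ v ≤_) ⟦X⟧≡0 (lower v))))
            where
            ⟦X⟧≡0 = 𝟙-no (v ∈? X) v∉X
            lemma : ∀ p → p - 0ℚ ≡ 0ℚ - - p
            lemma = solve-∀ ring

          -- Both 1 + φ and 1 - φ (on X) have sum x, so each reaches u by at most c walks.
          pointwise : ∀ u → A^ (suc k) φ u * A^ (suc k) φ u + A^ (suc k) ⟦ X ⟧ u * A^ (suc k) ⟦ X ⟧ u ≤ c * c
          pointwise u = *-cancelˡ 2ℚ (positive⁻¹ 2ℚ) (≤-by
            ((c - (s + t)) * (s + s + (c - (s - t))) + (c - (s - t)) * (s + s + (c - (s + t)))) (lemma c s t)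
            (0≤- s+t≤c *₀ (0≤s +₀ 0≤s +₀ 0≤- s-t≤c) +₀ 0≤- s-t≤c *₀ (0≤s +₀ 0≤s +₀ 0≤- s+t≤c)))
            where
            s = A^ (suc k) ⟦ X ⟧ u
            t = A^ (suc k) φ u
            lemma : ∀ c s t → 2ℚ * (c * c) - 2ℚ * (t * t + s * s)
              ≡ (c - (s + t)) * (s + s + (c - (s - t))) + (c - (s - t)) * (s + s + (c - (s + t)))
            lemma = solve-∀ ring
            0≤s : 0ℚ ≤ s
            0≤s = 0≤A^ (suc k) (0≤⟦⟧ X) u
            bound : ∀ ψ → (∀ v → ψ v ≤ ⟦ X ⟧ v) → (∀ v → - ψ v ≤ ⟦ X ⟧ v) → ∑ ψ ≡ 0ℚ →
                    s + A^ (suc k) ψ u ≤ c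
            bound ψ ψ≤ -ψ≤ ∑ψ≡0 = subst₂ _≤_ (A^-+ (suc k) ⟦ X ⟧ ψ u)
              (cong (_+ b) (trans (∑-+ ⟦ X ⟧ ψ) (trans (cong (λ ζ → x + ζ) ∑ψ≡0) (+-identityʳ x))))
              (walks≤ (λ v → ⟦ X ⟧ v + ψ v)
                (λ v → ≤-by (⟦ X ⟧ v - - ψ v) (l₁ (⟦ X ⟧ v) (ψ v)) (0≤- (-ψ≤ v)))
                (λ v → +-mono-≤ (𝟙≤1 (v ∈? X)) (≤-trans (ψ≤ v) (𝟙≤1 (v ∈? X)))) u)
              where
              l₁ : ∀ a p → a + p - 0ℚ ≡ a - - p
              l₁ = solve-∀ ring
            s+t≤c : s + t ≤ c
            s+t≤c = bound φ upper lower mean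
            s-t≤c : s - t ≤ c
            s-t≤c = subst (λ t′ → s + t′ ≤ c) (A^-neg (suc k) φ u)
              (bound (λ v → - φ v) lower (λ v → subst (_≤ ⟦ X ⟧ v) (l₂ (φ v)) (upper v))
                (trans (∑-neg φ) (cong -_ mean)))
              where
              l₂ : ∀ p → p ≡ - - p
              l₂ = solve-∀ ring

          norm≤x : ⟨ φ , φ ⟩ ≤ x
          norm≤x = subst (⟨ φ , φ ⟩ ≤_) (card-⟨⟩ X) (∑-mono λ v →
            ≤-by ((⟦ X ⟧ v - φ v) * (⟦ X ⟧ v - - φ v)) (lemma (φ v) (⟦ X ⟧ v))
              (0≤- (upper v) *₀ 0≤- (lower v)))
            where
            lemma : ∀ p a → a * a - p * p ≡ (a - p) * (a - - p)
            lemma = solve-∀ ring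

          -- `pointwise` is summed over `Z`, outside of which both functions vanish. The share of
          -- `z * (c * c)` that the indicator must take, by `xq²≤m`, is no longer available to `φ`.
          moment≤ : moment (suc k) φ + x * (q * q) ≤ z * (c * c)
          moment≤ = begin
            moment (suc k) φ + x * (q * q)                  ≤⟨ +-monoʳ-≤ (moment (suc k) φ) xq²≤m ⟩
            moment (suc k) φ + moment (suc k) ⟦ X ⟧
              ≡⟨ ∑-+ (λ u → A^ (suc k) φ u * A^ (suc k) φ u) (λ u → A^ (suc k) ⟦ X ⟧ u * A^ (suc k) ⟦ X ⟧ u) ⟨
            ∑ (λ u → A^ (suc k) φ u * A^ (suc k) φ u + A^ (suc k) ⟦ X ⟧ u * A^ (suc k) ⟦ X ⟧ u)
              ≤⟨ ∑-mono on-Z ⟩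
            ∑ (λ u → ⟦ Z ⟧ u * (c * c))                     ≡⟨ ∑-*ʳ (c * c) ⟦ Z ⟧ ⟩
            z * (c * c)                                     ∎
            where
            open ≤-Reasoning
            on-Z : ∀ u → A^ (suc k) φ u * A^ (suc k) φ u + A^ (suc k) ⟦ X ⟧ u * A^ (suc k) ⟦ X ⟧ u ≤ ⟦ Z ⟧ u * (c * c)
            on-Z u with u ∈? Z
            ... | yes _   = subst (_ ≤_) (sym (*-identityˡ (c * c))) (pointwise u)
            ... | no u∉Z  = ≤-reflexive (trans
              (cong₂ (λ t s → t * t + s * s)
                (vanishes-A^ parts balanced-vanishes (suc k) u u∉Z)
                (vanishes-A^ parts (λ v v∉X → 𝟙-no (v ∈? X) v∉X) (suc k) u u∉Z))
              (sym (*-zeroˡ (c * c))))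

        -- The case of the zero function, which already constrains the sizes of the parts.
        xq²≤zc² : x * (q * q) ≤ z * (c * c)
        xq²≤zc² = ≤-trans
          (≤-by (moment (suc k) (λ _ → 0ℚ)) (lemma (moment (suc k) (λ _ → 0ℚ)) (x * (q * q))) (0≤⟨⟩ (A^ (suc k) (λ _ → 0ℚ))))
          (moment≤ balanced-0)
          where
          lemma : ∀ m p → m + p - p ≡ m
          lemma = solve-∀ ring

      -- In `κ-small` the factor 8 is the constant of `N²≤8q²`, and `3ℚ * (τ + 2ℚ * β)` is the `κ`
      -- of `PartSizes`.
      module Mixing {τ β ε : ℚ} (0<ε : 0ℚ < ε) (0≤b : 0ℚ ≤ b) (b≤βN : b ≤ β * N)
        (0≤τ : 0ℚ ≤ τ) (4τ≤1 : 4ℚ * τ ≤ 1ℚ) (0≤β : 0ℚ ≤ β) (β≤1 : β ≤ 1ℚ)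
        (2q≥ : (1ℚ - τ) * N ≤ 2ℚ * q) (κ-small : 8ℚ * (3ℚ * (τ + 2ℚ * β)) ≤ (ε * ε) ^ suc k) where

        0≤q : 0ℚ ≤ q
        0≤q = 0≤^ (suc k) (<⇒≤ 0<D)

        0≤N : 0ℚ ≤ N
        0≤N = <⇒≤ 0<n

        τ≤1 : τ ≤ 1ℚ
        τ≤1 = ≤-by ((1ℚ - 4ℚ * τ) + 3ℚ * τ) (lemma τ) (0≤- 4τ≤1 +₀ nonNegative⁻¹ 3ℚ *₀ 0≤τ)
          where
          lemma : ∀ τ → 1ℚ - τ ≡ (1ℚ - 4ℚ * τ) + 3ℚ * τ
          lemma = solve-∀ ring

        0≤εND : 0ℚ ≤ ε * N * D
        0≤εND = <⇒≤ 0<ε *₀ 0≤N *₀ <⇒≤ 0<D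

        module Sizes {X Y : Subset n} (parts : HasParts G X Y) where

          open Part parts public
          open Part (flip-parts parts) public using () renaming (0<y to 0<x)
          open PartSizes {q = q} x+y≡N 0<x 0<y 0≤b b≤βN 0≤τ τ≤1 0≤β β≤1 0≤q 2q≥ public
            hiding (0≤N)

          q≤x+b : end-part (suc k) X Y ≡ X → q ≤ x + b
          q≤x+b Z≡X = ²-cancel (0≤x +₀ 0≤b) (*-cancelˡ x 0<x
            (subst (λ Z → x * (q * q) ≤ card Z * ((x + b) * (x + b))) Z≡X (xq²≤zc² parts)))

        -- The parity of the walk length tells whether `Z` is `X` or `Y`, hence which of the two
        -- estimates applies.
        defect≤ : ∀ {X Y} (parts : HasParts G X Y) → let x = card X in
          card (end-part (suc k) X Y) * ((x + b) * (x + b)) - x * (q * q) ≤ 3ℚ * (τ + 2ℚ * β) * (N * N * N)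
        defect≤ {X} {Y} parts with end-part-cases (suc k) X Y
        ... | inj₁ (Z≡X , Z′≡Y) = subst
          (λ Z → card Z * ((card X + b) * (card X + b)) - card X * (q * q) ≤ 3ℚ * (τ + 2ℚ * β) * (N * N * N)) (sym Z≡X)
          (Sizes.defect-within parts (Sizes.q≤x+b parts Z≡X) (Sizes.q≤x+b (flip-parts parts) Z′≡Y))
        ... | inj₂ (Z≡Y , _) = subst
          (λ Z → card Z * ((card X + b) * (card X + b)) - card X * (q * q) ≤ 3ℚ * (τ + 2ℚ * β) * (N * N * N)) (sym Z≡Y)
          (Sizes.defect-across parts)

        q²≤ : ∀ {X Y} (parts : HasParts G X Y) → q * q ≤ (card X + b) * (card Y + b)
        q²≤ {X} {Y} parts with end-part-cases (suc k) X Y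
        ... | inj₁ (Z≡X , Z′≡Y) = *-mono 0≤q (Sizes.q≤x+b parts Z≡X) 0≤q (Sizes.q≤x+b (flip-parts parts) Z′≡Y)
        ... | inj₂ (Z≡Y , Z′≡X) = Sizes.product-across parts
          (subst (λ Z → card X * (q * q) ≤ card Z * ((card X + b) * (card X + b))) Z≡Y (xq²≤zc² parts))
          (subst (λ Z → card Y * (q * q) ≤ card Z * ((card Y + b) * (card Y + b))) Z′≡X (xq²≤zc² (flip-parts parts)))

        -- As `τ` is at most 1/4, `2q` is at least `3N/4`, which would even allow the constant 64/9.
        N²≤8q² : N * N ≤ 8ℚ * (q * q)
        N²≤8q² = ≤-by
          (2ℚ * (2ℚ * q * (2ℚ * q) - (1ℚ - τ) * N * ((1ℚ - τ) * N)) + (1ℚ - 4ℚ * τ) * (N * N) + 2ℚ * (τ * τ) * (N * N))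
          (lemma N q τ)
          (nonNegative⁻¹ 2ℚ *₀ 0≤- (*-mono 0≤⟨1-τ⟩N 2q≥ 0≤⟨1-τ⟩N 2q≥) +₀ 0≤- 4τ≤1 *₀ 0≤² N
            +₀ nonNegative⁻¹ 2ℚ *₀ 0≤² τ *₀ 0≤² N)
          where
          0≤⟨1-τ⟩N = 0≤- τ≤1 *₀ 0≤N
          lemma : ∀ N q τ → 8ℚ * (q * q) - N * N ≡
            2ℚ * (2ℚ * q * (2ℚ * q) - (1ℚ - τ) * N * ((1ℚ - τ) * N)) + (1ℚ - 4ℚ * τ) * (N * N) + 2ℚ * (τ * τ) * (N * N)
          lemma = solve-∀ ring

        module _ {X Y : Subset n} (parts : HasParts G X Y) {φ : Fin n → ℚ} (balanced : Balanced parts φ) where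

          -- The powers with exponent `suc k` are compared. `moment-power` and the defect bound
          -- leave `κ N³ N^k`; trading two factors `N` for `8 q²` produces the power of `D` wanted
          -- on the right.
          norm-A≤ : moment 1 φ ≤ ε * ε * N * (D * D)
          norm-A≤ = ^-cancelˡ k (0≤² ε *₀ 0≤N *₀ 0≤² D) (begin
            moment 1 φ ^ suc k                          ≤⟨ moment-power k φ ⟩
            moment (suc k) φ * ⟨ φ , φ ⟩ ^ k            ≤⟨ *-mono (0≤⟨⟩ (A^ (suc k) φ)) m≤ (0≤^ k (0≤⟨⟩ φ))
                                                             (^-monoˡ k (0≤⟨⟩ φ) (≤-trans (norm≤x parts balanced) (card≤n X))) ⟩
            3ℚ * (τ + 2ℚ * β) * (N * N * N) * N ^ k     ≡⟨ lemma₁ (3ℚ * (τ + 2ℚ * β)) N (N ^ k) ⟩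
            κ * (N * N ^ k) * (N * N)
              ≤⟨ *-monoˡ (κ * N ^ suc k) (0≤κ *₀ 0≤^ (suc k) 0≤N) N²≤8q² ⟩
            κ * N ^ suc k * (8ℚ * (q * q))              ≡⟨ lemma₂ κ (N ^ suc k) (q * q) ⟩
            8ℚ * κ * (N ^ suc k * (q * q))
              ≤⟨ *-monoʳ (N ^ suc k * (q * q)) (0≤^ (suc k) 0≤N *₀ 0≤² q) κ-small ⟩
            (ε * ε) ^ suc k * (N ^ suc k * (q * q))     ≡⟨ *-assoc ((ε * ε) ^ suc k) (N ^ suc k) (q * q) ⟨
            (ε * ε) ^ suc k * N ^ suc k * (q * q)
              ≡⟨ cong₂ _*_ (^-distrib-* (ε * ε) N (suc k)) (²-^ D (suc k)) ⟨
            (ε * ε * N) ^ suc k * (D * D) ^ suc k       ≡⟨ ^-distrib-* (ε * ε * N) (D * D) (suc k) ⟨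
            (ε * ε * N * (D * D)) ^ suc k               ∎)
            where
            open ≤-Reasoning
            κ = 3ℚ * (τ + 2ℚ * β)
            0≤κ = nonNegative⁻¹ 3ℚ *₀ (0≤τ +₀ nonNegative⁻¹ 2ℚ *₀ 0≤β)
            m≤ : moment (suc k) φ ≤ κ * (N * N * N)
            m≤ = ≤-trans (≤-by (zc² - (moment (suc k) φ + card X * (q * q)))
                (l (moment (suc k) φ) zc² (card X * (q * q))) (0≤- (moment≤ parts balanced)))
              (defect≤ parts)
              where
              zc² = z parts * (c parts * c parts)
              l : ∀ m p r → p - r - m ≡ p - (m + r)
              l = solve-∀ ring
            lemma₁ : ∀ κ N M → κ * (N * N * N) * M ≡ κ * (N * M) * (N * N)
            lemma₁ = solve-∀ ring
            lemma₂ : ∀ κ M r → κ * M * (8ℚ * r) ≡ 8ℚ * κ * (M * r)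
            lemma₂ = solve-∀ ring

          square≤ : ∀ T → ⟨ ⟦ T ⟧ , A φ ⟩ * ⟨ ⟦ T ⟧ , A φ ⟩ ≤ ε * N * D * (ε * N * D)
          square≤ T = begin
            ⟨ ⟦ T ⟧ , A φ ⟩ * ⟨ ⟦ T ⟧ , A φ ⟩   ≤⟨ cauchy-schwarz ⟦ T ⟧ (A φ) ⟩
            ⟨ ⟦ T ⟧ , ⟦ T ⟧ ⟩ * moment 1 φ
              ≤⟨ *-mono (0≤⟨⟩ ⟦ T ⟧) (subst (_≤ N) (sym (card-⟨⟩ T)) (card≤n T))
                                                     (0≤⟨⟩ (A φ)) norm-A≤ ⟩
            N * (ε * ε * N * (D * D))           ≡⟨ lemma N ε D ⟩
            ε * N * D * (ε * N * D)             ∎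
            where
            open ≤-Reasoning
            lemma : ∀ N ε D → N * (ε * ε * N * (D * D)) ≡ ε * N * D * (ε * N * D)
            lemma = solve-∀ ring

          discrepancy≤ : ∀ T → ⟨ ⟦ T ⟧ , A φ ⟩ ≤ ε * N * D
          discrepancy≤ T = ²-cancel 0≤εND (square≤ T)

          -discrepancy≤ : ∀ T → - ⟨ ⟦ T ⟧ , A φ ⟩ ≤ ε * N * D
          -discrepancy≤ T = ²-cancel 0≤εND (subst (_≤ ε * N * D * (ε * N * D)) (lemma ⟨ ⟦ T ⟧ , A φ ⟩) (square≤ T))
            where
            lemma : ∀ p → p * p ≡ - p * - p
            lemma = solve-∀ ring

        -- `S` receives nearly the fraction `σ` of the edges between `X` and any `T`. The two signs
        -- are kept apart, so that each bound can be scaled by a nonnegative factor and added to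
        -- others.
        record Share {X Y} (parts : HasParts G X Y) (S : Subset n) : Set where
          field
            σ    : ℚ
            0≤σ  : 0ℚ ≤ σ
            σ≤1  : σ ≤ 1ℚ
            σx≡S : σ * card X ≡ card S
            excess  : ∀ T → edges T S - σ * edges T X ≤ ε * N * D
            deficit : ∀ T → - (edges T S - σ * edges T X) ≤ ε * N * D

        share : ∀ {X Y S} (parts : HasParts G X Y) → S ⊆ X → Share parts S
        share {X} {Y} {S} parts S⊆X with inverse (Part.0<y (flip-parts parts))
        ... | r , 0<r , rx≡1 = record
          { σ = σ ; 0≤σ = 0≤σ ; σ≤1 = σ≤1 ; σx≡S = σx≡S
          ; excess  = λ T → subst (_≤ ε * N * D) (expand T) (discrepancy≤ parts balanced T)
          ; deficit = λ T → subst (_≤ ε * N * D) (cong -_ (expand T)) (-discrepancy≤ parts balanced T)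
          }
          where
          σ : ℚ
          σ = card S * r
          0≤σ : 0ℚ ≤ σ
          0≤σ = 0≤card S *₀ <⇒≤ 0<r
          σ≤1 : σ ≤ 1ℚ
          σ≤1 = subst (σ ≤_) (trans (*-comm (card X) r) rx≡1) (*-monoʳ r (<⇒≤ 0<r) (∑-mono (⟦⟧-mono S⊆X)))
          σx≡S : σ * card X ≡ card S
          σx≡S = trans (*-assoc (card S) r (card X)) (trans (cong (card S *_) rx≡1) (*-identityʳ (card S)))
          φ : Fin n → ℚ
          φ v = ⟦ S ⟧ v + - (σ * ⟦ X ⟧ v)
          balanced : Balanced parts φ
          balanced = record
            { upper = λ v → ≤-by ((⟦ X ⟧ v - ⟦ S ⟧ v) + σ * ⟦ X ⟧ v) (l₁ (⟦ S ⟧ v) (⟦ X ⟧ v) σ)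
                (0≤- (⟦⟧-mono S⊆X v) +₀ 0≤σ *₀ 0≤⟦⟧ X v)
            ; lower = λ v → ≤-by ((1ℚ - σ) * ⟦ X ⟧ v + ⟦ S ⟧ v) (l₂ (⟦ S ⟧ v) (⟦ X ⟧ v) σ)
                (0≤- σ≤1 *₀ 0≤⟦⟧ X v +₀ 0≤⟦⟧ S v)
            ; mean  = trans (∑-- ⟦ S ⟧ (λ v → σ * ⟦ X ⟧ v))
                (trans (cong (_-_ (card S)) (trans (∑-*ˡ σ ⟦ X ⟧) σx≡S)) (+-inverseʳ (card S)))
            }
            where
            l₁ : ∀ s a σ → a - (s + - (σ * a)) ≡ (a - s) + σ * a
            l₁ = solve-∀ ring
            l₂ : ∀ s a σ → a - - (s + - (σ * a)) ≡ (1ℚ - σ) * a + s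
            l₂ = solve-∀ ring
          A-φ : ∀ u → A φ u ≡ A ⟦ S ⟧ u - σ * A ⟦ X ⟧ u
          A-φ u = trans (A-+ ⟦ S ⟧ (λ v → - (σ * ⟦ X ⟧ v)) u)
            (cong (λ ζ → A ⟦ S ⟧ u + ζ) (trans (A-neg (λ v → σ * ⟦ X ⟧ v) u) (cong -_ (A-* σ ⟦ X ⟧ u))))
          expand : ∀ T → ⟨ ⟦ T ⟧ , A φ ⟩ ≡ edges T S - σ * edges T X
          expand T = trans
            (∑-cong λ u → trans (cong (⟦ T ⟧ u *_) (A-φ u)) (l (⟦ T ⟧ u) (A ⟦ S ⟧ u) σ (A ⟦ X ⟧ u)))
            (trans (∑-- (λ u → ⟦ T ⟧ u * A ⟦ S ⟧ u) (λ u → σ * (⟦ T ⟧ u * A ⟦ X ⟧ u)))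
              (cong (_-_ (edges T S)) (∑-*ˡ σ (λ u → ⟦ T ⟧ u * A ⟦ X ⟧ u))))
            where
            l : ∀ t a σ c → t * (a - σ * c) ≡ t * a - σ * (t * c)
            l = solve-∀ ring

        module _ {X Y : Subset n} (parts : HasParts G X Y) {i : ℚ} (iN≡2 : i * N ≡ 2ℚ) {S T : Subset n} (S⊆X : S ⊆ X) (T⊆Y : T ⊆ Y) where

          open Sizes parts
          open Share (share parts S⊆X)
          open Share (share (flip-parts parts) T⊆Y) using ()
            renaming (σ to ρ; 0≤σ to 0≤ρ; σ≤1 to ρ≤1; σx≡S to ρy≡T; excess to excess′; deficit to deficit′)

          -- As `i` is `2 / N`, this is `4xy / N²`, which is 1 exactly for parts of equal size.
          density : ℚ
          density = i * i * (x * y)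

          main : ℚ
          main = i * D * card S * card T

          iE≡D : i * E ≡ D
          iE≡D = begin
            i * E                 ≡⟨ l₁ i E ⟩
            ½ * (i * (2ℚ * E))    ≡⟨ cong (λ e → ½ * (i * e)) 2E≡ND ⟩
            ½ * (i * (N * D))     ≡⟨ l₂ i N D ⟩
            ½ * (i * N * D)       ≡⟨ cong (λ e → ½ * (e * D)) iN≡2 ⟩
            ½ * (2ℚ * D)          ≡⟨ l₃ D ⟩
            D                     ∎
            where
            open ≡-Reasoning
            l₁ : ∀ i E → i * E ≡ ½ * (i * (2ℚ * E))
            l₁ = solve-∀ ring
            l₂ : ∀ i N D → ½ * (i * (N * D)) ≡ ½ * (i * N * D)
            l₂ = solve-∀ ring
            l₃ : ∀ D → ½ * (2ℚ * D) ≡ D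
            l₃ = solve-∀ ring

          main≡ : main ≡ σ * ρ * E * density
          main≡ = begin
            i * D * card S * card T                    ≡⟨ cong₂ (λ s t → i * D * s * t) σx≡S ρy≡T ⟨
            i * D * (σ * x) * (ρ * y)                  ≡⟨ cong (λ d → i * d * (σ * x) * (ρ * y)) iE≡D ⟨
            i * (i * E) * (σ * x) * (ρ * y)            ≡⟨ l i E σ x ρ y ⟩
            σ * ρ * E * density                        ∎
            where
            open ≡-Reasoning
            l : ∀ i E σ x ρ y → i * (i * E) * (σ * x) * (ρ * y) ≡ σ * ρ * E * (i * i * (x * y))
            l = solve-∀ ring

          i²N²≡4 : i * i * (N * N) ≡ 4ℚ
          i²N²≡4 = trans (l i N) (cong (λ p → p * p) iN≡2)
            where
            l : ∀ i N → i * i * (N * N) ≡ i * N * (i * N)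
            l = solve-∀ ring

          density≤1 : density ≤ 1ℚ
          density≤1 = *-cancelˡ 4ℚ (positive⁻¹ 4ℚ) (subst₂ _≤_ (l i (x * y)) i²N²≡4
            (*-monoˡ (i * i) (0≤² i) (am-gm {x} {y} x+y≡N)))
            where
            l : ∀ i p → i * i * (4ℚ * p) ≡ 4ℚ * (i * i * p)
            l = solve-∀ ring

          density≥ : 1ℚ - 2ℚ * τ - 8ℚ * β ≤ density
          density≥ = *-cancelˡ 4ℚ (positive⁻¹ 4ℚ) (subst₂ _≤_
            (trans (l₁ i N τ β) (cong (λ p → p * (1ℚ - 2ℚ * τ - 8ℚ * β)) i²N²≡4)) (l₂ i (x * y))
            (*-monoˡ (i * i) (0≤² i) (parts-balanced (q²≤ parts))))
            where
            l₁ : ∀ i N τ β → i * i * ((1ℚ - 2ℚ * τ - 8ℚ * β) * (N * N)) ≡ i * i * (N * N) * (1ℚ - 2ℚ * τ - 8ℚ * β)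
            l₁ = solve-∀ ring
            l₂ : ∀ i p → i * i * (4ℚ * p) ≡ 4ℚ * (i * i * p)
            l₂ = solve-∀ ring

          0≤E : 0ℚ ≤ E
          0≤E = <⇒≤ 0<E

          1-density : ℚ
          1-density = σ * ρ * E * (1ℚ - density)

          0≤1-density : 0ℚ ≤ 1-density
          0≤1-density = 0≤σ *₀ 0≤ρ *₀ 0≤E *₀ 0≤- density≤1

          1-density≤ : 1-density ≤ (τ + 4ℚ * β) * N * D
          1-density≤ = begin
            σ * ρ * E * (1ℚ - density)            ≤⟨ *-mono (0≤σ *₀ 0≤ρ *₀ 0≤E)
                                                       (*-mono (0≤σ *₀ 0≤ρ) (*-mono 0≤σ σ≤1 0≤ρ ρ≤1) 0≤E ≤-refl)
                                                       (0≤- density≤1) (≤-by (density - (1ℚ - 2ℚ * τ - 8ℚ * β)) (l₁ τ β density) (0≤- density≥)) ⟩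
            1ℚ * 1ℚ * E * (2ℚ * τ + 8ℚ * β)       ≡⟨ l₂ E τ β ⟩
            (τ + 4ℚ * β) * (2ℚ * E)               ≡⟨ cong ((τ + 4ℚ * β) *_) 2E≡ND ⟩
            (τ + 4ℚ * β) * (N * D)                ≡⟨ *-assoc (τ + 4ℚ * β) N D ⟨
            (τ + 4ℚ * β) * N * D                  ∎
            where
            open ≤-Reasoning
            l₁ : ∀ τ β w → 2ℚ * τ + 8ℚ * β - (1ℚ - w) ≡ w - (1ℚ - 2ℚ * τ - 8ℚ * β)
            l₁ = solve-∀ ring
            l₂ : ∀ E τ β → 1ℚ * 1ℚ * E * (2ℚ * τ + 8ℚ * β) ≡ (τ + 4ℚ * β) * (2ℚ * E)
            l₂ = solve-∀ ring

          δ₁ δ₂ : ℚ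
          δ₁ = edges T S - σ * edges T X
          δ₂ = edges X T - ρ * edges X Y

          σδ₂≤ : σ * δ₂ ≤ ε * N * D
          σδ₂≤ = ≤-trans (*-monoˡ σ 0≤σ (excess′ X)) (subst (σ * (ε * N * D) ≤_) (*-identityˡ (ε * N * D)) (*-monoʳ (ε * N * D) 0≤εND σ≤1))

          -σδ₂≤ : σ * - δ₂ ≤ ε * N * D
          -σδ₂≤ = ≤-trans (*-monoˡ σ 0≤σ (deficit′ X)) (subst (σ * (ε * N * D) ≤_) (*-identityˡ (ε * N * D)) (*-monoʳ (ε * N * D) 0≤εND σ≤1))

          -- `S` is exchanged for its share of `X`, then `T` for its share of `Y`. The last term is
          -- the error due to parts of unequal size.
          decompose : edges S T - main ≡ δ₁ + σ * δ₂ + 1-density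
          decompose = begin
            edges S T - main
              ≡⟨ cong₂ _-_ (edges-sym S T) main≡ ⟩
            edges T S - σ * ρ * E * density
              ≡⟨ l (edges T S) (edges T X) σ ρ E density ⟩
            (edges T S - σ * edges T X) + σ * (edges T X - ρ * E) + 1-density
              ≡⟨ cong (λ e → δ₁ + σ * (e - ρ * E) + 1-density) (edges-sym T X) ⟩
            δ₁ + σ * δ₂ + 1-density ∎
            where
            open ≡-Reasoning
            l : ∀ a c σ ρ E w → a - σ * ρ * E * w ≡ (a - σ * c) + σ * (c - ρ * E) + σ * ρ * E * (1ℚ - w)
            l = solve-∀ ring

          -- Each of the two exchanges costs `ε`. Unequal parts cost `2τ + 8β` times `E`, and `E` is
          -- half of `N * D`.
          mixing : ∣ edges S T - main ∣ ≤ (2ℚ * ε + τ + 4ℚ * β) * N * D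
          mixing = subst (λ p → ∣ p ∣ ≤ (2ℚ * ε + τ + 4ℚ * β) * N * D) (sym decompose)
            (∣ δ₁ + σ * δ₂ + 1-density ∣≤
              (≤-trans (+-mono-≤ (+-mono-≤ (excess T) σδ₂≤) 1-density≤) (≤-reflexive (l₁ ε N D τ β)))
              (≤-by ((ε * N * D - - δ₁) + (ε * N * D - σ * - δ₂) + 1-density + (τ + 4ℚ * β) * N * D)
                (l₂ ε N D τ β δ₁ σ δ₂ 1-density)
                (0≤- (deficit T) +₀ 0≤- -σδ₂≤ +₀ 0≤1-density
                  +₀ (0≤τ +₀ nonNegative⁻¹ 4ℚ *₀ 0≤β) *₀ 0≤N *₀ <⇒≤ 0<D)))
            where
            l₁ : ∀ ε N D τ β → ε * N * D + ε * N * D + (τ + 4ℚ * β) * N * D ≡ (2ℚ * ε + τ + 4ℚ * β) * N * D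
            l₁ = solve-∀ ring
            l₂ : ∀ ε N D τ β a σ c w → (2ℚ * ε + τ + 4ℚ * β) * N * D - - (a + σ * c + w) ≡
              (ε * N * D - - a) + (ε * N * D - σ * - c) + w + (τ + 4ℚ * β) * N * D
            l₂ = solve-∀ ring

-- Counts as rational sums, and the estimate for a single graph with explicit constants.

module Quantitative where

  open Rationals
  open FiniteSums
  open WalkCounts
  open Trimming
  open BipartiteMixing
  open import Data.Fin using (Fin; zero; suc)
  open import Data.Fin.Subset using (Subset; _⊆_) renaming (∣_∣ to ∣_∣ˢ)
  open import Data.Fin.Subset.Properties using (_∈?_; drop-there)
  open import Data.Bool using (true; false)
  open import Data.Integer as ℤ using (+_)
  import Data.Integer.Properties as ℤₚ
  open import Data.List as List
    using (List; []; _∷_; _++_; length; filter; allFin; tabulate; cartesianProduct)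
  open import Data.List.Properties using (length-++; filter-++; map-tabulate)
  open import Data.Nat as ℕ using (ℕ; zero; suc; NonZero)
  open import Data.Nat.ListAction using () renaming (sum to ℕ-sum)
  import Data.Nat.Properties as ℕₚ
  open import Data.Product using (_×_; _,_; proj₁; proj₂)
  open import Data.Rational hiding (NonZero)
  open import Data.Rational.Properties
  import Data.Rational.Unnormalised as ℚᵘ
  import Data.Rational.Unnormalised.Properties as ℚᵘₚ
  open import Data.Sum using (inj₁; inj₂)
  open import Data.Vec using ([]; _∷_; there)
  open import Function using (_∘_; id)
  open import Relation.Binary.PropositionalEquality
  open import Relation.Nullary using (Dec; yes; no)
  open import Relation.Nullary.Decidable using (_×-dec_)
  open import Relation.Unary using (Decidable)
  open import Tactic.RingSolver using (solve-∀)

  𝟙-× : ∀ {P Q : Set} (P? : Dec P) (Q? : Dec Q) → 𝟙 (P? ×-dec Q?) ≡ 𝟙 P? * 𝟙 Q?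
  𝟙-× (yes _) (yes _) = refl
  𝟙-× (yes _) (no _)  = refl
  𝟙-× (no _)  (yes _) = refl
  𝟙-× (no _)  (no _)  = refl

  fromℕ-length-filter : ∀ {n} {A : Set} {P : A → Set} (P? : Decidable P) (f : Fin n → A) →
                        fromℕ (length (filter P? (tabulate f))) ≡ ∑ (λ i → 𝟙 (P? (f i)))
  fromℕ-length-filter {zero}  P? f = refl
  fromℕ-length-filter {suc n} P? f with P? (f zero)
  ... | yes _ = trans (fromℕ-suc (length (filter P? (tabulate (f ∘ suc))))) (cong (λ ζ → 1ℚ + ζ) (fromℕ-length-filter P? (f ∘ suc)))
  ... | no _  = trans (fromℕ-length-filter P? (f ∘ suc)) (sym (+-identityˡ _))

  fromℕ-length-filter-× : ∀ {m n} {A B : Set} {P : A × B → Set} (P? : Decidable P) (f : Fin m → A) (g : Fin n → B) →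
    fromℕ (length (filter P? (cartesianProduct (tabulate f) (tabulate g)))) ≡ ∑ (λ i → ∑ λ j → 𝟙 (P? (f i , g j)))
  fromℕ-length-filter-× {zero}  P? f g = refl
  fromℕ-length-filter-× {suc m} P? f g = begin
    fromℕ (length (filter P? (row ++ rest)))
      ≡⟨ cong (fromℕ ∘ length) (filter-++ P? row rest) ⟩
    fromℕ (length (filter P? row ++ filter P? rest))
      ≡⟨ cong fromℕ (length-++ (filter P? row)) ⟩
    fromℕ (length (filter P? row) ℕ.+ length (filter P? rest))
      ≡⟨ fromℕ-+ (length (filter P? row)) (length (filter P? rest)) ⟩
    fromℕ (length (filter P? row)) + fromℕ (length (filter P? rest))
      ≡⟨ cong₂ _+_
           (trans (cong (fromℕ ∘ length ∘ filter P?) (map-tabulate g (f zero ,_))) (fromℕ-length-filter P? (λ j → f zero , g j)))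
           (fromℕ-length-filter-× P? (f ∘ suc) g) ⟩
    ∑ (λ j → 𝟙 (P? (f zero , g j))) + ∑ (λ i → ∑ λ j → 𝟙 (P? (f (suc i) , g j))) ∎
    where
    open ≡-Reasoning
    row  = List.map (f zero ,_) (tabulate g)
    rest = cartesianProduct (tabulate (f ∘ suc)) (tabulate g)

  fromℕ-sum : ∀ {n} {A : Set} (h : A → ℕ) (f : Fin n → A) → fromℕ (ℕ-sum (List.map h (tabulate f))) ≡ ∑ (fromℕ ∘ h ∘ f)
  fromℕ-sum {zero}  h f = refl
  fromℕ-sum {suc n} h f = trans (fromℕ-+ (h (f zero)) (ℕ-sum (List.map h (tabulate (f ∘ suc)))))
    (cong (λ ζ → fromℕ (h (f zero)) + ζ) (fromℕ-sum h (f ∘ suc)))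

  fromℕ-∣∣ : ∀ {n} (S : Subset n) → fromℕ ∣ S ∣ˢ ≡ card S
  fromℕ-∣∣ []          = refl
  fromℕ-∣∣ (true ∷ S)  = trans (fromℕ-suc ∣ S ∣ˢ) (cong (λ ζ → 1ℚ + ζ) (trans (fromℕ-∣∣ S)
    (∑-cong λ v → 𝟙-cong (v ∈? S) (suc v ∈? true ∷ S) there drop-there)))
  fromℕ-∣∣ (false ∷ S) = trans (fromℕ-∣∣ S) (trans
    (∑-cong λ v → 𝟙-cong (v ∈? S) (suc v ∈? false ∷ S) there drop-there) (sym (+-identityˡ _)))

  /-*-cancel : ∀ a m .{{_ : NonZero m}} → (+ a / m) * fromℕ m ≡ fromℕ a
  /-*-cancel a (suc m) = toℚᵘ-injective (begin
    toℚᵘ ((+ a / suc m) * fromℕ (suc m))              ≈⟨ toℚᵘ-homo-* (+ a / suc m) (fromℕ (suc m)) ⟩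
    toℚᵘ (+ a / suc m) ℚᵘ.* toℚᵘ (fromℕ (suc m))      ≈⟨ ℚᵘₚ.*-cong (toℚᵘ-fromℚᵘ (ℚᵘ.mkℚᵘ (+ a) m)) (toℚᵘ-fromℕ (suc m)) ⟩
    ℚᵘ.mkℚᵘ (+ a) m ℚᵘ.* ℚᵘ.mkℚᵘ (+ suc m) 0          ≈⟨ ℚᵘ.*≡* (trans (ℤₚ.*-identityʳ _) (cong (+ a ℤ.*_) (cong +_ (sym (ℕₚ.*-identityʳ (suc m)))))) ⟩
    ℚᵘ.mkℚᵘ (+ a) 0                                   ≈⟨ toℚᵘ-fromℕ a ⟨
    toℚᵘ (fromℕ a)                                    ∎)
    where open ℚᵘₚ.≃-Reasoning

  module _ {n : ℕ} (G : Graph n) where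

    open Graph G
    open Adjacency G

    fromℕ-degree : ∀ v → fromℕ (degree G v) ≡ deg v
    fromℕ-degree v = fromℕ-length-filter (v ~?_) id

    total≡ : .{{_ : NonZero n}} → total G ≡ fromℕ n * avgDegree G
    total≡ = sym (trans (*-comm (fromℕ n) (avgDegree G))
      (trans (/-*-cancel (ℕ-sum (List.map (degree G) (allFin n))) n)
        (trans (fromℕ-sum (degree G) id) (∑-cong fromℕ-degree))))

    fromℕ-e : ∀ S T → fromℕ (e G S T) ≡ edges G S T
    fromℕ-e S T = trans (fromℕ-length-filter-× (λ (s , t) → (s ∈? S) ×-dec (t ∈? T) ×-dec (s ~? t)) id id)
      (∑-cong λ s → trans (∑-cong (term s)) (∑-*ˡ (⟦ S ⟧ s) (λ t → adj s t * ⟦ T ⟧ t)))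
      where
      l : ∀ a b c → a * (b * c) ≡ a * (c * b)
      l = solve-∀ ring
      term : ∀ s t → 𝟙 ((s ∈? S) ×-dec (t ∈? T) ×-dec (s ~? t)) ≡ ⟦ S ⟧ s * (adj s t * ⟦ T ⟧ t)
      term s t = trans (𝟙-× (s ∈? S) ((t ∈? T) ×-dec (s ~? t)))
        (trans (cong (⟦ S ⟧ s *_) (𝟙-× (t ∈? T) (s ~? t))) (l (⟦ S ⟧ s) (⟦ T ⟧ t) (adj s t)))

  edges-⊆ᴳ : ∀ {n} {H G : Graph n} → H ⊆ᴳ G → ∀ S T → edges H S T ≤ edges G S T
  edges-⊆ᴳ {H = H} {G} H⊆G S T = ∑-mono λ s → *-monoˡ (⟦ S ⟧ s) (0≤⟦⟧ S s)
    (∑-mono λ t → *-monoʳ (⟦ T ⟧ t) (0≤⟦⟧ T t) (⊆ᴳ-adj {H = H} {G} H⊆G s t))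

  edges-loss : ∀ {n} {H G : Graph n} → H ⊆ᴳ G → ∀ S T → edges G S T - edges H S T ≤ total G - total H
  edges-loss {n} {H} {G} H⊆G S T = subst₂ _≤_ lhs rhs (∑-mono λ s → ∑-mono λ t → term s t)
    where
    aG = Adjacency.adj G
    aH = Adjacency.adj H
    term : ∀ s t → ⟦ S ⟧ s * (aG s t * ⟦ T ⟧ t) - ⟦ S ⟧ s * (aH s t * ⟦ T ⟧ t) ≤ aG s t - aH s t
    term s t = begin
      ⟦ S ⟧ s * (aG s t * ⟦ T ⟧ t) - ⟦ S ⟧ s * (aH s t * ⟦ T ⟧ t)
        ≡⟨ l (⟦ S ⟧ s) (aG s t) (aH s t) (⟦ T ⟧ t) ⟩
      ⟦ S ⟧ s * ⟦ T ⟧ t * (aG s t - aH s t)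
        ≤⟨ *-monoʳ (aG s t - aH s t) (0≤- (⊆ᴳ-adj {H = H} {G} H⊆G s t))
                                                                       (*-mono (0≤⟦⟧ S s) (𝟙≤1 (s ∈? S)) (0≤⟦⟧ T t) (𝟙≤1 (t ∈? T))) ⟩
      1ℚ * 1ℚ * (aG s t - aH s t)                                   ≡⟨ *-identityˡ (aG s t - aH s t) ⟩
      aG s t - aH s t                                               ∎
      where
      open ≤-Reasoning
      l : ∀ s g h t → s * (g * t) - s * (h * t) ≡ s * t * (g - h)
      l = solve-∀ ring
    ∑∑-- : (f g : Fin n → Fin n → ℚ) → ∑ (λ s → ∑ λ t → f s t - g s t) ≡ ∑ (λ s → ∑ (f s)) - ∑ (λ s → ∑ (g s))
    ∑∑-- f g = trans (∑-cong λ s → ∑-- (f s) (g s)) (∑-- (λ s → ∑ (f s)) (λ s → ∑ (g s)))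
    lhs = trans (∑∑-- (λ s t → ⟦ S ⟧ s * (aG s t * ⟦ T ⟧ t)) (λ s t → ⟦ S ⟧ s * (aH s t * ⟦ T ⟧ t)))
      (cong₂ _-_ (∑-cong λ s → ∑-*ˡ (⟦ S ⟧ s) (λ t → aG s t * ⟦ T ⟧ t)) (∑-cong λ s → ∑-*ˡ (⟦ S ⟧ s) (λ t → aH s t * ⟦ T ⟧ t)))
    rhs = ∑∑-- aG aH

  p≤∣p∣ : ∀ p → p ≤ ∣ p ∣
  p≤∣p∣ p with ≤-total 0ℚ p
  ... | inj₁ 0≤p = ≤-reflexive (sym (0≤p⇒∣p∣≡p 0≤p))
  ... | inj₂ p≤0 = ≤-trans p≤0 (0≤∣p∣ p)

  -p≤∣p∣ : ∀ p → - p ≤ ∣ p ∣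
  -p≤∣p∣ p = subst (- p ≤_) (∣-p∣≡∣p∣ p) (p≤∣p∣ (- p))

  0<fromℕ : ∀ n .{{_ : NonZero n}} → 0ℚ < fromℕ n
  0<fromℕ (suc n) = subst (0ℚ <_) (sym (fromℕ-suc n)) (<-≤-trans 0<1
    (≤-by (fromℕ n) (l (fromℕ n)) (0≤fromℕ n)))
    where
    l : ∀ m → 1ℚ + m - 1ℚ ≡ m
    l = solve-∀ ring

  -- The graph is trimmed at degree η d, which leaves maximum degree at most 4 gᵏ d.
  module Constants (k : ℕ) {ε ρ η g : ℚ} (0<ε : 0ℚ < ε) (0<ρ : 0ℚ < ρ) (4ρ≤1 : 4ℚ * ρ ≤ 1ℚ) (0<η : 0ℚ < η)
    (3ℓη≡ρ : fromℕ (suc k) * (3ℚ * η) ≡ ρ) (ρ-small : 8ℚ * (3ℚ * (ρ + 2ℚ * ρ)) ≤ (ε * ε) ^ suc k)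
    (0<g : 0ℚ < g) (gη≡2 : g * η ≡ 2ℚ) where

    ℓ : ℚ
    ℓ = fromℕ (suc k)

    1≤ℓ : 1ℚ ≤ ℓ
    1≤ℓ = subst (1ℚ ≤_) (sym (fromℕ-suc k)) (≤-by (fromℕ k) (l (fromℕ k)) (0≤fromℕ k))
      where
      l : ∀ m → 1ℚ + m - 1ℚ ≡ m
      l = solve-∀ ring

    0≤2 : 0ℚ ≤ 2ℚ
    0≤2 = nonNegative⁻¹ 2ℚ

    0≤4 : 0ℚ ≤ 4ℚ
    0≤4 = nonNegative⁻¹ 4ℚ

    0≤ρ : 0ℚ ≤ ρ
    0≤ρ = <⇒≤ 0<ρ

    ρ≤1 : ρ ≤ 1ℚ
    ρ≤1 = ≤-by ((1ℚ - 4ℚ * ρ) + 3ℚ * ρ) (l ρ) (0≤- 4ρ≤1 +₀ nonNegative⁻¹ 3ℚ *₀ 0≤ρ)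
      where
      l : ∀ ρ → 1ℚ - ρ ≡ (1ℚ - 4ℚ * ρ) + 3ℚ * ρ
      l = solve-∀ ring

    0≤η : 0ℚ ≤ η
    0≤η = <⇒≤ 0<η

    0≤3η : 0ℚ ≤ 3ℚ * η
    0≤3η = nonNegative⁻¹ 3ℚ *₀ 0≤η

    3η≤ρ : 3ℚ * η ≤ ρ
    3η≤ρ = subst₂ _≤_ (*-identityˡ (3ℚ * η)) 3ℓη≡ρ (*-monoʳ (3ℚ * η) 0≤3η 1≤ℓ)

    0≤1-3η : 0ℚ ≤ 1ℚ - 3ℚ * η
    0≤1-3η = 0≤- (≤-trans 3η≤ρ ρ≤1)

    0≤1-η : 0ℚ ≤ 1ℚ - η
    0≤1-η = subst (0ℚ ≤_) (l η) (0≤1-3η +₀ 0≤2 *₀ 0≤η)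
      where
      l : ∀ η → 1ℚ - 3ℚ * η + 2ℚ * η ≡ 1ℚ - η
      l = solve-∀ ring

    0<1-2η : 0ℚ < 1ℚ - 2ℚ * η
    0<1-2η = subst (0ℚ <_) (l η) (+-mono-≤-< 0≤1-3η 0<η)
      where
      l : ∀ η → 1ℚ - 3ℚ * η + η ≡ 1ℚ - 2ℚ * η
      l = solve-∀ ring

    ½≤[1-η]^ : 1ℚ ≤ 2ℚ * (1ℚ - η) ^ suc k
    ½≤[1-η]^ = ≤-trans
      (≤-by ((1ℚ - 4ℚ * ρ) + 2ℚ * ρ + 2ℚ * (ℓ * (2ℚ * η)))
        (trans (l₁ ℓ η) (cong (λ r → (1ℚ - 4ℚ * r) + 2ℚ * r + 2ℚ * (ℓ * (2ℚ * η))) 3ℓη≡ρ))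
        (0≤- 4ρ≤1 +₀ 0≤2 *₀ 0≤ρ +₀ 0≤2 *₀ (0≤fromℕ (suc k) *₀ (0≤2 *₀ 0≤η))))
      (*-monoˡ 2ℚ 0≤2 (bernoulli (suc k) 0≤η (≤-by (1ℚ - η) refl 0≤1-η)))
      where
      l₁ : ∀ ℓ η → 2ℚ * (1ℚ - ℓ * η) - 1ℚ ≡ (1ℚ - 4ℚ * (ℓ * (3ℚ * η))) + 2ℚ * (ℓ * (3ℚ * η)) + 2ℚ * (ℓ * (2ℚ * η))
      l₁ = solve-∀ ring

    -- Bernoulli bounds powers only from below, so it is applied to `1 - η`, and
    -- `(1 + η)(1 - η) ≤ 1` transfers the result.
    [1+η]^≤2 : (1ℚ + η) ^ suc k ≤ 2ℚ
    [1+η]^≤2 = begin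
      (1ℚ + η) ^ suc k                                    ≡⟨ *-identityʳ ((1ℚ + η) ^ suc k) ⟨
      (1ℚ + η) ^ suc k * 1ℚ
        ≤⟨ *-monoˡ ((1ℚ + η) ^ suc k) (0≤^ (suc k) (0≤1 +₀ 0≤η)) ½≤[1-η]^ ⟩
      (1ℚ + η) ^ suc k * (2ℚ * (1ℚ - η) ^ suc k)          ≡⟨ l₁ ((1ℚ + η) ^ suc k) ((1ℚ - η) ^ suc k) ⟩
      2ℚ * ((1ℚ + η) ^ suc k * (1ℚ - η) ^ suc k)
        ≡⟨ cong (2ℚ *_) (^-distrib-* (1ℚ + η) (1ℚ - η) (suc k)) ⟨
      2ℚ * ((1ℚ + η) * (1ℚ - η)) ^ suc k
        ≤⟨ *-monoˡ 2ℚ 0≤2 (^-monoˡ {q = 1ℚ} (suc k) ((0≤1 +₀ 0≤η) *₀ 0≤1-η)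
                                                               (≤-by (η * η) (l₂ η) (0≤² η))) ⟩
      2ℚ * 1ℚ ^ suc k                                     ≡⟨ cong (2ℚ *_) (1^ (suc k)) ⟩
      2ℚ * 1ℚ                                             ≡⟨ *-identityʳ 2ℚ ⟩
      2ℚ                                                  ∎
      where
      open ≤-Reasoning
      l₁ : ∀ p q → p * (2ℚ * q) ≡ 2ℚ * (p * q)
      l₁ = solve-∀ ring
      l₂ : ∀ η → 1ℚ - (1ℚ + η) * (1ℚ - η) ≡ η * η
      l₂ = solve-∀ ring

    N≤4d^ : ∀ {N d} → 0ℚ ≤ N → (1ℚ - η) ^ suc k * N ≤ 2ℚ * d ^ suc k → N ≤ 4ℚ * d ^ suc k
    N≤4d^ {N} {d} 0≤N lower = begin
      N                                ≡⟨ *-identityˡ N ⟨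
      1ℚ * N                           ≤⟨ *-monoʳ N 0≤N ½≤[1-η]^ ⟩
      2ℚ * (1ℚ - η) ^ suc k * N        ≡⟨ *-assoc 2ℚ ((1ℚ - η) ^ suc k) N ⟩
      2ℚ * ((1ℚ - η) ^ suc k * N)      ≤⟨ *-monoˡ 2ℚ 0≤2 lower ⟩
      2ℚ * (2ℚ * d ^ suc k)            ≡⟨ *-assoc 2ℚ 2ℚ (d ^ suc k) ⟨
      4ℚ * d ^ suc k                   ∎
      where open ≤-Reasoning

    C : ℚ
    C = 4ℚ * g ^ k

    0≤C : 0ℚ ≤ C
    0≤C = 0≤4 *₀ 0≤^ k (<⇒≤ 0<g)

    module Trimmed {n : ℕ} .{{_ : NonZero n}} (G : Graph n) {X Y : Subset n} (parts : HasParts G X Y)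
      (free : EvenCycleFree (suc k) G) {d : ℚ} (total≡Nd : total G ≡ fromℕ n * d) (0<d : 0ℚ < d)
      (lower : (1ℚ - η) ^ suc k * fromℕ n ≤ 2ℚ * d ^ suc k) (upper : d ^ suc k ≤ fromℕ n)
      (2≤ηd : 2ℚ ≤ η * d) (d-large : ℓ * C ^ k * 2ℚ ≤ ρ * d) where

      N θ : ℚ
      N = fromℕ n
      θ = η * d

      0<N : 0ℚ < N
      0<N = 0<fromℕ n

      0≤N : 0ℚ ≤ N
      0≤N = <⇒≤ 0<N

      0≤d : 0ℚ ≤ d
      0≤d = <⇒≤ 0<d

      0≤θ : 0ℚ ≤ θ
      0≤θ = 0≤η *₀ 0≤d

      H : Graph n
      H = proj₁ (trim 0≤θ G)

      H⊆G : H ⊆ᴳ G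
      H⊆G = proj₁ (proj₂ (trim 0≤θ G))

      H-minDegree : Adjacency.MinDegree H θ
      H-minDegree = proj₁ (proj₂ (proj₂ (trim 0≤θ G)))

      H-total : total G ≤ total H + N * (2ℚ * θ)
      H-total = proj₂ (proj₂ (proj₂ (trim 0≤θ G)))

      1/N : ℚ
      1/N = proj₁ (inverse 0<N)

      D : ℚ
      D = total H * 1/N

      total≡ND : total H ≡ N * D
      total≡ND = trans (sym (*-identityʳ (total H)))
        (trans (cong (total H *_) (sym (proj₂ (proj₂ (inverse 0<N))))) (l (total H) 1/N N))
        where
        l : ∀ t r N → t * (r * N) ≡ N * (t * r)
        l = solve-∀ ring

      D≥ : (1ℚ - 2ℚ * η) * d ≤ D
      D≥ = *-cancelˡ N 0<N (≤-by (total H + N * (2ℚ * θ) - total G)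
        (sym (trans (cong₂ (λ h g → h + N * (2ℚ * θ) - g) total≡ND total≡Nd) (l N D η d))) (0≤- H-total))
        where
        l : ∀ N D η d → N * D + N * (2ℚ * (η * d)) - N * d ≡ N * D - N * ((1ℚ - 2ℚ * η) * d)
        l = solve-∀ ring

      D≤d : D ≤ d
      D≤d = *-cancelˡ N 0<N (subst₂ _≤_ total≡ND total≡Nd
        (∑-mono λ u → ∑-mono λ v → ⊆ᴳ-adj {H = H} {G} H⊆G u v))

      0<D : 0ℚ < D
      0<D = <-≤-trans (0<* 0<1-2η 0<d) D≥

      -- The hypothesis on `d` costs a factor `1 - η` and trimming a factor `1 - 2η`, together at
      -- least `1 - 3η`. Bernoulli bounds the ℓ-th power below by `1 - 3ℓη`, whence the choice
      -- `3ℓη = ρ`.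
      2q≥ : (1ℚ - ρ) * N ≤ 2ℚ * D ^ suc k
      2q≥ = begin
        (1ℚ - ρ) * N                                              ≡⟨ cong (λ r → (1ℚ - r) * N) 3ℓη≡ρ ⟨
        (1ℚ - ℓ * (3ℚ * η)) * N
          ≤⟨ *-monoʳ N 0≤N (bernoulli (suc k) 0≤3η (≤-trans 3η≤ρ ρ≤1)) ⟩
        (1ℚ - 3ℚ * η) ^ suc k * N
          ≤⟨ *-monoʳ N 0≤N (^-monoˡ {q = (1ℚ - 2ℚ * η) * (1ℚ - η)} (suc k) 0≤1-3η
                                                                       (≤-by (2ℚ * (η * η)) (l₁ η) (0≤2 *₀ 0≤² η))) ⟩
        ((1ℚ - 2ℚ * η) * (1ℚ - η)) ^ suc k * N
          ≡⟨ cong (_* N) (^-distrib-* (1ℚ - 2ℚ * η) (1ℚ - η) (suc k)) ⟩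
        (1ℚ - 2ℚ * η) ^ suc k * (1ℚ - η) ^ suc k * N
          ≡⟨ *-assoc ((1ℚ - 2ℚ * η) ^ suc k) ((1ℚ - η) ^ suc k) N ⟩
        (1ℚ - 2ℚ * η) ^ suc k * ((1ℚ - η) ^ suc k * N)
          ≤⟨ *-monoˡ ((1ℚ - 2ℚ * η) ^ suc k) (0≤^ (suc k) (<⇒≤ 0<1-2η)) lower ⟩
        (1ℚ - 2ℚ * η) ^ suc k * (2ℚ * d ^ suc k)
          ≡⟨ l₂ ((1ℚ - 2ℚ * η) ^ suc k) (d ^ suc k) ⟩
        2ℚ * ((1ℚ - 2ℚ * η) ^ suc k * d ^ suc k)
          ≡⟨ cong (2ℚ *_) (^-distrib-* (1ℚ - 2ℚ * η) d (suc k)) ⟨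
        2ℚ * ((1ℚ - 2ℚ * η) * d) ^ suc k
          ≤⟨ *-monoˡ 2ℚ 0≤2 (^-monoˡ (suc k) (<⇒≤ 0<1-2η *₀ 0≤d) D≥) ⟩
        2ℚ * D ^ suc k                                            ∎
        where
        open ≤-Reasoning
        l₁ : ∀ η → (1ℚ - 2ℚ * η) * (1ℚ - η) - (1ℚ - 3ℚ * η) ≡ 2ℚ * (η * η)
        l₁ = solve-∀ ring
        l₂ : ∀ p q → p * (2ℚ * q) ≡ 2ℚ * (p * q)
        l₂ = solve-∀ ring

      Δ : ℚ
      Δ = C * d

      0≤Δ : 0ℚ ≤ Δ
      0≤Δ = 0≤C *₀ 0≤d

      -- Lies below `θ - 1` because `θ ≥ 2`, and is exactly `d / g`, so that its powers compare with
      -- those of `d`.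
      a : ℚ
      a = ½ * θ

      0<a : 0ℚ < a
      0<a = 0<* (positive⁻¹ ½) (0<* 0<η 0<d)

      d≡ga : d ≡ g * a
      d≡ga = trans (l₁ d) (trans (cong (λ t → ½ * (t * d)) (sym gη≡2)) (l₂ g η d))
        where
        l₁ : ∀ d → d ≡ ½ * (2ℚ * d)
        l₁ = solve-∀ ring
        l₂ : ∀ g η d → ½ * (g * η * d) ≡ g * (½ * (η * d))
        l₂ = solve-∀ ring

      a≤θ-1 : a ≤ θ - 1ℚ
      a≤θ-1 = ≤-by (½ * (θ - 2ℚ)) (l θ) (nonNegative⁻¹ ½ *₀ 0≤- 2≤ηd)
        where
        l : ∀ t → t - 1ℚ - ½ * t ≡ ½ * (t - 2ℚ)
        l = solve-∀ ring

      1≤θ : 1ℚ ≤ θ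
      1≤θ = ≤-trans (≤-by 1ℚ refl 0≤1) 2≤ηd

      H-parts : HasParts H X Y
      H-parts = ⊆ᴳ-parts {H = H} {G} H⊆G parts

      H-free : EvenCycleFree (suc k) H
      H-free = ⊆ᴳ-free {H = H} {G} {suc k} H⊆G free

      open Adjacency H using (deg; 0≤deg; A^; walks≤∑; deg*-≤n)

      -- `deg*-≤n` gives `deg u * a ^ k ≤ N ≤ 4 d ^ ℓ`, and with `d = g * a` the factor `a ^ k`
      -- cancels.
      deg≤Δ : ∀ u → deg u ≤ Δ
      deg≤Δ u = *-cancelˡ (a ^ k) (0<^ k 0<a) (begin
        a ^ k * deg u               ≡⟨ *-comm (a ^ k) (deg u) ⟩
        deg u * a ^ k               ≤⟨ *-monoˡ (deg u) (0≤deg u) (^-monoˡ k (<⇒≤ 0<a) a≤θ-1) ⟩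
        deg u * (θ - 1ℚ) ^ k        ≤⟨ deg*-≤n H-parts {suc k} H-free 1≤θ H-minDegree refl u ⟩
        N                           ≤⟨ N≤4d^ {N} {d} 0≤N lower ⟩
        4ℚ * (d * d ^ k)            ≡⟨ cong (λ t → 4ℚ * (d * t ^ k)) d≡ga ⟩
        4ℚ * (d * (g * a) ^ k)      ≡⟨ cong (λ t → 4ℚ * (d * t)) (^-distrib-* g a k) ⟩
        4ℚ * (d * (g ^ k * a ^ k))  ≡⟨ l d (g ^ k) (a ^ k) ⟩
        a ^ k * (4ℚ * g ^ k * d)    ∎)
        where
        open ≤-Reasoning
        l : ∀ d p q → 4ℚ * (d * (p * q)) ≡ q * (4ℚ * p * d)
        l = solve-∀ ring

      b : ℚ
      b = ℓ * Δ ^ k * 2ℚ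

      0≤b : 0ℚ ≤ b
      0≤b = 0≤fromℕ (suc k) *₀ 0≤^ k 0≤Δ *₀ 0≤2

      -- `b` is of order `d ^ k`, one factor `d` short of `N`; `d-large` says that this factor
      -- outweighs the constants.
      b≤ρN : b ≤ ρ * N
      b≤ρN = begin
        ℓ * (C * d) ^ k * 2ℚ           ≡⟨ cong (λ t → ℓ * t * 2ℚ) (^-distrib-* C d k) ⟩
        ℓ * (C ^ k * d ^ k) * 2ℚ       ≡⟨ l₁ ℓ (C ^ k) (d ^ k) ⟩
        ℓ * C ^ k * 2ℚ * d ^ k         ≤⟨ *-monoʳ (d ^ k) (0≤^ k 0≤d) d-large ⟩
        ρ * d * d ^ k                  ≡⟨ *-assoc ρ d (d ^ k) ⟩
        ρ * d ^ suc k                  ≤⟨ *-monoˡ ρ 0≤ρ upper ⟩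
        ρ * N                          ∎
        where
        open ≤-Reasoning
        l₁ : ∀ ℓ p q → ℓ * (p * q) * 2ℚ ≡ ℓ * p * 2ℚ * q
        l₁ = solve-∀ ring

      H-walks≤ : ∀ f → (∀ v → 0ℚ ≤ f v) → (∀ v → f v ≤ 2ℚ) → ∀ u → A^ (suc k) f u ≤ ∑ f + b
      H-walks≤ f 0≤f f≤2 = walks≤∑ H-parts {suc k} H-free 0≤Δ deg≤Δ 0≤2 0≤f f≤2

      open WalkBound H {k} {b} {D} 0<D total≡ND 0<N H-walks≤ using (module Mixing)

      open Mixing {ρ} {ρ} {ε} 0<ε 0≤b b≤ρN 0≤ρ 4ρ≤1 0≤ρ ρ≤1 2q≥ ρ-small using (mixing)

      d-D≤ : d - D ≤ 2ℚ * η * d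
      d-D≤ = ≤-by (D - (1ℚ - 2ℚ * η) * d) (l D η d) (0≤- D≥)
        where
        l : ∀ D η d → 2ℚ * η * d - (d - D) ≡ D - (1ℚ - 2ℚ * η) * d
        l = solve-∀ ring

      module _ {i : ℚ} (0≤i : 0ℚ ≤ i) (iN≡2 : i * N ≡ 2ℚ) {S T : Subset n} (S⊆X : S ⊆ X) (T⊆Y : T ⊆ Y) where

        s t M μ : ℚ
        s = card S
        t = card T
        M = (2ℚ * ε + ρ + 4ℚ * ρ) * N * D
        μ = edges H S T - i * D * s * t

        mixing-H : ∣ μ ∣ ≤ M
        mixing-H = mixing H-parts {i} iN≡2 S⊆X T⊆Y

        M≤ : M ≤ (2ℚ * ε + ρ + 4ℚ * ρ) * N * d
        M≤ = *-monoˡ ((2ℚ * ε + ρ + 4ℚ * ρ) * N) ((0≤2 *₀ <⇒≤ 0<ε +₀ 0≤ρ +₀ 0≤4 *₀ 0≤ρ) *₀ 0≤N) D≤d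

        e-loss : ℚ
        e-loss = edges G S T - edges H S T

        0≤e-loss : 0ℚ ≤ e-loss
        0≤e-loss = 0≤- (edges-⊆ᴳ {H = H} {G} H⊆G S T)

        e-loss≤ : e-loss ≤ 4ℚ * η * N * d
        e-loss≤ = begin
          e-loss                     ≤⟨ edges-loss {H = H} {G} H⊆G S T ⟩
          total G - total H          ≡⟨ cong₂ _-_ total≡Nd total≡ND ⟩
          N * d - N * D              ≡⟨ l₁ N d D ⟩
          N * (d - D)                ≤⟨ *-monoˡ N 0≤N d-D≤ ⟩
          -- A factor 2 is given away to match `main-loss≤`.
          N * (2ℚ * η * d)           ≤⟨ ≤-by (N * (2ℚ * η * d)) (l₂ N η d) (0≤N *₀ (0≤2 *₀ 0≤η *₀ 0≤d)) ⟩
          4ℚ * η * N * d             ∎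
          where
          open ≤-Reasoning
          l₁ : ∀ N d D → N * d - N * D ≡ N * (d - D)
          l₁ = solve-∀ ring
          l₂ : ∀ N η d → 4ℚ * η * N * d - N * (2ℚ * η * d) ≡ N * (2ℚ * η * d)
          l₂ = solve-∀ ring

        main-loss : ℚ
        main-loss = (d - D) * (i * (s * t))

        0≤main-loss : 0ℚ ≤ main-loss
        0≤main-loss = 0≤- D≤d *₀ (0≤i *₀ (0≤card S *₀ 0≤card T))

        main-loss≤ : main-loss ≤ 4ℚ * η * N * d
        main-loss≤ = begin
          (d - D) * (i * (s * t))        ≤⟨ *-mono (0≤- D≤d) d-D≤ (0≤i *₀ (0≤card S *₀ 0≤card T))
                                              (*-monoˡ i 0≤i (*-mono (0≤card S) (card≤n S) (0≤card T) (card≤n T))) ⟩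
          2ℚ * η * d * (i * (N * N))     ≡⟨ l₁ η d i N ⟩
          2ℚ * η * d * (i * N * N)       ≡⟨ cong (λ p → 2ℚ * η * d * (p * N)) iN≡2 ⟩
          2ℚ * η * d * (2ℚ * N)          ≡⟨ l₂ η d N ⟩
          4ℚ * η * N * d                 ∎
          where
          open ≤-Reasoning
          l₁ : ∀ η d i N → 2ℚ * η * d * (i * (N * N)) ≡ 2ℚ * η * d * (i * N * N)
          l₁ = solve-∀ ring
          l₂ : ∀ η d N → 2ℚ * η * d * (2ℚ * N) ≡ 4ℚ * η * N * d
          l₂ = solve-∀ ring

        decompose-G : edges G S T - i * d * s * t ≡ e-loss + μ - main-loss
        decompose-G = l (edges G S T) (edges H S T) i d D s t
          where
          l : ∀ g h i d D s t → g - i * d * s * t ≡ (g - h) + (h - i * D * s * t) - (d - D) * (i * (s * t))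
          l = solve-∀ ring

        -- Both losses from trimming are nonnegative and enter with opposite signs, so for either
        -- sign of the error only one of them has to be paid.
        mixing-G : ∣ edges G S T - i * d * s * t ∣ ≤ (2ℚ * ε + ρ + 4ℚ * ρ + 4ℚ * η) * N * d
        mixing-G = subst (λ p → ∣ p ∣ ≤ (2ℚ * ε + ρ + 4ℚ * ρ + 4ℚ * η) * N * d) (sym decompose-G)
          (∣ e-loss + μ - main-loss ∣≤
            (≤-by ((4ℚ * η * N * d - e-loss) + ((2ℚ * ε + ρ + 4ℚ * ρ) * N * d - μ) + main-loss)
              (l₁ ε ρ η N d e-loss μ main-loss)
              (0≤- e-loss≤ +₀ 0≤- (≤-trans (p≤∣p∣ μ) (≤-trans mixing-H M≤)) +₀ 0≤main-loss))
            (≤-by ((4ℚ * η * N * d - main-loss) + ((2ℚ * ε + ρ + 4ℚ * ρ) * N * d - - μ) + e-loss)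
              (l₂ ε ρ η N d e-loss μ main-loss)
              (0≤- main-loss≤ +₀ 0≤- (≤-trans (-p≤∣p∣ μ) (≤-trans mixing-H M≤)) +₀ 0≤e-loss)))
          where
          l₁ : ∀ ε ρ η N d a m c → (2ℚ * ε + ρ + 4ℚ * ρ + 4ℚ * η) * N * d - (a + m - c) ≡
            (4ℚ * η * N * d - a) + ((2ℚ * ε + ρ + 4ℚ * ρ) * N * d - m) + c
          l₁ = solve-∀ ring
          l₂ : ∀ ε ρ η N d a m c → (2ℚ * ε + ρ + 4ℚ * ρ + 4ℚ * η) * N * d - - (a + m - c) ≡
            (4ℚ * η * N * d - c) + ((2ℚ * ε + ρ + 4ℚ * ρ) * N * d - - m) + a
          l₂ = solve-∀ ring

-- Choice of the constants and passage to sequences of graphs.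

open import Data.Fin.Subset using (Subset; _⊆_; ∣_∣)
open import Data.Integer using (+_)
open import Data.Nat using (ℕ; NonZero; _≤_)
open import Data.Rational as ℚ using (ℚ; 0ℚ; _/_; _*_; _-_)
open import Data.Nat as ℕ using (zero; suc)
open Rationals
open FiniteSums
open WalkCounts
open BipartiteMixing
open Quantitative
import Data.Nat.Properties as ℕₚ
open import Data.Rational using (1ℚ; _+_; ½; _⊓_)
open import Data.Rational.Properties hiding (≤-refl)
open import Data.Product using (_,_; proj₁; proj₂)
open import Relation.Binary.PropositionalEquality
open import Tactic.RingSolver using (solve-∀)

signedPow-nonneg : ∀ k {q} → 0ℚ ℚ.≤ q → signedPow (suc k) q ≡ q ^ suc k
signedPow-nonneg k {q} 0≤q = cong (λ p → q * p ^ k) (0≤p⇒∣p∣≡p 0≤q)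

theorem5p1 :
    (ℓ : ℕ) → 2 ≤ ℓ →
    (n : ℕ → ℕ) .{{_ : ∀ {k} → NonZero (n k)}} → TendsToInfinity n →
    (G : ∀ k → Graph (n k)) (X Y : ∀ k → Subset (n k)) →
    (∀ k → HasParts (G k) (X k) (Y k)) →
    (∀ k → EvenCycleFree ℓ (G k)) →
    (λ k → avgDegree (G k)) ∼ (λ k → (+ n k / 2) ^1/ ℓ) →
    ∀ ε → 0ℚ ℚ.< ε → Eventually λ k →
      ∀ (S T : Subset (n k)) → S ⊆ X k → T ⊆ Y k →
        ℚ.∣ fromℕ (e (G k) S T)
            - (+ 2 / n k) * avgDegree (G k) * fromℕ ∣ S ∣ * fromℕ ∣ T ∣ ∣
          ≤ʳ ε · fromℕ (n k) · fromℕ (n k) ^1/ ℓ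
theorem5p1 zero    ()
theorem5p1 (suc k) _ n n→∞ G X Y parts free d∼ ε 0<ε = K , bound
  where
  open ≤-Reasoning

  ε₁ P m ρ ℓ s η g r B L : ℚ
  -- In the final error `2ℚ * ε₁ + ρ + 4ℚ * ρ + 4ℚ * η` the first term takes half of `ε`.
  ε₁ = ½ * (½ * ε)
  P = (ε₁ * ε₁) ^ suc k
  m = 1ℚ ⊓ (ε ⊓ P)
  -- 72 is 8 · 3 · 3, which makes the left side of `ρ-small` equal to `m`. The three terms of the
  -- minimum `m` serve `4ρ≤1`, `small` and `ρ-small`.
  ρ = (+ 1 / 72) * m
  ℓ = fromℕ (suc k)

  0<ε₁ : 0ℚ ℚ.< ε₁
  0<ε₁ = 0<* (positive⁻¹ ½) (0<* (positive⁻¹ ½) 0<ε)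

  0<⊓ : ∀ {p q} → 0ℚ ℚ.< p → 0ℚ ℚ.< q → 0ℚ ℚ.< p ⊓ q
  0<⊓ {p} {q} 0<p 0<q = ⊓-pos (⊓-sel p q)
    where
    open import Data.Sum using (_⊎_; inj₁; inj₂)
    ⊓-pos : p ⊓ q ≡ p ⊎ p ⊓ q ≡ q → 0ℚ ℚ.< p ⊓ q
    ⊓-pos (inj₁ eq) = subst (0ℚ ℚ.<_) (sym eq) 0<p
    ⊓-pos (inj₂ eq) = subst (0ℚ ℚ.<_) (sym eq) 0<q

  0<m : 0ℚ ℚ.< m
  0<m = 0<⊓ 0<1 (0<⊓ 0<ε (0<^ (suc k) (0<* 0<ε₁ 0<ε₁)))

  m≤1 : m ℚ.≤ 1ℚ
  m≤1 = p⊓q≤p 1ℚ (ε ⊓ P)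

  m≤ε : m ℚ.≤ ε
  m≤ε = ≤-trans (p⊓q≤q 1ℚ (ε ⊓ P)) (p⊓q≤p ε P)

  m≤P : m ℚ.≤ P
  m≤P = ≤-trans (p⊓q≤q 1ℚ (ε ⊓ P)) (p⊓q≤q ε P)

  0<ρ : 0ℚ ℚ.< ρ
  0<ρ = 0<* (positive⁻¹ (+ 1 / 72)) 0<m

  4ρ≤1 : 4ℚ * ρ ℚ.≤ 1ℚ
  4ρ≤1 = ≤-by ((1ℚ - m) + (+ 68 / 72) * m) (l m) (0≤- m≤1 +₀ nonNegative⁻¹ (+ 68 / 72) *₀ <⇒≤ 0<m)
    where
    l : ∀ m → 1ℚ - 4ℚ * ((+ 1 / 72) * m) ≡ (1ℚ - m) + (+ 68 / 72) * m
    l = solve-∀ ring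

  ρ-small : 8ℚ * (3ℚ * (ρ + 2ℚ * ρ)) ℚ.≤ P
  ρ-small = subst (ℚ._≤ P) (l m) m≤P
    where
    l : ∀ m → m ≡ 8ℚ * (3ℚ * ((+ 1 / 72) * m + 2ℚ * ((+ 1 / 72) * m)))
    l = solve-∀ ring

  1/3ℓ = inverse (0<* (0<fromℕ (suc k)) (positive⁻¹ 3ℚ))
  s = proj₁ 1/3ℓ
  η = ρ * s

  0<η : 0ℚ ℚ.< η
  0<η = 0<* 0<ρ (proj₁ (proj₂ 1/3ℓ))

  3ℓη≡ρ : ℓ * (3ℚ * η) ≡ ρ
  3ℓη≡ρ = trans (l ℓ ρ s) (trans (cong (ρ *_) (proj₂ (proj₂ 1/3ℓ))) (*-identityʳ ρ))
    where
    l : ∀ ℓ ρ s → ℓ * (3ℚ * (ρ * s)) ≡ ρ * (s * (ℓ * 3ℚ))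
    l = solve-∀ ring

  1/η = inverse 0<η
  g = 2ℚ * proj₁ 1/η

  0<g : 0ℚ ℚ.< g
  0<g = 0<* (positive⁻¹ 2ℚ) (proj₁ (proj₂ 1/η))

  gη≡2 : g * η ≡ 2ℚ
  gη≡2 = trans (*-assoc 2ℚ (proj₁ 1/η) η) (trans (cong (2ℚ *_) (proj₂ (proj₂ 1/η))) (*-identityʳ 2ℚ))

  module Fixed = Constants k {ε₁} {ρ} {η} {g} 0<ε₁ 0<ρ 4ρ≤1 0<η 3ℓη≡ρ ρ-small 0<g gη≡2
  open Fixed using (0≤2; 0≤4; 0≤ρ; 0≤η; 0≤1-η; 3η≤ρ; [1+η]^≤2; N≤4d^; C; 0≤C)

  1/ρ = inverse 0<ρ
  r = proj₁ 1/ρ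
  B = ℓ * C ^ k * 2ℚ
  -- A degree `d` above both summands is large enough: `η * g` is 2, which gives `2≤ηd`, and `ρ * r`
  -- is 1, which gives `d-large`.
  L = g + r * B

  0≤B : 0ℚ ℚ.≤ B
  0≤B = 0≤fromℕ (suc k) *₀ 0≤^ k 0≤C *₀ 0≤2

  0≤rB : 0ℚ ℚ.≤ r * B
  0≤rB = <⇒≤ (proj₁ (proj₂ 1/ρ)) *₀ 0≤B

  0<L : 0ℚ ℚ.< L
  0<L = +-mono-<-≤ 0<g 0≤rB

  M M′ K₁ K : ℕ
  -- `M′` makes `N` at least `4ℚ * L ^ suc k`, hence `d` at least `L`; `K₁` puts `d` within the
  -- factors `1 - η` and `1 + η` of its asymptotic value. Both are fixed before `S` and `T`, so the
  -- error is uniform.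
  M = proj₁ (archimedean (4ℚ * L ^ suc k))
  M′ = proj₁ (n→∞ M)
  K₁ = proj₁ (d∼ η 0<η)
  K = K₁ ℕ.⊔ M′

  module _ (j : ℕ) (K₁≤j : K₁ ≤ j) (M′≤j : M′ ≤ j) where

    N d h : ℚ
    N = fromℕ (n j)
    d = avgDegree (G j)
    h = + n j / 2

    0<N : 0ℚ ℚ.< N
    0<N = 0<fromℕ (n j)

    0≤N : 0ℚ ℚ.≤ N
    0≤N = <⇒≤ 0<N

    2h≡N : 2ℚ * h ≡ N
    2h≡N = trans (*-comm 2ℚ h) (/-*-cancel (n j) 2)

    0≤d : 0ℚ ℚ.≤ d
    0≤d = *-cancelˡ N 0<N (subst₂ ℚ._≤_ (sym (*-zeroʳ N)) (total≡ (G j))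
      (0≤∑ (Adjacency.0≤deg (G j))))

    lower : (1ℚ - η) ^ suc k * N ℚ.≤ 2ℚ * d ^ suc k
    lower = begin
      (1ℚ - η) ^ suc k * N           ≡⟨ cong ((1ℚ - η) ^ suc k *_) 2h≡N ⟨
      (1ℚ - η) ^ suc k * (2ℚ * h)    ≡⟨ l ((1ℚ - η) ^ suc k) h ⟩
      2ℚ * ((1ℚ - η) ^ suc k * h)    ≤⟨ *-monoˡ 2ℚ 0≤2 (subst₂ ℚ._≤_
                                          (cong (_* h) (trans (cong (signedPow (suc k)) (*-identityʳ (1ℚ - η))) (signedPow-nonneg k 0≤1-η)))
                                          (signedPow-nonneg k 0≤d) (proj₁ (proj₂ (d∼ η 0<η) j K₁≤j))) ⟩
      2ℚ * d ^ suc k                 ∎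
      where
      l : ∀ p h → p * (2ℚ * h) ≡ 2ℚ * (p * h)
      l = solve-∀ ring

    -- The asymptotic value is `N / 2`, so a factor 2 is left to absorb the power of `1 + η`.
    upper : d ^ suc k ℚ.≤ N
    upper = begin
      d ^ suc k                 ≤⟨ subst₂ ℚ._≤_ (signedPow-nonneg k 0≤d)
                                     (cong (_* h) (trans (cong (signedPow (suc k)) (*-identityʳ (1ℚ + η))) (signedPow-nonneg k (0≤1 +₀ 0≤η))))
                                     (proj₂ (proj₂ (d∼ η 0<η) j K₁≤j)) ⟩
      (1ℚ + η) ^ suc k * h      ≤⟨ *-monoʳ h (nonNegative⁻¹ h {{normalize-nonNeg (n j) 2}}) [1+η]^≤2 ⟩
      2ℚ * h                    ≡⟨ 2h≡N ⟩
      N                         ∎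

    L≤d : L ℚ.≤ d
    L≤d = ^-cancelˡ k 0≤d (*-cancelˡ 4ℚ (positive⁻¹ 4ℚ) (begin
      4ℚ * L ^ suc k    ≤⟨ proj₂ (archimedean (4ℚ * L ^ suc k)) ⟩
      fromℕ M           ≤⟨ fromℕ-mono (proj₂ (n→∞ M) j M′≤j) ⟩
      N                 ≤⟨ N≤4d^ {N} {d} 0≤N lower ⟩
      4ℚ * d ^ suc k    ∎))

    2≤ηd : 2ℚ ℚ.≤ η * d
    2≤ηd = begin
      2ℚ         ≡⟨ trans (*-comm η g) gη≡2 ⟨
      η * g      ≤⟨ *-monoˡ η 0≤η (≤-trans (≤-by (r * B) (l g (r * B)) 0≤rB) L≤d) ⟩
      η * d      ∎
      where
      l : ∀ g p → g + p - g ≡ p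
      l = solve-∀ ring

    d-large : B ℚ.≤ ρ * d
    d-large = begin
      B                ≡⟨ trans (cong (_* B) (proj₂ (proj₂ 1/ρ))) (*-identityˡ B) ⟨
      r * ρ * B        ≡⟨ l₁ r ρ B ⟩
      ρ * (r * B)      ≤⟨ *-monoˡ ρ 0≤ρ (≤-trans (≤-by g (l₂ g (r * B)) (<⇒≤ 0<g)) L≤d) ⟩
      ρ * d             ∎
      where
      l₁ : ∀ r ρ b → r * ρ * b ≡ ρ * (r * b)
      l₁ = solve-∀ ring
      l₂ : ∀ g p → g + p - p ≡ g
      l₂ = solve-∀ ring

    i : ℚ
    i = + 2 / n j

    module _ (S T : Subset (n j)) (S⊆X : S ⊆ X j) (T⊆Y : T ⊆ Y j) where

      v : ℚ
      v = fromℕ (e (G j) S T) - i * d * fromℕ ∣ S ∣ * fromℕ ∣ T ∣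

      ∣v∣≤ : ℚ.∣ v ∣ ℚ.≤ ε * N * d
      ∣v∣≤ = begin
        ℚ.∣ v ∣
          ≡⟨ cong ℚ.∣_∣ (cong₂ _-_ (fromℕ-e (G j) S T) (cong₂ (λ a b → i * d * a * b) (fromℕ-∣∣ S) (fromℕ-∣∣ T))) ⟩
        ℚ.∣ edges (G j) S T - i * d * card S * card T ∣
          ≤⟨ Fixed.Trimmed.mixing-G (G j) (parts j) (free j) (total≡ (G j)) (<-≤-trans 0<L L≤d) lower upper 2≤ηd d-large
               {i} (nonNegative⁻¹ i {{normalize-nonNeg 2 (n j)}}) (/-*-cancel 2 (n j)) S⊆X T⊆Y ⟩
        (2ℚ * ε₁ + ρ + 4ℚ * ρ + 4ℚ * η) * N * d
          ≤⟨ *-monoʳ d 0≤d (*-monoʳ N 0≤N small) ⟩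
        ε * N * d ∎
        where
        small : 2ℚ * ε₁ + ρ + 4ℚ * ρ + 4ℚ * η ℚ.≤ ε
        small = ≤-by (½ * (ε - m) + 4ℚ * (ρ - 3ℚ * η) + 8ℚ * η + (+ 27 / 72) * m) (l ε m η)
          (nonNegative⁻¹ ½ *₀ 0≤- m≤ε +₀ 0≤4 *₀ 0≤- 3η≤ρ +₀ nonNegative⁻¹ 8ℚ *₀ 0≤η
            +₀ nonNegative⁻¹ (+ 27 / 72) *₀ <⇒≤ 0<m)
          where
          l : ∀ ε m η → ε - (2ℚ * (½ * (½ * ε)) + (+ 1 / 72) * m + 4ℚ * ((+ 1 / 72) * m) + 4ℚ * η) ≡
            ½ * (ε - m) + 4ℚ * ((+ 1 / 72) * m - 3ℚ * η) + 8ℚ * η + (+ 27 / 72) * m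
          l = solve-∀ ring

      final : signedPow (suc k) ℚ.∣ v ∣ ℚ.≤ signedPow (suc k) (ε * (N * 1ℚ)) * N
      final = begin
        signedPow (suc k) ℚ.∣ v ∣                 ≡⟨ signedPow-nonneg k (0≤∣p∣ v) ⟩
        ℚ.∣ v ∣ ^ suc k                           ≤⟨ ^-monoˡ (suc k) (0≤∣p∣ v) ∣v∣≤ ⟩
        (ε * N * d) ^ suc k                       ≡⟨ ^-distrib-* (ε * N) d (suc k) ⟩
        -- Here `upper` turns the bound by a multiple of `d` into one by the ℓ-th root of `N`.
        (ε * N) ^ suc k * d ^ suc k               ≤⟨ *-monoˡ ((ε * N) ^ suc k) (0≤^ (suc k) 0≤εN) upper ⟩
        (ε * N) ^ suc k * N                       ≡⟨ cong (_* N) (signedPow-nonneg k 0≤εN) ⟨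
        signedPow (suc k) (ε * N) * N
          ≡⟨ cong (λ p → signedPow (suc k) (ε * p) * N) (*-identityʳ N) ⟨
        signedPow (suc k) (ε * (N * 1ℚ)) * N      ∎
        where
        0≤εN = <⇒≤ 0<ε *₀ 0≤N

  bound : ∀ j → K ≤ j → _
  bound j K≤j S T S⊆X T⊆Y = final j K₁≤j M′≤j S T S⊆X T⊆Y
    where
    K₁≤j = ℕₚ.≤-trans (ℕₚ.m≤m⊔n K₁ M′) K≤j
    M′≤j = ℕₚ.≤-trans (ℕₚ.m≤n⊔m K₁ M′) K≤j
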